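{- Let $\Sigma$ be a finite alphabet and let $L\subseteq\Sigma^{\circledast}$. (a) For every $n\ge0$, $L$ is definable in $\mathrm{FO}[(\infty_j)_{j\le n}]$ if and only if $L$ is recognized by a finite block product of copies of $\Delta_n$. (b) $L$ is definable in $\mathrm{FO}[\infty]$ if and only if $L$ is recognized by a finite block product of $\circledast$-algebras from $\{\Delta_n\mid n\in\mathbb N\}$.
   Context: Words. A (countable) word over a set $A$ is a map $w$ from a countable, possibly empty, linear ordering $\mathrm{dom}(w)$ to $A$, taken up to isomorphism; $A^{\circledast}$ is the set of all such words (including the empty word $\varepsilon$). For words $(w_i)_{i\in\alpha}$ indexed by a countable linear ordering $\alpha$, $\prod_{i\in\alpha}w_i$ is their generalized concatenation. $w^{\omega}$ and $w^{\omega^*}$ are the concatenations of copies of $w$ indexed by $(\mathbb N,<)$ and $(-\mathbb N,<)$. For a finite nonempty set $E$, the perfect shuffle $E^{\eta}$ is the (unique up to isomorphism) word of domain $(\mathbb Q,<)$ using only letters of $E$ in which every nonempty non-singleton interval contains every letter of $E$. Algebra. A $\circledast$-monoid $(M,\mathrm{id},\pi)$ is a set $M$ with a map $\pi:M^{\circledast}\to M$ such that $\pi(a)=a$ for $a\in M$, $\pi(\prod_{i\in\alpha}u_i)=\pi(\prod_{i\in\alpha}\pi(u_i))$ for all countable linear orderings $\alpha$ and words $u_i$ over $M$, and $\mathrm{id}=\pi(\varepsilon)$. It induces the $\circledast$-algebra $(M,\mathrm{id},\cdot,\tau,\tau^*,\kappa)$ with $a\cdot b=\pi(ab)$, $a^{\tau}=\pi(a^{\omega})$,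 $a^{\tau^*}=\pi(a^{\omega^*})$, $E^{\kappa}=\pi(E^{\eta})$ for nonempty finite $E\subseteq M$. A finite $\circledast$-monoid is determined by its $\circledast$-algebra, and the two are identified. A morphism $h:M\to M'$ satisfies $h(\pi(w))=\pi'(\bar h(w))$, where $\bar h$ is the letterwise extension of $h$. $\Sigma^{\circledast}$ with generalized concatenation is the free $\circledast$-monoid over $\Sigma$. $L\subseteq\Sigma^{\circledast}$ is recognized by $M$ if there is a morphism $h:\Sigma^{\circledast}\to M$ with $L=h^{ -1}(h(L))$. Block product. For $\circledast$-monoids $M$, $N$, let $K=N^{M\times M}$ (direct power of $N$, with pointwise product $\pi_K$), with left and right actions of $M$ given by $(m*f)(m_1,m_2)=f(m_1\cdot m,m_2)$ and $(f*m)(m_1,m_2)=f(m_1,m\cdot m_2)$. The block product $M\,\Box\,N$ is the semidirect product of $M$ and $K$ for these actions: its underlying set is $M\times K$, and a word $u$ with domain $\alpha$ and $u(x)=(m_x,f_x)$ has product $\big(\pi_M(\prod_{x\in\alpha}m_x),\ \pi_K(\prod_{x\in\alpha}\,p_x*f_x*q_x)\big)$, where $p_x=\pi_M(\prod_{y<x}m_y)$ and $q_x=\pi_M(\prod_{y>x}m_y)$. A finite block product of members of a class $B$ is an element of the smallest class containing $B$ and closed under $\Box$ (i.e. a finitely iterated block product of copies of members of $B$). $\Delta_n$ is the (finite) $\circledast$-algebra with underlying set $\{\mathrm{id},0,1,\dots,n\}$, identity $\mathrm{id}$, $i\cdot j=\max(i,j)$ and $i^{\tau}=i^{\tau^*}=\min(i+1,n)$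 for $i,j\in\{0,\dots,n\}$, $\mathrm{id}^{\tau}=\mathrm{id}^{\tau^*}=\{\mathrm{id}\}^{\kappa}=\mathrm{id}$, and $S^{\kappa}=n$ whenever $S\setminus\{\mathrm{id}\}\neq\emptyset$. Infinitary rank. Let $\mathcal I_0$ be the set of nonempty finite linear orderings. For $n\ge1$, $\mathcal I_n$ is the set of (nonempty) orderings of the form $\sum_{i\in\mathbb Z}\alpha_i$ with each $\alpha_i\in\mathcal I_{n-1}$ or empty, closed under finite sums. $\mathcal I\text{ - }\mathit{rank}(\alpha)$ is the least $n$ with $\alpha\in\mathcal I_n$, and is infinite if no such $n$ exists. Logic. Formulas of $\mathrm{FO}[(\infty_j)_{j\le n}]$ are built from $x<y$, $a(x)$ ($a\in\Sigma$; "position $x$ carries letter $a$"), boolean connectives, $\exists x$, and $\exists^{\infty_j}x$ for $0\le j\le n$; all variables range over positions. Semantics: $w,s\models\exists^{\infty_j}x\,\varphi$ iff there is $X\subseteq\mathrm{dom}(w)$ with $\mathcal I\text{ - }\mathit{rank}(X)=j$ (for the induced ordering) and $w,s[x=i]\models\varphi$ for all $i\in X$. $\mathrm{FO}[\infty]$ allows all quantifiers $\exists^{\infty_j}$, $j\in\mathbb N$. A language is definable in a logic if it is the set of words satisfying some sentence of the logic. -}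

module Defs where

open import Level using (Level; Lift; 0ℓ; _⊔_) renaming (suc to lsuc)
open import Data.Bool.Base using (if_then_else_)
open import Data.Bool.ListAction using (all)
open import Data.Fin.Base as Fin using (Fin; zero; suc)
import Data.Fin.Properties as Fin
open import Data.Integer.Base as ℤ using (ℤ; +_; -[1+_])
import Data.Integer.Properties as ℤ
open import Data.Irrelevant using ([_])
import Data.List.Membership.Setoid as Membership
open import Data.List.NonEmpty.Base as List⁺ using (List⁺; toList)
open import Data.Maybe.Base using (Maybe; just; nothing; is-nothing)
open import Data.Nat.Base as ℕ using (ℕ; zero; suc; s≤s; z≤n)
import Data.Nat.Properties as ℕ
open import Data.Product.Base using (Σ; Σ-syntax; ∃; _×_; _,_; proj₁; proj₂)
open import Data.Product.Relation.Binary.Pointwise.NonDependent using (×-setoid)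
open import Data.Rational.Base as ℚ using (ℚ; mkℚ)
import Data.Rational.Properties as ℚ
open import Data.Refinement using (Refinement-syntax; _,_; value)
open import Data.Refinement.Properties using (value-injective)
open import Data.Sum.Base using (_⊎_)
open import Data.Vec.Base as Vec using (Vec; []; _∷_; lookup)
open import Function.Base using (_∘_; _on_; flip)
open import Function.Bundles using (Func; _⟨$⟩_; Inverse; Injection; _↣_; _↔_; _⇔_; mk↣)
import Function.Relation.Binary.Setoid.Equality as FunctionSetoid
open import Relation.Binary.Bundles using (Setoid)
open import Relation.Binary.Core using (Rel)
open import Relation.Binary.Definitions using (_Respects_; tri<; tri≈; tri>; Trichotomous)
import Relation.Binary.Construct.Flip.EqAndOrd as Flip
open import Relation.Binary.Morphism.Structures using (IsOrderIsomorphism)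
open import Relation.Binary.PropositionalEquality as ≡ using (_≡_; _≢_; refl; cong)
import Relation.Binary.Reasoning.Setoid as SetoidReasoning
open import Relation.Binary.Structures using (IsStrictTotalOrder)
open import Relation.Nullary.Decidable.Core using (does; recompute)
open import Relation.Nullary.Negation.Core using (¬_; contradiction; contradiction-irr)
open import Relation.Unary using (Pred; _∈_)

private
  variable
    a b c ℓ c₁ ℓ₁ c₂ ℓ₂ : Level
    A B : Set a

------------------------------------------------------------------------
-- Countable linear orderings

-- Trichotomy and the enumeration are data; under excluded middle this is
-- no restriction on the countable linear orders covered.
record CountableOrder : Set₁ where
  infix 4 _<_
  field
    Carrier            : Set
    _<_                : Rel Carrier 0ℓ
    isStrictTotalOrder : IsStrictTotalOrder _≡_ _<_
    countable          : Carrier ↣ ℕ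

  open IsStrictTotalOrder isStrictTotalOrder public
    using (compare; irrefl; asym; _<?_) renaming (trans to <-trans)

∣_∣ : CountableOrder → Set
∣_∣ = CountableOrder.Carrier

infix 4 _≅_
record _≅_ (α β : CountableOrder) : Set where
  private
    module α = CountableOrder α
    module β = CountableOrder β
  field
    to                 : ∣ α ∣ → ∣ β ∣
    isOrderIsomorphism : IsOrderIsomorphism _≡_ _≡_ α._<_ β._<_ to

  open IsOrderIsomorphism isOrderIsomorphism public using (mono; cancel; injective)

  surj : ∀ y → ∃ λ x → to x ≡ y
  surj y with x , eq ← IsOrderIsomorphism.surjective isOrderIsomorphism y = x , eq refl

module _ {α β : CountableOrder} where
  private
    module α = CountableOrder α
    module β = CountableOrder β

  mk≅ : (to : ∣ α ∣ → ∣ β ∣) → (∀ {x y} → x α.< y → to x β.< to y) →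
        (∀ y → ∃ λ x → to x ≡ y) → α ≅ β
  mk≅ to mono surj = record
    { to                 = to
    ; isOrderIsomorphism = record
      { isOrderMonomorphism = record
        { isOrderHomomorphism = record { cong = cong to ; mono = mono }
        ; injective           = injective
        ; cancel              = cancel
        }
      ; surjective = λ y → proj₁ (surj y) , λ { refl → proj₂ (surj y) }
      }
    }
    where
    injective : ∀ {x y} → to x ≡ to y → x ≡ y
    injective {x} {y} eq with α.compare x y
    ... | tri< x<y _ _ = contradiction (mono x<y) (β.irrefl eq)
    ... | tri≈ _ x≡y _ = x≡y
    ... | tri> _ _ y<x = contradiction (mono y<x) (β.irrefl (≡.sym eq))

    cancel : ∀ {x y} → to x β.< to y → x α.< y
    cancel {x} {y} lt with α.compare x y
    ... | tri< x<y _ _  = x<y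
    ... | tri≈ _ refl _ = contradiction lt (β.irrefl refl)
    ... | tri> _ _ y<x  = contradiction (mono y<x) (β.asym lt)

≅-refl : ∀ {α} → α ≅ α
≅-refl = mk≅ (λ x → x) (λ p → p) (λ y → y , refl)

≅-sym : ∀ {α β} → α ≅ β → β ≅ α
≅-sym {α} {β} φ = mk≅ from from-mono (λ x → φ.to x , φ.injective (proj₂ (φ.surj (φ.to x))))
  where
  module φ = _≅_ φ
  module α = CountableOrder α
  module β = CountableOrder β
  from : ∣ β ∣ → ∣ α ∣
  from y = proj₁ (φ.surj y)
  from-mono : ∀ {x y} → x β.< y → from x α.< from y
  from-mono {x} {y} lt = φ.cancel
    (≡.subst₂ β._<_ (≡.sym (proj₂ (φ.surj x))) (≡.sym (proj₂ (φ.surj y))) lt)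

≅-trans : ∀ {α β γ} → α ≅ β → β ≅ γ → α ≅ γ
≅-trans {α} {β} {γ} φ ψ = mk≅ (ψ.to ∘ φ.to) (ψ.mono ∘ φ.mono) surj
  where
  module φ = _≅_ φ
  module ψ = _≅_ ψ
  surj : ∀ z → ∃ λ x → ψ.to (φ.to x) ≡ z
  surj z with y , refl ← ψ.surj z with x , refl ← φ.surj y = x , refl

------------------------------------------------------------------------
-- Concrete orderings

finite : ℕ → CountableOrder
finite n = record
  { Carrier            = Fin n
  ; _<_                = Fin._<_
  ; isStrictTotalOrder = Fin.<-isStrictTotalOrder
  ; countable          = mk↣ Fin.toℕ-injective
  }

ω : CountableOrder
ω = record
  { Carrier            = ℕ
  ; _<_                = ℕ._<_
  ; isStrictTotalOrder = ℕ.<-isStrictTotalOrder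
  ; countable          = mk↣ {to = λ n → n} λ eq → eq
  }

ω* : CountableOrder
ω* = record
  { Carrier            = ℕ
  ; _<_                = flip ℕ._<_
  ; isStrictTotalOrder = Flip.isStrictTotalOrder ℕ.<-isStrictTotalOrder
  ; countable          = mk↣ {to = λ n → n} λ eq → eq
  }

private
  pair : ℕ → ℕ → ℕ
  pair m n = (m ℕ.+ n) ℕ.* (m ℕ.+ n) ℕ.+ m

  pair-< : ∀ m n m′ n′ → m ℕ.+ n ℕ.< m′ ℕ.+ n′ → pair m n ℕ.< pair m′ n′
  pair-< m n m′ n′ s<s′ = begin-strict
    s ℕ.* s ℕ.+ m              ≤⟨ ℕ.+-monoʳ-≤ (s ℕ.* s) (ℕ.m≤m+n m n) ⟩
    s ℕ.* s ℕ.+ s              ≡⟨ ℕ.+-comm (s ℕ.* s) s ⟩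
    suc s ℕ.* s                <⟨ ℕ.*-monoʳ-< (suc s) (ℕ.n<1+n s) ⟩
    suc s ℕ.* suc s            ≤⟨ ℕ.*-mono-≤ s<s′ s<s′ ⟩
    s′ ℕ.* s′                  ≤⟨ ℕ.m≤m+n (s′ ℕ.* s′) m′ ⟩
    s′ ℕ.* s′ ℕ.+ m′           ∎
    where
    open ℕ.≤-Reasoning
    s = m ℕ.+ n
    s′ = m′ ℕ.+ n′

  pair-injective : ∀ m n m′ n′ → pair m n ≡ pair m′ n′ → m ≡ m′ × n ≡ n′
  pair-injective m n m′ n′ eq with ℕ.<-cmp (m ℕ.+ n) (m′ ℕ.+ n′)
  ... | tri< lt _ _ = contradiction eq (ℕ.<⇒≢ (pair-< m n m′ n′ lt))
  ... | tri> _ _ gt = contradiction (≡.sym eq) (ℕ.<⇒≢ (pair-< m′ n′ m n gt))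
  ... | tri≈ _ s≡s′ _
    with refl ← ℕ.+-cancelˡ-≡ ((m′ ℕ.+ n′) ℕ.* (m′ ℕ.+ n′)) m m′
                  (≡.trans (cong (λ s → s ℕ.* s ℕ.+ m) (≡.sym s≡s′)) eq)
    = refl , ℕ.+-cancelˡ-≡ m n n′ s≡s′

  encodeℤ : ℤ → ℕ
  encodeℤ (+ n)    = pair 0 n
  encodeℤ -[1+ n ] = pair 1 n

  encodeℤ-injective : ∀ {i j} → encodeℤ i ≡ encodeℤ j → i ≡ j
  encodeℤ-injective {+ m}       {+ n}       eq = cong +_ (proj₂ (pair-injective 0 m 0 n eq))
  encodeℤ-injective {+ m}       { -[1+ n ]} eq with () ← proj₁ (pair-injective 0 m 1 n eq)
  encodeℤ-injective { -[1+ m ]} {+ n}       eq with () ← proj₁ (pair-injective 1 m 0 n eq)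
  encodeℤ-injective { -[1+ m ]} { -[1+ n ]} eq = cong -[1+_] (proj₂ (pair-injective 1 m 1 n eq))

  encodeℚ : ℚ → ℕ
  encodeℚ (mkℚ i d _) = pair (encodeℤ i) d

  encodeℚ-injective : ∀ {p q} → encodeℚ p ≡ encodeℚ q → p ≡ q
  encodeℚ-injective {mkℚ i d _} {mkℚ j e _} eq
    with eq₁ , refl ← pair-injective (encodeℤ i) d (encodeℤ j) e eq
    with refl ← encodeℤ-injective {i} {j} eq₁ = refl

ζ : CountableOrder
ζ = record
  { Carrier            = ℤ
  ; _<_                = ℤ._<_
  ; isStrictTotalOrder = ℤ.<-isStrictTotalOrder
  ; countable          = mk↣ encodeℤ-injective
  }

η : CountableOrder
η = record
  { Carrier            = ℚ
  ; _<_                = ℚ._<_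
  ; isStrictTotalOrder = ℚ.<-isStrictTotalOrder
  ; countable          = mk↣ encodeℚ-injective
  }

------------------------------------------------------------------------
-- Suborderings

-- Membership proofs are irrelevant, so that the suborder has one element
-- for each element of X.
infixl 7 _↾_
_↾_ : (α : CountableOrder) → Pred ∣ α ∣ 0ℓ → CountableOrder
α ↾ X = record
  { Carrier            = [ x ∈ ∣ α ∣ ∣ X x ]
  ; _<_                = α._<_ on value
  ; isStrictTotalOrder = record
    { isStrictPartialOrder = record
      { isEquivalence = ≡.isEquivalence
      ; irrefl        = λ { refl → α.irrefl refl }
      ; trans         = α.<-trans
      ; <-resp-≈      = (λ { refl lt → lt }) , (λ { refl lt → lt })
      }
    ; compare = compare
    }
  ; countable = mk↣ (value-injective ∘ Injection.injective α.countable)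
  }
  where
  module α = CountableOrder α
  compare : Trichotomous {A = [ x ∈ ∣ α ∣ ∣ X x ]} _≡_ (α._<_ on value)
  compare x y with α.compare (value x) (value y)
  ... | tri< lt ne gt = tri< lt (ne ∘ cong value) gt
  ... | tri≈ lt eq gt = tri≈ lt (value-injective eq) gt
  ... | tri> lt ne gt = tri> lt (ne ∘ cong value) gt

↾-cong : ∀ {α β} (φ : α ≅ β) {X : Pred ∣ α ∣ 0ℓ} {Y : Pred ∣ β ∣ 0ℓ} →
         (∀ {x} → X x → Y (_≅_.to φ x)) → (∀ {x} → Y (_≅_.to φ x) → X x) → α ↾ X ≅ β ↾ Y
↾-cong {α} {β} φ {X} {Y} X⇒Y Y⇒X = mk≅ to φ.mono surj
  where
  module φ = _≅_ φ
  to : ∣ α ↾ X ∣ → ∣ β ↾ Y ∣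
  to (x , [ p ]) = φ.to x , [ X⇒Y p ]
  surj : ∀ y → ∃ λ x → to x ≡ y
  surj (y , [ q ]) with x , refl ← φ.surj y = (x , [ Y⇒X q ]) , refl

------------------------------------------------------------------------
-- Ordered sums

module _ {I : Set} {F : I → Set} (_<ᵢ_ : Rel I 0ℓ) (_<ₓ_ : ∀ {i} → Rel (F i) 0ℓ) where

  data Lex : Rel (Σ I F) 0ℓ where
    fst< : ∀ {i j x y} → i <ᵢ j → Lex (i , x) (j , y)
    snd< : ∀ {i x y} → x <ₓ y → Lex (i , x) (i , y)

∑ : (α : CountableOrder) → (∣ α ∣ → CountableOrder) → CountableOrder
∑ α β = record
  { Carrier            = Σ[ i ∈ ∣ α ∣ ] ∣ β i ∣
  ; _<_                = _≺_
  ; isStrictTotalOrder = record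
    { isStrictPartialOrder = record
      { isEquivalence = ≡.isEquivalence
      ; irrefl        = λ { refl → ≺-irrefl }
      ; trans         = ≺-trans
      ; <-resp-≈      = (λ { refl lt → lt }) , (λ { refl lt → lt })
      }
    ; compare = compare
    }
  ; countable = mk↣ encode-injective
  }
  where
  module α = CountableOrder α
  module β {i} = CountableOrder (β i)

  _≺_ : Rel (Σ[ i ∈ ∣ α ∣ ] ∣ β i ∣) 0ℓ
  _≺_ = Lex α._<_ β._<_

  ≺-irrefl : ∀ {p} → ¬ p ≺ p
  ≺-irrefl (fst< i<i) = α.irrefl refl i<i
  ≺-irrefl (snd< x<x) = β.irrefl refl x<x

  ≺-trans : ∀ {p q r} → p ≺ q → q ≺ r → p ≺ r
  ≺-trans (fst< l) (fst< m) = fst< (α.<-trans l m)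
  ≺-trans (fst< l) (snd< m) = fst< l
  ≺-trans (snd< l) (fst< m) = fst< m
  ≺-trans (snd< l) (snd< m) = snd< (β.<-trans l m)

  ≺-asym : ∀ {p q} → p ≺ q → ¬ q ≺ p
  ≺-asym l m = ≺-irrefl (≺-trans l m)

  ≺⇒≢ : ∀ {p q} → p ≺ q → p ≢ q
  ≺⇒≢ l refl = ≺-irrefl l

  compare : Trichotomous _≡_ _≺_
  compare (i , x) (j , y) with α.compare i j
  ... | tri< l _ _ = tri< (fst< l) (≺⇒≢ (fst< l)) (≺-asym (fst< l))
  ... | tri> _ _ l = tri> (≺-asym (fst< l)) (≺⇒≢ (fst< l) ∘ ≡.sym) (fst< l)
  ... | tri≈ _ refl _ with β.compare x y
  ...   | tri< l _ _    = tri< (snd< l) (≺⇒≢ (snd< l)) (≺-asym (snd< l))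
  ...   | tri≈ _ refl _ = tri≈ ≺-irrefl refl ≺-irrefl
  ...   | tri> _ _ l    = tri> (≺-asym (snd< l)) (≺⇒≢ (snd< l) ∘ ≡.sym) (snd< l)

  encode : Σ[ i ∈ ∣ α ∣ ] ∣ β i ∣ → ℕ
  encode (i , x) = pair (Injection.to α.countable i) (Injection.to β.countable x)

  encode-injective : ∀ {p q} → encode p ≡ encode q → p ≡ q
  encode-injective {i , x} {j , y} eq
    with eq₁ , eq₂ ← pair-injective (Injection.to α.countable i) (Injection.to β.countable x)
                                    (Injection.to α.countable j) (Injection.to β.countable y) eq
    with refl ← Injection.injective α.countable eq₁
    with refl ← Injection.injective β.countable eq₂ = refl

∑-cong : ∀ {α α′} {β : ∣ α ∣ → CountableOrder} {β′ : ∣ α′ ∣ → CountableOrder} →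
         (φ : α ≅ α′) → (∀ i → β i ≅ β′ (_≅_.to φ i)) → ∑ α β ≅ ∑ α′ β′
∑-cong {α} {α′} {β} {β′} φ ψ = mk≅ to mono surj
  where
  module φ = _≅_ φ
  module ψ {i} = _≅_ (ψ i)
  to : ∣ ∑ α β ∣ → ∣ ∑ α′ β′ ∣
  to (i , x) = φ.to i , ψ.to x
  mono : ∀ {p q} → CountableOrder._<_ (∑ α β) p q → CountableOrder._<_ (∑ α′ β′) (to p) (to q)
  mono (fst< l) = fst< (φ.mono l)
  mono (snd< l) = snd< (ψ.mono l)
  surj : ∀ q → ∃ λ p → to p ≡ q
  surj (j , y) with i , refl ← φ.surj j with x , refl ← ψ.surj y = (i , x) , refl

∑-assoc : ∀ α (β : ∣ α ∣ → CountableOrder) (γ : ∀ i → ∣ β i ∣ → CountableOrder) →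
          ∑ α (λ i → ∑ (β i) (γ i)) ≅ ∑ (∑ α β) (λ p → γ (proj₁ p) (proj₂ p))
∑-assoc α β γ = mk≅ to mono λ { ((i , x) , y) → (i , x , y) , refl }
  where
  to : ∣ ∑ α (λ i → ∑ (β i) (γ i)) ∣ → ∣ ∑ (∑ α β) (λ p → γ (proj₁ p) (proj₂ p)) ∣
  to (i , x , y) = (i , x) , y
  mono : ∀ {p q} → CountableOrder._<_ (∑ α (λ i → ∑ (β i) (γ i))) p q →
         CountableOrder._<_ (∑ (∑ α β) (λ p → γ (proj₁ p) (proj₂ p))) (to p) (to q)
  mono (fst< l)        = fst< (fst< l)
  mono (snd< (fst< l)) = fst< (snd< l)
  mono (snd< (snd< l)) = snd< l

------------------------------------------------------------------------
-- Words

-- Words are considered up to the relation _≋_ below (an isomorphism of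
-- domains matching the letters), since there are no quotients.
record Word (A : Set a) : Set (lsuc 0ℓ ⊔ a) where
  constructor word
  field
    dom    : CountableOrder
    letter : ∣ dom ∣ → A

open Word public

module _ (S : Setoid c ℓ) where
  private module S = Setoid S

  infix 4 _≋_
  record _≋_ (u v : Word S.Carrier) : Set ℓ where
    constructor _,_
    field
      dom≅    : dom u ≅ dom v
      letter≈ : ∀ x → letter u x S.≈ letter v (_≅_.to dom≅ x)

  wordSetoid : Setoid (lsuc 0ℓ ⊔ c) ℓ
  wordSetoid = record
    { Carrier       = Word S.Carrier
    ; _≈_           = _≋_
    ; isEquivalence = record
      { refl  = ≅-refl , λ _ → S.refl
      ; sym   = λ {u} {v} → ≋-sym {u} {v}
      ; trans = λ { (φ , p) (ψ , q) → ≅-trans φ ψ , λ x → S.trans (p x) (q (_≅_.to φ x)) }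
      }
    }
    where
    ≋-sym : ∀ {u v} → u ≋ v → v ≋ u
    ≋-sym {u} {v} (φ , p) = ≅-sym φ , λ y →
      S.trans (S.reflexive (cong (letter v) (≡.sym (proj₂ (_≅_.surj φ y))))) (S.sym (p _))

map : (A → B) → Word A → Word B
map f w = word (dom w) (f ∘ letter w)

fromVec : ∀ {n} → Vec A n → Word A
fromVec {n = n} v = word (finite n) (lookup v)

ε : Word A
ε = fromVec []

⟦_⟧ : A → Word A
⟦ x ⟧ = fromVec (x ∷ [])

⟦_⨾_⟧ : A → A → Word A
⟦ x ⨾ y ⟧ = fromVec (x ∷ y ∷ [])

constant : CountableOrder → A → Word A
constant α x = word α λ _ → x

∏ : (α : CountableOrder) → (∣ α ∣ → Word A) → Word A
∏ α u = word (∑ α (dom ∘ u)) λ p → letter (u (proj₁ p)) (proj₂ p)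

restrict : (w : Word A) → Pred ∣ dom w ∣ 0ℓ → Word A
restrict w X = word (dom w ↾ X) (letter w ∘ value)

before after : (w : Word A) → ∣ dom w ∣ → Word A
before w x = restrict w λ y → CountableOrder._<_ (dom w) y x
after  w x = restrict w λ y → CountableOrder._<_ (dom w) x y

module _ (S : Setoid c ℓ) where
  private
    module S = Setoid S
    infix 4 _≈_
    _≈_ = _≋_ S

  before-cong : ∀ {u v : Word S.Carrier} (e : u ≈ v) x →
                before u x ≈ before v (_≅_.to (_≋_.dom≅ e) x)
  before-cong (φ , p) x = ↾-cong φ (_≅_.mono φ) (_≅_.cancel φ) , λ y → p (value y)

  after-cong : ∀ {u v : Word S.Carrier} (e : u ≈ v) x →
               after u x ≈ after v (_≅_.to (_≋_.dom≅ e) x)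
  after-cong (φ , p) x = ↾-cong φ (_≅_.mono φ) (_≅_.cancel φ) , λ y → p (value y)

  ∏-⟦⟧-ε : ∀ x → ∏ (finite 2) (lookup (⟦ x ⟧ ∷ ε ∷ [])) ≈ ⟦ x ⟧
  ∏-⟦⟧-ε x = mk≅ to (λ {p} {q} → mono {p} {q}) surj , letters
    where
    w = ∏ (finite 2) (lookup (⟦ x ⟧ ∷ ε ∷ []))
    to : ∣ dom w ∣ → Fin 1
    to _ = zero
    mono : ∀ {p q} → CountableOrder._<_ (dom w) p q → to p Fin.< to q
    mono {zero , zero} {zero , zero} (fst< ())
    mono {zero , zero} {zero , zero} (snd< ())
    mono {suc zero , ()}
    mono {zero , zero} {suc zero , ()}
    surj : ∀ y → ∃ λ p → to p ≡ y
    surj zero = (zero , zero) , refl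
    letters : ∀ p → letter w p S.≈ letter (⟦ x ⟧) (to p)
    letters (zero , zero) = S.refl
    letters (suc zero , ())

  ∏-ε-⟦⟧ : ∀ x → ∏ (finite 2) (lookup (ε ∷ ⟦ x ⟧ ∷ [])) ≈ ⟦ x ⟧
  ∏-ε-⟦⟧ x = mk≅ to (λ {p} {q} → mono {p} {q}) surj , letters
    where
    w = ∏ (finite 2) (lookup (ε ∷ ⟦ x ⟧ ∷ []))
    to : ∣ dom w ∣ → Fin 1
    to _ = zero
    mono : ∀ {p q} → CountableOrder._<_ (dom w) p q → to p Fin.< to q
    mono {suc zero , zero} {suc zero , zero} (fst< (s≤s ()))
    mono {suc zero , zero} {suc zero , zero} (snd< ())
    mono {zero , ()}
    mono {suc zero , zero} {zero , ()}
    surj : ∀ y → ∃ λ p → to p ≡ y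
    surj zero = (suc zero , zero) , refl
    letters : ∀ p → letter w p S.≈ letter (⟦ x ⟧) (to p)
    letters (suc zero , zero) = S.refl
    letters (zero , ())

  ∏-1+2 : ∀ x y z → ∏ (finite 2) (lookup (⟦ x ⟧ ∷ ⟦ y ⨾ z ⟧ ∷ [])) ≈ fromVec (x ∷ y ∷ z ∷ [])
  ∏-1+2 x y z = mk≅ to (λ {p} {q} → mono {p} {q}) surj , letters
    where
    w = ∏ (finite 2) (lookup (⟦ x ⟧ ∷ ⟦ y ⨾ z ⟧ ∷ []))
    to : ∣ dom w ∣ → Fin 3
    to (zero , zero)  = zero
    to (suc zero , i) = suc i
    mono : ∀ {p q} → CountableOrder._<_ (dom w) p q → to p Fin.< to q
    mono {zero , zero}  {zero , zero}  (fst< ())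
    mono {zero , zero}  {zero , zero}  (snd< ())
    mono {zero , zero}  {suc zero , j} _         = s≤s z≤n
    mono {suc zero , i} {zero , j}     (fst< ())
    mono {suc zero , i} {suc zero , j} (fst< (s≤s ()))
    mono {suc zero , i} {suc zero , j} (snd< l)  = s≤s l
    surj : ∀ y → ∃ λ p → to p ≡ y
    surj zero    = (zero , zero) , refl
    surj (suc i) = (suc zero , i) , refl
    letters : ∀ p → letter w p S.≈ lookup (x ∷ y ∷ z ∷ []) (to p)
    letters (zero , zero)  = S.refl
    letters (suc zero , i) = S.refl

  ∏-2+1 : ∀ x y z → ∏ (finite 2) (lookup (⟦ x ⨾ y ⟧ ∷ ⟦ z ⟧ ∷ [])) ≈ fromVec (x ∷ y ∷ z ∷ [])
  ∏-2+1 x y z = mk≅ to (λ {p} {q} → mono {p} {q}) surj , letters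
    where
    w = ∏ (finite 2) (lookup (⟦ x ⨾ y ⟧ ∷ ⟦ z ⟧ ∷ []))
    to : ∣ dom w ∣ → Fin 3
    to (zero , zero)     = zero
    to (zero , suc zero) = suc zero
    to (suc zero , _)    = suc (suc zero)
    mono : ∀ {p q} → CountableOrder._<_ (dom w) p q → to p Fin.< to q
    mono {zero , i}        {zero , j}        (fst< ())
    mono {zero , zero}     {zero , zero}     (snd< ())
    mono {zero , zero}     {zero , suc zero} (snd< _) = s≤s z≤n
    mono {zero , suc zero} {zero , zero}     (snd< ())
    mono {zero , suc zero} {zero , suc zero} (snd< (s≤s ()))
    mono {zero , zero}     {suc zero , _}    _        = s≤s z≤n
    mono {zero , suc zero} {suc zero , _}    _        = s≤s (s≤s z≤n)
    mono {suc zero , _}    {zero , _}        (fst< ())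
    mono {suc zero , _}    {suc zero , _}    (fst< (s≤s ()))
    mono {suc zero , zero} {suc zero , zero} (snd< ())
    surj : ∀ y → ∃ λ p → to p ≡ y
    surj zero             = (zero , zero) , refl
    surj (suc zero)       = (zero , suc zero) , refl
    surj (suc (suc zero)) = (suc zero , zero) , refl
    letters : ∀ p → letter w p S.≈ lookup (x ∷ y ∷ z ∷ []) (to p)
    letters (zero , zero)        = S.refl
    letters (zero , suc zero)    = S.refl
    letters (suc zero , zero)    = S.refl

  module _ (α : CountableOrder) (u : ∣ α ∣ → Word S.Carrier)
           (i : ∣ α ∣) (x : ∣ dom (u i) ∣) where
    private
      module α = CountableOrder α
      module β {j} = CountableOrder (dom (u j))
      module ∏αu = CountableOrder (dom (∏ α u))

    ∏-before : ∏ (finite 2) (lookup (∏ (α ↾ (α._< i)) (u ∘ value) ∷ before (u i) x ∷ []))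
                 ≈ before (∏ α u) (i , x)
    ∏-before = mk≅ to (λ {p} {q} → mono {p} {q}) surj , letters
      where
      w = ∏ (finite 2) (lookup (∏ (α ↾ (α._< i)) (u ∘ value) ∷ before (u i) x ∷ []))
      to : ∣ dom w ∣ → ∣ dom (before (∏ α u) (i , x)) ∣
      to (zero , (j , [ j<i ]) , y) = (j , y) , [ fst< j<i ]
      to (suc zero , y , [ y<x ])   = (i , y) , [ snd< y<x ]
      mono : ∀ {p q} → CountableOrder._<_ (dom w) p q → value (to p) ∏αu.< value (to q)
      mono {zero , _}     {zero , _}     (fst< ())
      mono {zero , _}     {zero , _}     (snd< (fst< l)) = fst< l
      mono {zero , _}     {zero , _}     (snd< (snd< l)) = snd< l
      mono {zero , (j , [ j<i ]) , y} {suc zero , _} _   = fst< (recompute (j α.<? i) j<i)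
      mono {suc zero , _} {zero , _}     (fst< ())
      mono {suc zero , _} {suc zero , _} (fst< (s≤s ()))
      mono {suc zero , _} {suc zero , _} (snd< l)        = snd< l
      snd<⁻¹ : ∀ {y} → (i , y) ∏αu.< (i , x) → y β.< x
      snd<⁻¹ (fst< i<i) = contradiction i<i (α.irrefl refl)
      snd<⁻¹ (snd< y<x) = y<x
      surj : ∀ p → ∃ λ q → to q ≡ p
      surj ((j , y) , [ lt ]) with α.compare j i
      ... | tri< j<i _ _  = (zero , (j , [ j<i ]) , y) , refl
      ... | tri≈ _ refl _ = (suc zero , y , [ snd<⁻¹ lt ]) , refl
      ... | tri> _ _ i<j  = contradiction-irr lt (∏αu.asym (fst< i<j))
      letters : ∀ p → letter w p S.≈ letter (∏ α u) (value (to p))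
      letters (zero , _)     = S.refl
      letters (suc zero , _) = S.refl

    ∏-after : ∏ (finite 2) (lookup (after (u i) x ∷ ∏ (α ↾ (i α.<_)) (u ∘ value) ∷ []))
                ≈ after (∏ α u) (i , x)
    ∏-after = mk≅ to (λ {p} {q} → mono {p} {q}) surj , letters
      where
      w = ∏ (finite 2) (lookup (after (u i) x ∷ ∏ (α ↾ (i α.<_)) (u ∘ value) ∷ []))
      to : ∣ dom w ∣ → ∣ dom (after (∏ α u) (i , x)) ∣
      to (zero , y , [ x<y ])           = (i , y) , [ snd< x<y ]
      to (suc zero , (j , [ i<j ]) , y) = (j , y) , [ fst< i<j ]
      mono : ∀ {p q} → CountableOrder._<_ (dom w) p q → value (to p) ∏αu.< value (to q)
      mono {zero , _}     {zero , _}     (fst< ())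
      mono {zero , _}     {zero , _}     (snd< l)          = snd< l
      mono {zero , _}     {suc zero , (j , [ i<j ]) , _} _ = fst< (recompute (i α.<? j) i<j)
      mono {suc zero , _} {zero , _}     (fst< ())
      mono {suc zero , _} {suc zero , _} (fst< (s≤s ()))
      mono {suc zero , _} {suc zero , _} (snd< (fst< l))   = fst< l
      mono {suc zero , _} {suc zero , _} (snd< (snd< l))   = snd< l
      snd<⁻¹ : ∀ {y} → (i , x) ∏αu.< (i , y) → x β.< y
      snd<⁻¹ (fst< i<i) = contradiction i<i (α.irrefl refl)
      snd<⁻¹ (snd< x<y) = x<y
      surj : ∀ p → ∃ λ q → to q ≡ p
      surj ((j , y) , [ lt ]) with α.compare i j
      ... | tri< i<j _ _  = (suc zero , (j , [ i<j ]) , y) , refl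
      ... | tri≈ _ refl _ = (zero , y , [ snd<⁻¹ lt ]) , refl
      ... | tri> _ _ j<i  = contradiction-irr lt (∏αu.asym (fst< j<i))
      letters : ∀ p → letter w p S.≈ letter (∏ α u) (value (to p))
      letters (zero , _)     = S.refl
      letters (suc zero , _) = S.refl

------------------------------------------------------------------------
-- ⊛-monoids

record ⊛-Monoid c ℓ : Set (lsuc (c ⊔ ℓ)) where
  infixr 7 _∙_
  infix 8 _^τ _^τ*
  field
    setoid : Setoid c ℓ

  open Setoid setoid public renaming (refl to ≈-refl; sym to ≈-sym; trans to ≈-trans)

  field
    π      : Word Carrier → Carrier
    π-cong : ∀ {u v} → _≋_ setoid u v → π u ≈ π v
    π-⟦⟧   : ∀ x → π ⟦ x ⟧ ≈ x
    π-∏    : ∀ α (u : ∣ α ∣ → Word Carrier) → π (∏ α u) ≈ π (word α (π ∘ u))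

  id : Carrier
  id = π ε

  _∙_ : Carrier → Carrier → Carrier
  x ∙ y = π ⟦ x ⨾ y ⟧

  _^τ _^τ* : Carrier → Carrier
  x ^τ  = π (constant ω x)
  x ^τ* = π (constant ω* x)

  π-letters : ∀ {α} {f g : ∣ α ∣ → Carrier} → (∀ x → f x ≈ g x) → π (word α f) ≈ π (word α g)
  π-letters p = π-cong (≅-refl , p)

  ∙-cong : ∀ {x x′ y y′} → x ≈ x′ → y ≈ y′ → x ∙ y ≈ x′ ∙ y′
  ∙-cong p q = π-letters λ { zero → p ; (suc zero) → q }

  π-∏₂ : ∀ u v → π (∏ (finite 2) (lookup (u ∷ v ∷ []))) ≈ π u ∙ π v
  π-∏₂ u v = ≈-trans (π-∏ (finite 2) (lookup (u ∷ v ∷ [])))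
    (π-letters λ { zero → ≈-refl ; (suc zero) → ≈-refl })

  identityʳ : ∀ x → x ∙ id ≈ x
  identityʳ x = begin
    x ∙ id                                       ≈⟨ ∙-cong (π-⟦⟧ x) ≈-refl ⟨
    π ⟦ x ⟧ ∙ id                                 ≈⟨ π-∏₂ ⟦ x ⟧ ε ⟨
    π (∏ (finite 2) (lookup (⟦ x ⟧ ∷ ε ∷ [])))   ≈⟨ π-cong (∏-⟦⟧-ε setoid x) ⟩
    π ⟦ x ⟧                                      ≈⟨ π-⟦⟧ x ⟩
    x                                            ∎
    where open SetoidReasoning setoid

  identityˡ : ∀ x → id ∙ x ≈ x
  identityˡ x = begin
    id ∙ x                                       ≈⟨ ∙-cong ≈-refl (π-⟦⟧ x) ⟨
    id ∙ π ⟦ x ⟧                                 ≈⟨ π-∏₂ ε ⟦ x ⟧ ⟨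
    π (∏ (finite 2) (lookup (ε ∷ ⟦ x ⟧ ∷ [])))   ≈⟨ π-cong (∏-ε-⟦⟧ setoid x) ⟩
    π ⟦ x ⟧                                      ≈⟨ π-⟦⟧ x ⟩
    x                                            ∎
    where open SetoidReasoning setoid

  assoc : ∀ x y z → (x ∙ y) ∙ z ≈ x ∙ (y ∙ z)
  assoc x y z = begin
    (x ∙ y) ∙ z                                            ≈⟨ ∙-cong ≈-refl (π-⟦⟧ z) ⟨
    (x ∙ y) ∙ π ⟦ z ⟧                                      ≈⟨ π-∏₂ ⟦ x ⨾ y ⟧ ⟦ z ⟧ ⟨
    π (∏ (finite 2) (lookup (⟦ x ⨾ y ⟧ ∷ ⟦ z ⟧ ∷ [])))     ≈⟨ π-cong (∏-2+1 setoid x y z) ⟩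
    π (fromVec (x ∷ y ∷ z ∷ []))                           ≈⟨ π-cong (∏-1+2 setoid x y z) ⟨
    π (∏ (finite 2) (lookup (⟦ x ⟧ ∷ ⟦ y ⨾ z ⟧ ∷ [])))     ≈⟨ π-∏₂ ⟦ x ⟧ ⟦ y ⨾ z ⟧ ⟩
    π ⟦ x ⟧ ∙ (y ∙ z)                                      ≈⟨ ∙-cong (π-⟦⟧ x) ≈-refl ⟩
    x ∙ (y ∙ z)                                            ∎
    where open SetoidReasoning setoid

  π-before-cong : ∀ {u v} (e : _≋_ setoid u v) x →
                  π (before u x) ≈ π (before v (_≅_.to (_≋_.dom≅ e) x))
  π-before-cong {u} {v} e x = π-cong (before-cong setoid {u} {v} e x)

  π-after-cong : ∀ {u v} (e : _≋_ setoid u v) x →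
                 π (after u x) ≈ π (after v (_≅_.to (_≋_.dom≅ e) x))
  π-after-cong {u} {v} e x = π-cong (after-cong setoid {u} {v} e x)

  π-before-∏ : ∀ α (u : ∣ α ∣ → Word Carrier) i x →
               π (before (∏ α u) (i , x)) ≈ π (before (word α (π ∘ u)) i) ∙ π (before (u i) x)
  π-before-∏ α u i x = begin
    π (before (∏ α u) (i , x))                            ≈⟨ π-cong (∏-before setoid α u i x) ⟨
    π (∏ (finite 2) (lookup (v ∷ before (u i) x ∷ [])))   ≈⟨ π-∏₂ v (before (u i) x) ⟩
    π v ∙ π (before (u i) x)                              ≈⟨ ∙-cong (π-∏ _ (u ∘ value)) ≈-refl ⟩
    π (before (word α (π ∘ u)) i) ∙ π (before (u i) x)    ∎
    where
    open SetoidReasoning setoid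
    v = ∏ (α ↾ (λ j → CountableOrder._<_ α j i)) (u ∘ value)

  π-after-∏ : ∀ α (u : ∣ α ∣ → Word Carrier) i x →
              π (after (∏ α u) (i , x)) ≈ π (after (u i) x) ∙ π (after (word α (π ∘ u)) i)
  π-after-∏ α u i x = begin
    π (after (∏ α u) (i , x))                            ≈⟨ π-cong (∏-after setoid α u i x) ⟨
    π (∏ (finite 2) (lookup (after (u i) x ∷ v ∷ [])))   ≈⟨ π-∏₂ (after (u i) x) v ⟩
    π (after (u i) x) ∙ π v                              ≈⟨ ∙-cong ≈-refl (π-∏ _ (u ∘ value)) ⟩
    π (after (u i) x) ∙ π (after (word α (π ∘ u)) i)     ∎
    where
    open SetoidReasoning setoid
    v = ∏ (α ↾ (λ j → CountableOrder._<_ α i j)) (u ∘ value)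

  π-before-⟦⟧ : ∀ x i → π (before ⟦ x ⟧ i) ≈ id
  π-before-⟦⟧ x zero =
    π-cong (mk≅ (λ { (zero , [ () ]) }) (λ { {zero , [ () ]} }) (λ ()) , λ { (zero , [ () ]) })

  π-after-⟦⟧ : ∀ x i → π (after ⟦ x ⟧ i) ≈ id
  π-after-⟦⟧ x zero =
    π-cong (mk≅ (λ { (zero , [ () ]) }) (λ { {zero , [ () ]} }) (λ ()) , λ { (zero , [ () ]) })

record Morphism (M : ⊛-Monoid c₁ ℓ₁) (N : ⊛-Monoid c₂ ℓ₂) : Set (lsuc 0ℓ ⊔ c₁ ⊔ ℓ₁ ⊔ c₂ ⊔ ℓ₂) where
  private
    module M = ⊛-Monoid M
    module N = ⊛-Monoid N
  field
    func : Func M.setoid N.setoid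
    homo : ∀ w → func ⟨$⟩ M.π w N.≈ N.π (map (func ⟨$⟩_) w)

free : Set → ⊛-Monoid (lsuc 0ℓ) 0ℓ
free A = record
  { setoid = wordSetoid S
  ; π      = λ w → ∏ (dom w) (letter w)
  ; π-cong = λ { (φ , p) → ∑-cong φ (_≋_.dom≅ ∘ p) , λ { (i , x) → _≋_.letter≈ (p i) x } }
  ; π-⟦⟧   = λ w →
      mk≅ (λ { (zero , x) → x })
          (λ { {zero , _} {zero , _} (fst< ()) ; {zero , _} {zero , _} (snd< l) → l })
          (λ x → (zero , x) , refl)
    , λ { (zero , x) → refl }
  ; π-∏    = λ α u →
      ≅-sym (∑-assoc α (dom ∘ u) (λ i x → dom (letter (u i) x))) , λ _ → refl
  }
  where S = ≡.setoid A

------------------------------------------------------------------------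
-- Block product

_^_ : ⊛-Monoid c₁ ℓ₁ → (S : Setoid c₂ ℓ₂) → ⊛-Monoid (c₁ ⊔ ℓ₁ ⊔ c₂ ⊔ ℓ₂) (ℓ₁ ⊔ c₂)
N ^ S = record
  { setoid = S ⇨ N.setoid
  ; π      = λ w → record
    { to   = λ s → N.π (map (_⟨$⟩ s) w)
    ; cong = λ s≈t → N.π-letters λ x → Func.cong (letter w x) s≈t
    }
  ; π-cong = λ { (φ , p) s → N.π-cong (φ , λ x → p x s) }
  ; π-⟦⟧   = λ f s → N.≈-trans (N.π-letters λ { zero → N.≈-refl }) (N.π-⟦⟧ (f ⟨$⟩ s))
  ; π-∏    = λ α u s → N.π-∏ α (map (_⟨$⟩ s) ∘ u)
  }
  where
  module N = ⊛-Monoid N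
  open FunctionSetoid using (_⇨_)

module _ (M : ⊛-Monoid c₁ ℓ₁) (N : ⊛-Monoid c₂ ℓ₂) where
  private
    module M = ⊛-Monoid M
    module N = ⊛-Monoid N
    K = N ^ ×-setoid M.setoid M.setoid
    module K = ⊛-Monoid K

  leftAction : M.Carrier → K.Carrier → K.Carrier
  leftAction m f = record
    { to   = λ (m₁ , m₂) → f ⟨$⟩ (m₁ M.∙ m , m₂)
    ; cong = λ (p , q) → Func.cong f (M.∙-cong p M.≈-refl , q)
    }

  rightAction : K.Carrier → M.Carrier → K.Carrier
  rightAction f m = record
    { to   = λ (m₁ , m₂) → f ⟨$⟩ (m₁ , m M.∙ m₂)
    ; cong = λ (p , q) → Func.cong f (p , M.∙-cong M.≈-refl q)
    }

  -- At position x: p_x * f_x * q_x, where p_x and q_x are the products of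
  -- the M-components strictly before and strictly after x.
  blockWord : Word (M.Carrier × K.Carrier) → Word K.Carrier
  blockWord u = word (dom u) λ x →
    rightAction (leftAction (M.π (before (map proj₁ u) x)) (proj₂ (letter u x)))
                (M.π (after (map proj₁ u) x))

  infixr 7 _□_
  _□_ : ⊛-Monoid _ _
  _□_ = record
    { setoid = S
    ; π      = λ u → M.π (map proj₁ u) , K.π (blockWord u)
    ; π-cong = λ {u} {v} → π-cong u v
    ; π-⟦⟧   = λ { (m , f) →
          M.≈-trans (M.π-letters λ { zero → M.≈-refl }) (M.π-⟦⟧ m)
        , λ { (m₁ , m₂) → N.≈-trans
            (N.π-letters λ { zero → Func.cong f
              ( M.≈-trans (M.∙-cong M.≈-refl (before-⟦⟧ m f)) (M.identityʳ m₁)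
              , M.≈-trans (M.∙-cong (after-⟦⟧ m f) M.≈-refl) (M.identityˡ m₂) ) })
            (N.π-⟦⟧ (f ⟨$⟩ (m₁ , m₂))) } }
    ; π-∏    = λ α u →
          M.π-∏ α (map proj₁ ∘ u)
        , λ { (m₁ , m₂) → N.≈-trans
            (N.π-letters λ { (i , x) → Func.cong (proj₂ (letter (u i) x))
              ( M.≈-trans (M.∙-cong M.≈-refl (M.π-before-∏ α (map proj₁ ∘ u) i x))
                          (M.≈-sym (M.assoc m₁ _ _))
              , M.≈-trans (M.∙-cong (M.π-after-∏ α (map proj₁ ∘ u) i x) M.≈-refl)
                          (M.assoc _ _ m₂) ) })
            (N.π-∏ α λ i → word (dom (u i)) λ x →
              letter (blockWord (u i)) x ⟨$⟩
                ( m₁ M.∙ M.π (before (word α (M.π ∘ map proj₁ ∘ u)) i)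
                , M.π (after (word α (M.π ∘ map proj₁ ∘ u)) i) M.∙ m₂ )) }
    }
    where
    S = ×-setoid M.setoid K.setoid

    one : M.Carrier → K.Carrier → Word M.Carrier
    one m f = map proj₁ (⟦ m , f ⟧)

    before-⟦⟧ : ∀ m f → M.π (before (one m f) zero) M.≈ M.id
    before-⟦⟧ m f = M.≈-trans
      (M.π-letters {f = letter (before (one m f) zero)} {g = letter (before ⟦ m ⟧ zero)}
        λ { (zero , _) → M.≈-refl })
      (M.π-before-⟦⟧ m zero)

    after-⟦⟧ : ∀ m f → M.π (after (one m f) zero) M.≈ M.id
    after-⟦⟧ m f = M.≈-trans
      (M.π-letters {f = letter (after (one m f) zero)} {g = letter (after ⟦ m ⟧ zero)}
        λ { (zero , _) → M.≈-refl })
      (M.π-after-⟦⟧ m zero)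

    π-cong : ∀ u v → _≋_ S u v →
             Setoid._≈_ S (M.π (map proj₁ u) , K.π (blockWord u))
                          (M.π (map proj₁ v) , K.π (blockWord v))
    π-cong u v (φ , p) = M.π-cong e , λ { (m₁ , m₂) → N.π-cong (φ , λ x →
      N.≈-trans (proj₂ (p x) _)
                (Func.cong (proj₂ (letter v (_≅_.to φ x)))
                  ( M.∙-cong M.≈-refl (M.π-before-cong {map proj₁ u} {map proj₁ v} e x)
                  , M.∙-cong (M.π-after-cong {map proj₁ u} {map proj₁ v} e x) M.≈-refl ))) }
      where
      e : _≋_ M.setoid (map proj₁ u) (map proj₁ v)
      e = φ , proj₁ ∘ p

data FiniteBlockProduct (B : Pred (⊛-Monoid 0ℓ 0ℓ) ℓ) : Pred (⊛-Monoid 0ℓ 0ℓ) (lsuc 0ℓ ⊔ ℓ) where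
  base : ∀ {M} → M ∈ B → M ∈ FiniteBlockProduct B
  _□ᶠ_ : ∀ {M N} → M ∈ FiniteBlockProduct B → N ∈ FiniteBlockProduct B →
         (M □ N) ∈ FiniteBlockProduct B

------------------------------------------------------------------------
-- Induced ⊛-algebras

-- Finite nonempty sets are given by nonempty lists of their elements.
record Raw⊛-Algebra c ℓ : Set (lsuc (c ⊔ ℓ)) where
  infixr 7 _∙_
  infix 8 _^τ _^τ* _^κ
  field
    setoid : Setoid c ℓ
  open Setoid setoid public using (Carrier; _≈_)
  field
    id   : Carrier
    _∙_  : Carrier → Carrier → Carrier
    _^τ  : Carrier → Carrier
    _^τ* : Carrier → Carrier
    _^κ  : List⁺ Carrier → Carrier

Convex : (α : CountableOrder) → Pred (Pred ∣ α ∣ 0ℓ) 0ℓ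
Convex α I = ∀ {x y z} → x ∈ I → z ∈ I → x < y → y < z → y ∈ I
  where open CountableOrder α

-- `nonempty non-singleton interval': a convex set with two distinct points.
module _ (S : Setoid c ℓ) where
  open Setoid S
  open Membership S renaming (_∈_ to _∈ₗ_)

  record IsPerfectShuffle (E : List⁺ Carrier) (f : ∣ η ∣ → Carrier) : Set (lsuc 0ℓ ⊔ c ⊔ ℓ) where
    field
      letters : ∀ q → f q ∈ₗ toList E
      dense   : ∀ (I : Pred ∣ η ∣ 0ℓ) → Convex η I → ∀ {p q} → p ∈ I → q ∈ I → p ≢ q →
                ∀ {e} → e ∈ₗ toList E → ∃ λ r → r ∈ I × f r ≈ e

-- E^κ is specified by its value on every word which is a perfect shuffle
-- of E; all these words are isomorphic.
record Induces (M : ⊛-Monoid c₁ ℓ₁) (A : Raw⊛-Algebra c₂ ℓ₂) : Set (lsuc 0ℓ ⊔ c₁ ⊔ ℓ₁ ⊔ c₂ ⊔ ℓ₂) where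
  private
    module M = ⊛-Monoid M
    module A = Raw⊛-Algebra A
  field
    carrier↔ : Inverse M.setoid A.setoid
  open Inverse carrier↔ using (to)
  field
    id-homo : to M.id A.≈ A.id
    ∙-homo  : ∀ x y → to (x M.∙ y) A.≈ to x A.∙ to y
    τ-homo  : ∀ x → to (x M.^τ) A.≈ to x A.^τ
    τ*-homo : ∀ x → to (x M.^τ*) A.≈ to x A.^τ*
    κ-homo  : ∀ E f → IsPerfectShuffle M.setoid E f → to (M.π (word η f)) A.≈ (List⁺.map to E A.^κ)

-- `nothing` is the identity and `just i` is the element i ∈ {0,…,n}.
Δ : ℕ → Raw⊛-Algebra 0ℓ 0ℓ
Δ n = record
  { setoid = ≡.setoid (Maybe (Fin (suc n)))
  ; id     = nothing
  ; _∙_    = _∙_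
  ; _^τ    = next
  ; _^τ*   = next
  ; _^κ    = λ E → if all is-nothing (toList E) then nothing else just (Fin.fromℕ n)
  }
  where
  _∙_ : Maybe (Fin (suc n)) → Maybe (Fin (suc n)) → Maybe (Fin (suc n))
  nothing ∙ y       = y
  just i  ∙ nothing = just i
  just i  ∙ just j  = just (if does (i Fin.≤? j) then j else i)
  next : Maybe (Fin (suc n)) → Maybe (Fin (suc n))
  next nothing  = nothing
  next (just i) = just (Fin.fromℕ< {suc (Fin.toℕ i) ℕ.⊓ n} (s≤s (ℕ.m⊓n≤n _ n)))

------------------------------------------------------------------------
-- Infinitary rank

Nonempty : Pred CountableOrder 0ℓ
Nonempty α = ∣ α ∣

-- zsum: ℤ-indexed sums of orderings in 𝓘 n or empty; fsum: closure under
-- (nonempty) finite sums.  Both are taken up to isomorphism.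
data 𝓘 : ℕ → Pred CountableOrder (lsuc 0ℓ) where
  fin  : ∀ {α} k → α ≅ finite (suc k) → α ∈ 𝓘 0
  zsum : ∀ {n α} (β : ℤ → CountableOrder) → (∀ i → β i ∈ 𝓘 n ⊎ ¬ Nonempty (β i)) →
         Nonempty α → α ≅ ∑ ζ β → α ∈ 𝓘 (suc n)
  fsum : ∀ {n α} k (β : Fin (suc k) → CountableOrder) → (∀ i → β i ∈ 𝓘 (suc n)) →
         α ≅ ∑ (finite (suc k)) β → α ∈ 𝓘 (suc n)

_HasRank_ : CountableOrder → ℕ → Set₁
α HasRank n = α ∈ 𝓘 n × (∀ m → m ℕ.< n → ¬ α ∈ 𝓘 m)

------------------------------------------------------------------------
-- Logic

-- `Formula Q A k`: formulas over the alphabet A with k free variables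
-- (de Bruijn), using the quantifiers ∃^∞_j for j in Q.
infix 6 ¬′_
infixr 5 _∧′_
infixr 4 _∨′_
data Formula (Q : Pred ℕ 0ℓ) (A : Set) (k : ℕ) : Set where
  _≺_    : Fin k → Fin k → Formula Q A k
  has    : A → Fin k → Formula Q A k
  ¬′_    : Formula Q A k → Formula Q A k
  _∧′_   : Formula Q A k → Formula Q A k → Formula Q A k
  _∨′_   : Formula Q A k → Formula Q A k → Formula Q A k
  ∃′     : Formula Q A (suc k) → Formula Q A k
  ∃∞     : ∀ j → j ∈ Q → Formula Q A (suc k) → Formula Q A k

Sentence : Pred ℕ 0ℓ → Set → Set
Sentence Q A = Formula Q A 0

infix 4 _⊨[_]_
_⊨[_]_ : ∀ {Q A k} (w : Word A) → Vec ∣ dom w ∣ k → Formula Q A k → Set₁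
w ⊨[ s ] (x ≺ y)    = Lift _ (CountableOrder._<_ (dom w) (lookup s x) (lookup s y))
w ⊨[ s ] has a x    = Lift _ (letter w (lookup s x) ≡ a)
w ⊨[ s ] (¬′ φ)     = ¬ w ⊨[ s ] φ
w ⊨[ s ] (φ ∧′ ψ)   = w ⊨[ s ] φ × w ⊨[ s ] ψ
w ⊨[ s ] (φ ∨′ ψ)   = w ⊨[ s ] φ ⊎ w ⊨[ s ] ψ
w ⊨[ s ] ∃′ φ       = ∃ λ i → w ⊨[ i ∷ s ] φ
w ⊨[ s ] ∃∞ j _ φ   = Σ[ X ∈ Pred ∣ dom w ∣ 0ℓ ]
                       (dom w ↾ X) HasRank j × (∀ i → i ∈ X → w ⊨[ i ∷ s ] φ)

------------------------------------------------------------------------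
-- Languages

record Language (A : Set) ℓ : Set (lsuc (lsuc 0ℓ ⊔ ℓ)) where
  field
    words    : Pred (Word A) ℓ
    respects : words Respects _≋_ (≡.setoid A)

open Language public

DefinableIn : ∀ {A} → Pred ℕ 0ℓ → Language A ℓ → Set _
DefinableIn {A = A} Q L = Σ[ φ ∈ Sentence Q A ] ∀ w → w ∈ words L ⇔ (w ⊨[ [] ] φ)

-- L = h⁻¹(h(L)) for some morphism h from the free ⊛-monoid.
RecognizedBy : ∀ {A} → ⊛-Monoid c ℓ₁ → Language A ℓ → Set _
RecognizedBy {A = A} M L = Σ[ h ∈ Morphism (free A) M ]
  ∀ w → w ∈ words L ⇔ (∃ λ v → v ∈ words L × Morphism.func h ⟨$⟩ w M.≈ Morphism.func h ⟨$⟩ v)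
  where module M = ⊛-Monoid M

RecognizedIn : ∀ {A} → Pred (⊛-Monoid 0ℓ 0ℓ) ℓ₁ → Language A ℓ → Set _
RecognizedIn C L = ∃ λ M → M ∈ C × RecognizedBy M L

{-# OPTIONS --safe #-}
module Submission where

-- Call a countable order big of level 0 if it is nonempty, and big of level
-- l+1 if it contains a monotone ω- or ω*-sequence of points such that all
-- intervals between consecutive points are big of level l; a letter i of
-- Δ n is given the weight of an order ω^i.  Then
--   * the order has a suborder of rank j iff it is big of level j;
--   * the product in any ⊛-monoid inducing Δ n has value at least l ≤ n iff
--     the word is big of level l.  Bigness bounds products from below by
--     taking τ and τ* of blocks of constant value; conversely, a word of too
--     large a value can be cut repeatedly, which produces a sequence
--     witnessing bigness.  Shuffles need no separate treatment.
-- Hence ∃^∞_j is evaluated by one factor Δ n (n ≥ j) in a block product,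
-- whose left component decides the formula under the quantifier at each
-- position, and products in Δ n are defined by the quantifiers ∃^∞_j, j ≤ n,
-- over the finitely many classes of letters.

open import Defs
open import Axiom.ExcludedMiddle using (ExcludedMiddle)
open import Data.Bool.Base using (Bool; true; false; if_then_else_)
open import Data.Bool.ListAction using (all)
open import Data.Empty using (⊥)
open import Data.Fin.Base as Fin using (Fin; zero; suc)
import Data.Fin.Properties as Fin
open import Data.Integer.Base as ℤ using (ℤ; +_; -[1+_])
import Data.Integer.Properties as ℤ
open import Data.Irrelevant using ([_])
open import Data.List.Base as List using (List; []; _∷_; _++_; upTo; allFin)
open import Data.List.Membership.Propositional using () renaming (_∈_ to _∈ₗ_)
open import Data.List.Membership.Propositional.Properties using (∈-++⁺ˡ; ∈-++⁺ʳ; ∈-map⁺; ∈-upTo⁺; ∈-allFin)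
open import Data.List.NonEmpty.Base as List⁺ using (List⁺; toList)
import Data.List.Properties as List
open import Data.List.Relation.Unary.Any using (here; there)
open import Data.Maybe.Base using (Maybe; just; nothing; is-nothing)
open import Data.Nat.Base as ℕ using (ℕ; zero; suc; _≤_; s≤s; z≤n)
import Data.Nat.Properties as ℕ
open import Data.Product.Base using (Σ; Σ-syntax; ∃; ∃₂; _×_; _,_; proj₁; proj₂)
open import Data.Product.Relation.Binary.Pointwise.NonDependent using (×-setoid)
open import Data.Rational.Base as ℚ using (ℚ)
import Data.Rational.Properties as ℚ
open import Data.Refinement using (_,_; value)
open import Data.Sum.Base as Sum using (_⊎_; inj₁; inj₂; [_,_]′)
open import Data.Vec.Base as Vec using (Vec; []; _∷_; lookup)
import Data.Vec.Properties as Vec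
open import Function.Base using (_∘_; flip)
open import Function.Bundles using (Func; _⟨$⟩_; Inverse; Injection; _↔_; _⇔_; Equivalence; mk⇔)
import Function.Construct.Identity as Identity
open import Level using (Level; Lift; 0ℓ; _⊔_; lift; lower) renaming (suc to lsuc)
open import Relation.Binary.Bundles using (Setoid)
import Relation.Binary.Construct.Flip.EqAndOrd as Flip
open import Relation.Binary.Core using (Rel)
open import Relation.Binary.Definitions using (tri<; tri≈; tri>)
open import Relation.Binary.PropositionalEquality as ≡ using (_≡_; refl; cong; sym; trans; subst)
import Relation.Binary.Reasoning.Setoid as SetoidReasoning
open import Relation.Binary.Structures using (IsStrictTotalOrder)
open import Relation.Nullary.Decidable.Core using (yes; no; does; recompute; True; toWitness; fromWitness)
open import Relation.Nullary.Negation.Core using (¬_; contradiction; contradiction-irr)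
open import Relation.Nullary.Reflects using (ofʸ; ofⁿ)
open import Relation.Unary using (Pred; _∈_; U; _∩_; _∪_)

-- A member of the class is given only through `Induces`, so its products are known a priori on a
-- few special words and every other product has to be reduced to those. The reduction rests on Δ n
-- multiplying by maxima: along any chain a largest recurring level can be read off. Weights make
-- the notion of bigness stable under sums: a block may be replaced by one point whose weight is the
-- level of the block. This single fact gives both the behaviour of ranks under ordered sums and the
-- generalized associativity of the monoid constructed for Δ n. Two mismatches between quantifiers
-- and bigness have to be bridged. A quantifier asks for rank exactly j, while bigness only bounds
-- the rank from below; hence sets are thinned (`big-thin`). A quantifier also ignores weights; but
-- bigness of level l always comes from i + j = l, with points of weight i arranged in a set of
-- level j (`big⇒pure`). This is why level l ≤ n never requires a quantifier beyond n.

module _ (em : ∀ {ℓ} → ExcludedMiddle ℓ) where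
  private
    variable
      ℓ ℓ₁ ℓ₂ : Level
      α β γ : CountableOrder
      A : Set

  dne : {P : Set ℓ} → ¬ ¬ P → P
  dne {P = P} ¬¬p with em {P = P}
  ... | yes p = p
  ... | no ¬p = contradiction ¬p ¬¬p

  -- Orders and their reversals

  module Order (α : CountableOrder) where
    open CountableOrder α public

    infix 4 _≼_
    _≼_ : Rel ∣ α ∣ 0ℓ
    x ≼ y = ¬ y < x

    ≼-refl : ∀ {x} → x ≼ x
    ≼-refl = irrefl refl

    <⇒≼ : ∀ {x y} → x < y → x ≼ y
    <⇒≼ = asym

    ≼⇒<⊎≡ : ∀ {x y} → x ≼ y → x < y ⊎ x ≡ y
    ≼⇒<⊎≡ {x} {y} x≼y with compare x y
    ... | tri< x<y _ _ = inj₁ x<y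
    ... | tri≈ _ x≡y _ = inj₂ x≡y
    ... | tri> _ _ y<x = contradiction y<x x≼y

    ≼-<-trans : ∀ {x y z} → x ≼ y → y < z → x < z
    ≼-<-trans x≼y y<z with ≼⇒<⊎≡ x≼y
    ... | inj₁ x<y  = <-trans x<y y<z
    ... | inj₂ refl = y<z

    <-≼-trans : ∀ {x y z} → x < y → y ≼ z → x < z
    <-≼-trans x<y y≼z with ≼⇒<⊎≡ y≼z
    ... | inj₁ y<z  = <-trans x<y y<z
    ... | inj₂ refl = x<y

    ≼-trans : ∀ {x y z} → x ≼ y → y ≼ z → x ≼ z
    ≼-trans x≼y y≼z z<x = y≼z (<-≼-trans z<x x≼y)

    monotone : ∀ {c : ℕ → ∣ α ∣} → (∀ k → c k ≼ c (suc k)) → ∀ {i j} → i ≤ j → c i ≼ c j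
    monotone {c} step {i} i≤j = go (ℕ.≤⇒≤′ i≤j)
      where
      go : ∀ {j} → i ℕ.≤′ j → c i ≼ c j
      go ℕ.≤′-refl     = ≼-refl
      go (ℕ.≤′-step p) = ≼-trans (go p) (step _)

    strictlyMonotone : ∀ {c : ℕ → ∣ α ∣} → (∀ k → c k < c (suc k)) → ∀ {i j} → i ℕ.< j → c i < c j
    strictlyMonotone step i<j = <-≼-trans (step _) (monotone (<⇒≼ ∘ step) i<j)

  data Direction : Set where
    ↑ ↓ : Direction

  module _ (α : CountableOrder) where
    open CountableOrder α

    Lt : Direction → Rel ∣ α ∣ 0ℓ
    Lt ↑ = _<_
    Lt ↓ = flip _<_

    Lt-isStrictTotalOrder : ∀ d → IsStrictTotalOrder _≡_ (Lt d)
    Lt-isStrictTotalOrder ↑ = isStrictTotalOrder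
    Lt-isStrictTotalOrder ↓ = Flip.isStrictTotalOrder isStrictTotalOrder

  dir : Direction → CountableOrder → CountableOrder
  dir d α = record
    { Carrier            = ∣ α ∣
    ; _<_                = Lt α d
    ; isStrictTotalOrder = Lt-isStrictTotalOrder α d
    ; countable          = CountableOrder.countable α
    }

  -- Betweenness is phrased so as to be symmetric in the endpoints and
  -- invariant under reversal of the order.
  module _ (α : CountableOrder) where
    open CountableOrder α

    Between : ∣ α ∣ → ∣ α ∣ → Pred ∣ α ∣ 0ℓ
    Between a b x = (x < a → ¬ x < b) × (a < x → ¬ b < x)

    between-sym : ∀ {a b x} → Between a b x → Between b a x
    between-sym (p , q) = flip p , flip q

    module _ (d : Direction) where
      private module D = Order (dir d α)

      -- Half-open, so that the pieces between successive points of a chain are disjoint and leave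
      -- no gaps; a chain that pauses just contributes an empty piece.
      Ioc : ∣ α ∣ → ∣ α ∣ → Pred ∣ α ∣ 0ℓ
      Ioc a b x = a D.< x × x D.≼ b

  between-≼ : ∀ d {a b x} → Order._≼_ (dir d α) a b → Between α a b x →
              Order._≼_ (dir d α) a x × Order._≼_ (dir d α) x b
  between-≼ {α} ↑ a≼b (p , q) =
    (λ x<a → p x<a (A.<-≼-trans x<a a≼b)) , (λ b<x → q (A.≼-<-trans a≼b b<x) b<x)
    where module A = Order α
  between-≼ {α} ↓ a≼b (p , q) =
    (λ a<x → q a<x (A.≼-<-trans a≼b a<x)) , (λ x<b → p (A.<-≼-trans x<b a≼b) x<b)
    where module A = Order α

  ≼-between : ∀ d {a b x} → Order._≼_ (dir d α) a x → Order._≼_ (dir d α) x b → Between α a b x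
  ≼-between ↑ a≼x x≼b = (λ x<a _ → a≼x x<a) , (λ _ b<x → x≼b b<x)
  ≼-between ↓ a≼x x≼b = (λ _ x<b → x≼b x<b) , (λ a<x _ → a≼x a<x)

  module _ (d : Direction) where
    private module D α = Order (dir d α)

    between-mono : ∀ {a b a′ b′ x} → D._≼_ α a b → D._≼_ α a′ a → D._≼_ α b b′ →
                   Between α a b x → Between α a′ b′ x
    between-mono {α} a≼b a′≼a b≼b′ btw with a≼x , x≼b ← between-≼ d a≼b btw =
      ≼-between d (D.≼-trans α a′≼a a≼x) (D.≼-trans α x≼b b≼b′)

  locate : ∀ d (c : ℕ → ∣ α ∣) m {x} → Lt α d (c 0) x → ¬ Lt α d (c m) x →
           ∃ λ k → Ioc α d (c k) (c (suc k)) x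
  locate d c zero c<x c≮x = contradiction c<x c≮x
  locate {α} d c (suc m) {x} c<x c≮x with em {P = Lt α d (c m) x}
  ... | yes c′<x = m , c′<x , c≮x
  ... | no c′≮x  = locate d c m c<x c′≮x

  -- Pieces numbered outwards along a decreasing chain occur in reverse order. Indexing them by
  -- `dir d ω` makes them an ordered sum in either direction.
  reorient : ∀ d {V : ℕ → Pred ∣ α ∣ 0ℓ} →
             (∀ {i j x y} → V i x → V j y → i ℕ.< j → Lt α d x y) →
             ∀ {i j x y} → V i x → V j y → Lt ω d i j → CountableOrder._<_ α x y
  reorient ↑ sep p q i<j = sep p q i<j
  reorient ↓ sep p q j<i = sep q p j<i

  -- Weighted orders

  Weight : CountableOrder → Set₁
  Weight α = ∣ α ∣ → ℕ → Set

  infixl 7 _⊓_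
  _⊓_ : (A → ℕ → Set) → Pred A 0ℓ → A → ℕ → Set
  (P ⊓ I) x l = P x l × I x

  -- A point x of weight l (written P x l) counts as a copy of ω^l.
  Big : (α : CountableOrder) → ℕ → Weight α → Set
  Big α zero    P = ∃ λ x → P x 0
  Big α (suc l) P = (∃ λ x → P x (suc l)) ⊎
    (Σ[ d ∈ Direction ] Σ[ c ∈ (ℕ → ∣ α ∣) ] (∀ k → Lt α d (c k) (c (suc k))) ×
      (∀ k → Big α l (P ⊓ Between α (c k) (c (suc k)))))

  -- With all weights 0, only chains can raise the level, which gives the unweighted notion of
  -- bigness for the set S.
  pure : Pred A 0ℓ → A → ℕ → Set
  pure S x i = i ≡ 0 × S x

  big-mono : ∀ l {P Q : Weight α} → (∀ {x i} → P x i → Q x i) → Big α l P → Big α l Q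
  big-mono zero    P⊂Q (x , p)                  = x , P⊂Q p
  big-mono (suc l) P⊂Q (inj₁ (x , p))           = inj₁ (x , P⊂Q p)
  big-mono (suc l) P⊂Q (inj₂ (d , c , <c , bs)) =
    inj₂ (d , c , <c , λ k → big-mono l (λ (p , i) → P⊂Q p , i) (bs k))

  big-point : ∀ l {P : Weight α} {x} → P x l → Big α l P
  big-point zero    p = _ , p
  big-point (suc l) p = inj₁ (_ , p)

  big-nonempty : ∀ l {P : Weight α} → Big α l P → ∃₂ λ x i → i ≤ l × P x i
  big-nonempty zero    (x , p)                 = x , 0 , z≤n , p
  big-nonempty (suc l) (inj₁ (x , p))          = x , suc l , ℕ.≤-refl , p
  big-nonempty (suc l) (inj₂ (_ , _ , _ , bs)) with x , i , i≤l , p , _ ← big-nonempty l (bs 0) =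
    x , i , ℕ.m≤n⇒m≤1+n i≤l , p

  big-pred : ∀ l {P : Weight α} → (∀ {x i} → P x (suc i) → P x i) → Big α (suc l) P → Big α l P
  big-pred l down (inj₁ (_ , p))           = big-point l (down p)
  big-pred l down (inj₂ (_ , _ , _ , bs)) = big-mono l proj₁ (bs 0)

  -- Dependent choice: S is an invariant of the points constructed so far.
  big-steps : ∀ α d {P : Weight α} {l} (S : Pred ∣ α ∣ ℓ) {x} → S x →
              (∀ x → S x → ∃ λ y → Lt α d x y × S y × Big α l (P ⊓ Between α x y)) →
              Big α (suc l) P
  big-steps α d {P} {l} S {x₀} s₀ step =
    inj₂ (d , proj₁ ∘ states , (λ k → proj₁ (next k)) , (λ k → proj₂ (proj₂ (next k))))
    where
    states : ℕ → ∃ S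
    next : ∀ k → let x = proj₁ (states k); y = proj₁ (states (suc k)) in
           Lt α d x y × S y × Big α l (P ⊓ Between α x y)
    states zero    = x₀ , s₀
    states (suc k) with y , _ , s , _ ← step (proj₁ (states k)) (proj₂ (states k)) = y , s
    next k = proj₂ (step (proj₁ (states k)) (proj₂ (states k)))

  -- Pigeonhole arguments along chains

  Often : Pred ℕ ℓ → Set ℓ
  Often Q = ∀ N → ∃ λ k → N ≤ k × Q k

  often-⊎ : ∀ {Q R : Pred ℕ ℓ} → Often (Q ∪ R) → Often Q ⊎ Often R
  often-⊎ {Q = Q} {R} h with em {P = ∃ λ N → ∀ k → N ≤ k → ¬ Q k}
  ... | no ¬∃ = inj₁ λ N → dne λ ¬q → ¬∃ (N , λ k N≤k q → ¬q (k , N≤k , q))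
  ... | yes (N₀ , ¬Q) = inj₂ λ N → go N (h (N ℕ.⊔ N₀))
    where
    go : ∀ N → (∃ λ k → N ℕ.⊔ N₀ ≤ k × (Q k ⊎ R k)) → ∃ λ k → N ≤ k × R k
    go N (k , le , inj₁ q) = contradiction q (¬Q k (ℕ.≤-trans (ℕ.m≤n⊔m N N₀) le))
    go N (k , le , inj₂ r) = k , ℕ.≤-trans (ℕ.m≤m⊔n N N₀) le , r

  often-∃ : ∀ l {Q : ℕ → Pred ℕ ℓ} → Often (λ k → ∃ λ i → i ≤ l × Q i k) →
            ∃ λ i → i ≤ l × Often (Q i)
  often-∃ zero {Q} h = 0 , z≤n , λ N → let k , N≤k , i , i≤0 , q = h N in
    k , N≤k , subst (λ i → Q i k) (ℕ.n≤0⇒n≡0 i≤0) q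
  often-∃ (suc l) {Q} h = [ lower-bound , (λ q → suc l , ℕ.≤-refl , q) ]′ (often-⊎ split)
    where
    split : Often ((λ k → ∃ λ i → i ≤ l × Q i k) ∪ Q (suc l))
    split N with h N
    ... | k , N≤k , i , i≤1+l , q with ℕ.m≤n⇒m<n∨m≡n i≤1+l
    ...   | inj₁ (s≤s i≤l) = k , N≤k , inj₁ (i , i≤l , q)
    ...   | inj₂ refl      = k , N≤k , inj₂ q
    lower-bound : Often (λ k → ∃ λ i → i ≤ l × Q i k) → ∃ λ i → i ≤ suc l × Often (Q i)
    lower-bound o with i , i≤l , q ← often-∃ l o = i , ℕ.m≤n⇒m≤1+n i≤l , q

  -- Thinning the chain to the right ends of the good intervals merges every other interval into the
  -- next good one.
  big-often : ∀ d l {P : Weight α} (c : ℕ → ∣ α ∣) → (∀ k → Lt α d (c k) (c (suc k))) →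
              Often (λ k → Big α l (P ⊓ Between α (c k) (c (suc k)))) → Big α (suc l) P
  big-often {α} d l {P} c <c often = big-steps α d S (0 , refl) step
    where
    module D = Order (dir d α)
    S : Pred ∣ α ∣ 0ℓ
    S x = ∃ λ k → x ≡ c k
    step : ∀ x → S x → ∃ λ y → Lt α d x y × S y × Big α l (P ⊓ Between α x y)
    step _ (k , refl) with k′ , k≤k′ , b ← often k =
      c (suc k′) , D.strictlyMonotone <c (s≤s k≤k′) , (suc k′ , refl) ,
      big-mono l (λ (p , btw) → p , between-mono d (D.<⇒≼ (<c k′))
                                      (D.monotone (D.<⇒≼ ∘ <c) k≤k′) D.≼-refl btw) b

  -- Indivisibility, as for the ordinals ω^l: every interval of the chain is big for one of the two
  -- parts, and one part wins infinitely often.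
  big-∪ : ∀ l {P Q : Weight α} → Big α l (λ x i → P x i ⊎ Q x i) → Big α l P ⊎ Big α l Q
  big-∪ zero    (x , inj₁ p)        = inj₁ (x , p)
  big-∪ zero    (x , inj₂ q)        = inj₂ (x , q)
  big-∪ (suc l) (inj₁ (x , inj₁ p)) = inj₁ (inj₁ (x , p))
  big-∪ (suc l) (inj₁ (x , inj₂ q)) = inj₂ (inj₁ (x , q))
  big-∪ {α} (suc l) {P} {Q} (inj₂ (d , c , <c , bs)) =
    [ inj₁ ∘ big-often d l c <c , inj₂ ∘ big-often d l c <c ]′ (often-⊎ (λ N → N , ℕ.≤-refl , split N))
    where
    J : ℕ → Pred ∣ α ∣ 0ℓ
    J k = Between α (c k) (c (suc k))
    split : ∀ k → Big α l (P ⊓ J k) ⊎ Big α l (Q ⊓ J k)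
    split k = big-∪ l (big-mono l (λ (p , i) → [ (λ p → inj₁ (p , i)) , (λ q → inj₂ (q , i)) ]′ p) (bs k))

  -- R y x says that y lies in the block of x.
  module Blocks (β α : CountableOrder) (R : ∣ β ∣ → ∣ α ∣ → Set)
                (mono : ∀ {y y′ x x′} → R y x → R y′ x′ →
                        CountableOrder._<_ α x x′ → CountableOrder._<_ β y y′) where
    private
      module A d = Order (dir d α)
      module B d = Order (dir d β)

    mono-dir : ∀ d {y y′ x x′} → R y x → R y′ x′ → Lt α d x x′ → Lt β d y y′
    mono-dir ↑ r r′ = mono r r′
    mono-dir ↓ r r′ = mono r′ r

    collapse : ∀ l {P : Weight β} {Q : Weight α} → (∀ {y i} → P y i → ∃ (R y)) →
               (∀ {x i} → i ≤ l → Big β i (P ⊓ λ y → R y x) → Q x i) → Big β l P → Big α l Q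
    -- A chain either stays in one block from some point on, or meets
    -- infinitely many blocks.
    collapse zero cover fill (y , p) with x , r ← cover p = x , fill z≤n (y , p , r)
    collapse (suc l) cover fill (inj₁ (y , p)) with x , r ← cover p =
      inj₁ (x , fill ℕ.≤-refl (inj₁ (y , p , r)))
    collapse (suc l) {P} {Q} cover fill (inj₂ (d , c , <c , bs))
      with em {P = ∃₂ λ N x → ∀ k → N ≤ k → ∀ {y i} → P y i → Between β (c k) (c (suc k)) y → R y x}
    ... | yes (N , x , inBlock) = inj₁ (x , fill ℕ.≤-refl (big-often d l c <c λ N′ →
            N ℕ.⊔ N′ , ℕ.m≤n⊔m N N′ ,
            big-mono l (λ (p , btw) → (p , inBlock _ (ℕ.m≤m⊔n N N′) p btw) , btw) (bs (N ℕ.⊔ N′))))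
    ... | no ¬block with y₀ , _ , _ , p₀ , btw₀ ← big-nonempty l (bs 0) with x₀ , r₀ ← cover p₀ =
      big-steps α d S (y₀ , 0 , r₀ , proj₂ (btw⇒≼ btw₀)) step
      where
      open B d
      c≼ : ∀ {i j} → i ≤ j → c i ≼ c j
      c≼ = monotone (<⇒≼ ∘ <c)
      btw⇒≼ : ∀ {k y} → Between β (c k) (c (suc k)) y → c k ≼ y × y ≼ c (suc k)
      btw⇒≼ {k} = between-≼ d (<⇒≼ (<c k))
      S : Pred ∣ α ∣ 0ℓ
      S x = ∃₂ λ y k → R y x × y ≼ c (suc k)
      leaves : ∀ N x → ∃₂ λ k y → N ≤ k × (∃ λ i → P y i) × Between β (c k) (c (suc k)) y × ¬ R y x
      leaves N x = dne λ ¬∃ → ¬block (N , x , λ k N≤k {y} {i} p btw →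
        dne λ ¬r → ¬∃ (k , y , N≤k , (i , p) , btw , ¬r))
      step : ∀ x → S x → ∃ λ x′ → Lt α d x x′ × S x′ × Big α l (Q ⊓ Between α x x′)
      -- Looking from k + 2 onwards leaves the whole interval from c (k+1) to c (k+2) between y and
      -- y′; its points then lie in blocks between x and x′.
      step x (y , k , r , y≼c) with leaves (suc (suc k)) x
      ... | k′ , y′ , k<k′ , (i , p) , btw , ¬r with x′ , r′ ← cover p =
        x′ , x<x′ , (y′ , k′ , r′ , proj₂ (btw⇒≼ btw)) ,
        collapse l (cover ∘ proj₁)
          (λ i≤l b → fill (ℕ.m≤n⇒m≤1+n i≤l) (big-mono _ (λ ((p , _) , r) → p , r) b) , inside b)
          (bs (suc k))
        where
        y≼y′ : y ≼ y′
        y≼y′ = ≼-trans y≼c (≼-trans (c≼ (ℕ.≤-trans (ℕ.n≤1+n _) k<k′)) (proj₁ (btw⇒≼ btw)))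
        x<x′ : Lt α d x x′
        x<x′ with A.≼⇒<⊎≡ d {x} {x′} (λ x′<x → y≼y′ (mono-dir d r′ r x′<x))
        ... | inj₁ x<x′ = x<x′
        ... | inj₂ refl = contradiction r′ ¬r
        inside : ∀ {i x″} →
                 Big β i ((P ⊓ Between β (c (suc k)) (c (suc (suc k)))) ⊓ λ y → R y x″) →
                 Between α x x′ x″
        inside {i} {x″} b with y″ , _ , _ , (_ , btw″) , r″ ← big-nonempty i b
          with c≼y″ , y″≼c ← btw⇒≼ btw″ = ≼-between d
            (λ x″<x → ≼-trans y≼c c≼y″ (mono-dir d r″ r x″<x))
            (λ x′<x″ → ≼-trans y″≼c (≼-trans (c≼ k<k′) (proj₁ (btw⇒≼ btw))) (mono-dir d r′ r″ x′<x″))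

    expand : ∀ l {P : Weight β} {Q : Weight α} →
             (∀ {x i} → i ≤ l → Q x i → Big β i (P ⊓ λ y → R y x)) → Big α l Q → Big β l P
    expand zero    fill (x , q) with y , p , _ ← fill z≤n q = y , p
    expand (suc l) fill (inj₁ (x , q)) = big-mono (suc l) proj₁ (fill ℕ.≤-refl q)
    expand (suc l) {P} {Q} fill (inj₂ (d , c , <c , bs)) = big-steps β d S (proj₁ (proj₂ (pick 0))) step
      where
      open A d
      btw⇒≼ : ∀ {k x} → Between α (c k) (c (suc k)) x → c k ≼ x × x ≼ c (suc k)
      btw⇒≼ {k} = between-≼ d (<⇒≼ (<c k))
      S : Pred ∣ β ∣ 0ℓ
      S y = ∃₂ λ x k → R y x × x ≼ c (suc k)
      pick : ∀ k → ∃ λ y → S y × ∃ λ x → R y x × c k ≼ x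
      pick k with x , i , i≤l , q , btw ← big-nonempty l (bs k)
        with y , _ , _ , _ , r ← big-nonempty i (fill (ℕ.m≤n⇒m≤1+n i≤l) q) =
          y , (x , k , r , proj₂ (btw⇒≼ btw)) , x , r , proj₁ (btw⇒≼ btw)
      -- Leaving gaps keeps the blocks of x and x′ off the interval in use.
      step : ∀ y → S y → ∃ λ y′ → Lt β d y y′ × S y′ × Big β l (P ⊓ Between β y y′)
      step y (x , k , r , x≼c) with y′ , s′ , x′ , r′ , c≼x′ ← pick (4 ℕ.+ k) =
        y′ , mono-dir d r r′ (≼-<-trans x≼c (<-≼-trans (strictlyMonotone <c (ℕ.m≤n+m _ 2)) c≼x′)) ,
        s′ , expand l (λ i≤l (q , btw) → big-mono _
               (λ (p , r″) → (p , inside btw r″) , r″) (fill (ℕ.m≤n⇒m≤1+n i≤l) q)) (bs (2 ℕ.+ k))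
        where
        inside : ∀ {x″ y″} → Between α (c (2 ℕ.+ k)) (c (3 ℕ.+ k)) x″ → R y″ x″ → Between β y y′ y″
        inside btw r″ with c≼x″ , x″≼c ← btw⇒≼ btw = ≼-between d
          (B.<⇒≼ d (mono-dir d r r″ (≼-<-trans x≼c (<-≼-trans (<c (suc k)) c≼x″))))
          (B.<⇒≼ d (mono-dir d r″ r′ (≼-<-trans x″≼c (<-≼-trans (<c (3 ℕ.+ k)) c≼x′))))

  -- Bigness over finite and locally finite orders

  big-singleton : ∀ l {P : Weight α} {z} → Big α l (P ⊓ (_≡ z)) → P z l
  big-singleton zero    (_ , p , refl)        = p
  big-singleton (suc l) (inj₁ (_ , p , refl)) = p
  big-singleton {α} (suc l) (inj₂ (d , c , <c , bs))
    -- Neighbouring intervals share an endpoint, so intervals 0 and 2 are compared: z cannot lie in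
    -- both.
    with _ , _ , _ , (_ , refl) , btw₀ ← big-nonempty l (bs 0)
    with _ , _ , _ , (_ , refl) , btw₂ ← big-nonempty l (bs 2) =
      contradiction (<c 1) (≼-trans (proj₁ (between-≼ d (<⇒≼ (<c 2)) btw₂))
                                    (proj₂ (between-≼ d (<⇒≼ (<c 0)) btw₀)))
    where open Order (dir d α)

  -- By indivisibility the bigness concentrates on one of the finitely many points, where no chain
  -- can contribute.
  big-list : ∀ l {P : Weight α} xs → (∀ {x i} → P x i → x ∈ₗ xs) → Big α l P → ∃ λ x → P x l
  big-list l []       P⊂xs b with _ , _ , _ , p ← big-nonempty l b with P⊂xs p
  ... | ()
  big-list {α} l {P} (z ∷ xs) P⊂xs b =
    [ (λ b → z , big-singleton l b)
    , (λ b → let x , p , _ = big-list l xs proj₂ b in x , p) ]′ (big-∪ l (big-mono l split b))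
    where
    split : ∀ {x i} → P x i → (P ⊓ (_≡ z)) x i ⊎ (P ⊓ (_∈ₗ xs)) x i
    split p with P⊂xs p
    ... | here x≡z   = inj₁ (p , x≡z)
    ... | there x∈xs = inj₂ (p , x∈xs)

  LocallyFinite : Pred CountableOrder 0ℓ
  LocallyFinite α = ∀ a b → ∃ λ xs → ∀ {x} → Between α a b x → x ∈ₗ xs

  -- A chain has only finitely many points in its first interval, so level l there must come from a
  -- single letter. Chains in such an order therefore add at most one level.
  big-locallyFinite : LocallyFinite α → ∀ l {P : Weight α} → Big α (suc l) P →
                      ∃ λ x → P x l ⊎ P x (suc l)
  big-locallyFinite locFin l (inj₁ (x , p)) = x , inj₂ p
  big-locallyFinite locFin l (inj₂ (d , c , <c , bs))
    with xs , ⊂xs ← locFin (c 0) (c 1)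
    with x , p , _ ← big-list l xs (⊂xs ∘ proj₂) (bs 0) = x , inj₁ p

  dir-locallyFinite : ∀ d → LocallyFinite α → LocallyFinite (dir d α)
  dir-locallyFinite ↑ locFin = locFin
  dir-locallyFinite ↓ locFin a b with xs , ⊂xs ← locFin a b = xs , λ (p , q) → ⊂xs (q , p)

  ω-locallyFinite : LocallyFinite ω
  ω-locallyFinite a b = upTo (suc (a ℕ.+ b)) , λ (_ , q) → ∈-upTo⁺ (s≤s (ℕ.≮⇒≥ λ a+b<x →
    q (ℕ.≤-<-trans (ℕ.m≤m+n a b) a+b<x) (ℕ.≤-<-trans (ℕ.m≤n+m b a) a+b<x)))

  ζ-locallyFinite : LocallyFinite ζ
  ζ-locallyFinite a b = List.map +_ (upTo (suc m)) ++ List.map -[1+_] (upTo (suc m)) , λ {x} → bound x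
    where
    m = ℤ.∣ a ∣ ℕ.+ ℤ.∣ b ∣
    above : ∀ i {k} → ℤ.∣ i ∣ ℕ.< k → i ℤ.< + k
    above (+ _)    lt = ℤ.+<+ lt
    above -[1+ _ ] lt = ℤ.-<+
    below : ∀ i {k} → ℤ.∣ i ∣ ℕ.< k → -[1+ k ] ℤ.< i
    below (+ _)    lt = ℤ.-<+
    below -[1+ _ ] lt = ℤ.-<- (ℕ.<-trans (ℕ.n<1+n _) lt)
    bound : ∀ x → Between ζ a b x → x ∈ₗ (List.map +_ (upTo (suc m)) ++ List.map -[1+_] (upTo (suc m)))
    bound (+ k) (_ , q) = ∈-++⁺ˡ (∈-map⁺ +_ (∈-upTo⁺ (s≤s (ℕ.≮⇒≥ λ m<k →
      q (above a (ℕ.≤-<-trans (ℕ.m≤m+n ℤ.∣ a ∣ _) m<k)) (above b (ℕ.≤-<-trans (ℕ.m≤n+m _ ℤ.∣ a ∣) m<k))))))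
    bound -[1+ k ] (p , _) = ∈-++⁺ʳ (List.map +_ (upTo (suc m))) (∈-map⁺ -[1+_] (∈-upTo⁺ (s≤s (ℕ.≮⇒≥ λ m<k →
      p (below a (ℕ.≤-<-trans (ℕ.m≤m+n ℤ.∣ a ∣ _) m<k)) (below b (ℕ.≤-<-trans (ℕ.m≤n+m _ ℤ.∣ a ∣) m<k))))))

  -- Each interval of the chain splits its level l as i + j by induction. Finitely many i are
  -- possible, so one recurs; the intervals with that i all have the same j = l ∸ i, and the chain
  -- through them adds one to it.
  big⇒pure : ∀ l {P : Weight α} → Big α l P →
             ∃₂ λ i j → i ℕ.+ j ≡ l × Big α j (pure (λ x → P x i))
  big⇒pure zero    (x , p)        = 0 , 0 , refl , x , refl , p
  big⇒pure (suc l) (inj₁ (x , p)) = suc l , 0 , ℕ.+-identityʳ _ , x , refl , p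
  big⇒pure {α} (suc l) {P} (inj₂ (d , c , <c , bs))
    = let i , i≤l , often = often-∃ l (λ N → N , ℕ.≤-refl , level N) in
      i , suc (l ℕ.∸ i) , trans (ℕ.+-suc i _) (cong suc (ℕ.m+[n∸m]≡n i≤l)) ,
      big-often d _ c <c often
    where
    J : ℕ → Pred ∣ α ∣ 0ℓ
    J k = Between α (c k) (c (suc k))
    level : ∀ k → ∃ λ i → i ≤ l × Big α (l ℕ.∸ i) (pure (λ x → P x i) ⊓ J k)
    level k with i , j , refl , b ← big⇒pure l (bs k) =
      i , ℕ.m≤m+n i j , subst (λ j → Big α j (pure (λ x → P x i) ⊓ J k)) (sym (ℕ.m+n∸m≡n i j))
        (big-mono j (λ (z , p , b) → (z , p) , b) b)

  pure⇒big : ∀ i j {P : Weight α} → Big α j (pure (λ x → P x i)) → Big α (i ℕ.+ j) P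
  pure⇒big {α} i zero    {P} (x , _ , p) = subst (λ l → Big α l P) (sym (ℕ.+-identityʳ i)) (big-point i p)
  pure⇒big {α} i (suc j) {P} (inj₂ (d , c , <c , bs)) = subst (λ l → Big α l P) (sym (ℕ.+-suc i j))
    (inj₂ (d , c , <c , λ k → pure⇒big i j (big-mono j (λ ((z , p) , b) → z , p , b) (bs k))))

  -- Excluded middle resizes every type to a proposition in Set.
  ⌊_⌋ : Set ℓ → Set
  ⌊ P ⌋ = True (em {P = P})

  ⌊⌋⁺ : {P : Set ℓ} → P → ⌊ P ⌋
  ⌊⌋⁺ = fromWitness

  ⌊⌋⁻ : {P : Set ℓ} → ⌊ P ⌋ → P
  ⌊⌋⁻ = toWitness

  -- What the cutting argument needs to know about an upper bound. Both "empty or of rank below l"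
  -- and "product of value at most l" satisfy these closure rules, so the argument is made only
  -- once.
  record IsSmallness {α : CountableOrder} (P : Weight α) (Good : ℕ → Pred (Pred ∣ α ∣ 0ℓ) ℓ) :
                     Set (lsuc 0ℓ ⊔ ℓ) where
    open CountableOrder α
    field
      ext    : ∀ {l I J} → (∀ {x} → I x → J x) → (∀ {x} → J x → I x) → Good l I → Good l J
      initial : ∀ {I} → (∀ {x} → I x → ¬ P x 0) → Good 0 I
      empty  : ∀ {l I} → (∀ {x} → ¬ I x) → Good (suc l) I
      single : ∀ {l x} → ¬ P x (suc l) → Good (suc l) (_≡ x)
      join   : ∀ {l I J} → (∀ {x y} → I x → J y → x < y) →
               Good (suc l) I → Good (suc l) J → Good (suc l) (I ∪ J)
      limit  : ∀ {l I} d {c : ℕ → ∣ α ∣} → (∀ k → ¬ Lt α d (c (suc k)) (c k)) →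
               (∀ k → Good l (I ∩ Ioc α d (c k) (c (suc k)))) →
               Good (suc l) (I ∩ λ x → ∃ λ k → Ioc α d (c k) (c (suc k)) x)

  -- If every bounded part of J is good at level l, then J is good at level
  -- suc l, being a two-sided ω-limit.  So a bad I has bounded bad parts;
  -- cut it into its largest hereditarily good initial segment D and the
  -- rest.  If D is bad then so are all its final segments, which yields an
  -- increasing chain; otherwise all initial segments of I ∖ D are bad,
  -- which yields a decreasing one.
  module _ {α : CountableOrder} {P : Weight α} {Good : ℕ → Pred (Pred ∣ α ∣ 0ℓ) ℓ}
           (isSmallness : IsSmallness {α = α} P Good) where
    open IsSmallness isSmallness
    open Order α

    ¬big⇒good : ∀ l {I} → ¬ Big α l (P ⊓ I) → Good l I
    ¬big⇒good zero    ¬big = initial λ i p → ¬big (_ , p , i)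
    ¬big⇒good (suc l) {I} ¬big = dne (¬big ∘ bad⇒big)
      where
      T : Pred (Pred ∣ α ∣ 0ℓ) _
      T = Good (suc l)

      BigPair : Pred ∣ α ∣ 0ℓ → Set
      BigPair J = ∃₂ λ a b → J a × J b × a < b × Big α l (P ⊓ I ⊓ Between α a b)

      bigPair-dir : ∀ d {J a b} → J a → J b → Lt α d a b → Big α l (P ⊓ I ⊓ Between α a b) → BigPair J
      bigPair-dir ↑ ja jb a<b b = _ , _ , ja , jb , a<b , b
      bigPair-dir ↓ ja jb b<a b =
        _ , _ , jb , ja , b<a , big-mono l (λ (p , btw) → p , between-sym α btw) b

      single-I : ∀ {x} → I x → T (_≡ x)
      single-I i = single λ p → ¬big (inj₁ (_ , p , i))

      module _ {J} (J⊂I : ∀ {x} → J x → I x) (¬pair : ¬ BigPair J) {z} (jz : J z) (d : Direction) where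
        open Order (dir d α) using () renaming
          ( _<_ to _<ᵈ_; _≼_ to _≼ᵈ_; ≼-refl to ≼ᵈ-refl; <⇒≼ to <⇒≼ᵈ; irrefl to irreflᵈ
          ; ≼-<-trans to ≼-<-transᵈ; <-≼-trans to <-≼-transᵈ)
        private
          code : ∣ α ∣ → ℕ
          code = Injection.to countable

          Next : ℕ → ∣ α ∣ → Pred ∣ α ∣ 0ℓ
          Next k a x = J x × code x ≡ k × a <ᵈ x

          -- Stage k moves to the point of code k if that point is in J and further out. As every
          -- point has a code, the resulting sequence is cofinal in J.
          state : ℕ → ∃ J
          state zero    = z , jz
          state (suc k) with em {P = ∃ (Next k (proj₁ (state k)))}
          ... | yes (x , j , _) = x , j
          ... | no _            = state k

          c : ℕ → ∣ α ∣
          c = proj₁ ∘ state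

          c-mono : ∀ k → c k ≼ᵈ c (suc k)
          c-mono k with em {P = ∃ (Next k (c k))}
          ... | yes (x , _ , _ , lt) = <⇒≼ᵈ lt
          ... | no _                 = ≼ᵈ-refl

          c-cofinal : ∀ {x} → J x → x ≼ᵈ c (suc (code x))
          c-cofinal {x} j with em {P = ∃ (Next (code x) (c (code x)))}
          ... | yes (x′ , _ , eq , _) = λ lt → irreflᵈ (Injection.injective countable eq) lt
          ... | no ¬next              = λ lt → ¬next (x , j , refl , lt)

          after-z : ∀ m {x} → c m <ᵈ x → z <ᵈ x
          after-z zero    lt = lt
          after-z (suc m) lt = after-z m (≼-<-transᵈ (c-mono m) lt)

        side : T (J ∩ (z <ᵈ_))
        side = ext (λ (j , m , c<x , _) → j , after-z m c<x)
          (λ {x} (j , z<x) → j , locate d c (suc (code x)) z<x (c-cofinal j))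
          -- All c k belong to J, so a piece that is big at level l would give a forbidden pair; the
          -- induction on l then makes each piece good.
          (limit d c-mono λ k → ¬big⇒good l λ b →
            let _ , _ , _ , _ , _ , c<x , x≼c = big-nonempty l b in
            ¬pair (bigPair-dir d (proj₂ (state k)) (proj₂ (state (suc k))) (<-≼-transᵈ c<x x≼c)
              (big-mono l (λ (p , j , c<x , x≼c) → (p , J⊂I j) , ≼-between d (<⇒≼ᵈ c<x) x≼c) b)))

      bad⇒bigPair : ∀ {J} → (∀ {x} → J x → I x) → ¬ T J → BigPair J
      bad⇒bigPair {J} J⊂I bad with em {P = ∃ J}
      ... | no ¬∃ = contradiction (empty λ j → ¬∃ (_ , j)) bad
      ... | yes (z , jz) = dne λ ¬pair → bad (ext
              (λ { (inj₁ (inj₁ (j , _))) → j ; (inj₁ (inj₂ refl)) → jz ; (inj₂ (j , _)) → j })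
              three
              (join (λ { (inj₁ (_ , x<z)) (_ , z<y) → <-trans x<z z<y ; (inj₂ refl) (_ , z<y) → z<y })
                (join (λ { (_ , x<z) refl → x<z }) (side J⊂I ¬pair jz ↓) (single-I (J⊂I jz)))
                (side J⊂I ¬pair jz ↑)))
        where
        three : ∀ {x} → J x → (((J ∩ (_< z)) ∪ (_≡ z)) ∪ (J ∩ (z <_))) x
        three {x} j with compare x z
        ... | tri< lt _ _ = inj₁ (inj₁ (j , lt))
        ... | tri≈ _ eq _ = inj₁ (inj₂ eq)
        ... | tri> _ _ gt = inj₂ (j , gt)

      upTo′ : ∣ α ∣ → Pred ∣ α ∣ 0ℓ
      upTo′ x y = I y × y ≼ x

      D : Pred ∣ α ∣ 0ℓ
      -- `T` may live in a higher universe; resizing turns D into a set of points to which `T`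
      -- itself applies.
      D x = I x × ⌊ (∀ y → I y → y ≼ x → T (upTo′ y)) ⌋

      badBelow : ∀ {x} → I x → ¬ D x → ∃ λ y → y ≼ x × I y × ¬ T (upTo′ y)
      badBelow ix ¬dx = dne λ ¬∃ → ¬dx (ix , ⌊⌋⁺ λ _ iy y≼x → dne λ bad → ¬∃ (_ , y≼x , iy , bad))

      bad⇒big : ¬ T I → Big α (suc l) (P ⊓ I)
      bad⇒big bad with em {P = T D}
      ... | no ¬good with a , _ , da , _ ← bad⇒bigPair proj₁ ¬good = big-steps α ↑ D da step
        where
        step : ∀ x → D x → ∃ λ y → x < y × D y × Big α l (P ⊓ I ⊓ Between α x y)
        step x (ix , good) with bad⇒bigPair {D ∩ (x <_)} (proj₁ ∘ proj₁) (λ t → ¬good (ext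
            (λ { (inj₁ (iy , y≼x)) → iy , ⌊⌋⁺ (λ _ iz z≼y → ⌊⌋⁻ good _ iz (≼-trans z≼y y≼x))
               ; (inj₂ (dy , _)) → dy })
            split (join (λ (_ , y≼x) (_ , x<z) → ≼-<-trans y≼x x<z) (⌊⌋⁻ good x ix ≼-refl) t)))
          where
          split : ∀ {y} → D y → (upTo′ x ∪ (D ∩ (x <_))) y
          split {y} dy with em {P = x < y}
          ... | yes x<y = inj₂ (dy , x<y)
          ... | no x≮y  = inj₁ (proj₁ dy , x≮y)
        ... | a , b , (_ , x<a) , (db , _) , a<b , big =
          b , <-trans x<a a<b , db ,
          big-mono l (λ (p , btw) → p , between-mono ↑ {α = α} (<⇒≼ a<b) (<⇒≼ x<a) ≼-refl btw) big
      ... | yes good with em {P = ∃ λ x → I x × ¬ D x}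
      ...   | no ¬∃ = contradiction (ext proj₁ (λ ix → dne λ ¬dx → ¬∃ (_ , ix , ¬dx)) good) bad
      ...   | yes (x₀ , ix₀ , ¬dx₀) = big-steps α ↓ S (proj₂ (proj₂ (badBelow ix₀ ¬dx₀))) step
        where
        S : Pred ∣ α ∣ _
        S x = I x × ¬ T (upTo′ x)
        step : ∀ x → S x → ∃ λ y → y < x × S y × Big α l (P ⊓ I ⊓ Between α x y)
        step x (ix , bad) with bad⇒bigPair {λ y → I y × ¬ D y × y < x} proj₁ (λ t → bad (ext
            (λ { (inj₁ (inj₁ dy)) → proj₁ dy , asym (D<x dy)
               ; (inj₁ (inj₂ (iy , _ , y<x))) → iy , asym y<x
               ; (inj₂ refl) → ix , ≼-refl })
            split
            (join (λ { (inj₁ dy) refl → D<x dy ; (inj₂ (_ , _ , y<x)) refl → y<x })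
              (join D<¬D good t) (single-I ix))))
          where
          D<x : ∀ {y} → D y → y < x
          D<x (_ , good) = dne λ y≮x → bad (⌊⌋⁻ good x ix y≮x)
          D<¬D : ∀ {y z} → D y → (I z × ¬ D z × z < x) → y < z
          D<¬D (_ , good) (iz , ¬dz , _) = dne λ y≮z → ¬dz (iz , ⌊⌋⁺ λ _ iw w≼z → ⌊⌋⁻ good _ iw (≼-trans w≼z y≮z))
          split : ∀ {y} → upTo′ x y → ((D ∪ (λ y → I y × ¬ D y × y < x)) ∪ (_≡ x)) y
          split {y} (iy , y≼x) with ≼⇒<⊎≡ y≼x | em {P = D y}
          ... | inj₂ y≡x | _      = inj₂ y≡x
          ... | inj₁ y<x | yes dy = inj₁ (inj₁ dy)
          ... | inj₁ y<x | no ¬dy = inj₁ (inj₂ (iy , ¬dy , y<x))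
        -- The point a need not have a bad initial segment itself, but being outside D it has a
        -- point y ≼ a with one; from y to x the big interval from a to b is still covered.
        ... | a , b , (ia , ¬da , _) , (_ , _ , b<x) , a<b , big with y , y≼a , sy ← badBelow ia ¬da =
          y , ≼-<-trans y≼a (<-trans a<b b<x) , sy ,
          big-mono l (λ (p , btw) → p , between-sym α (between-mono ↑ {α = α} (<⇒≼ a<b) y≼a (<⇒≼ b<x) btw)) big

  -- Infinitary rank

  Separated : (β α : CountableOrder) → Pred ∣ α ∣ 0ℓ → (∣ β ∣ → Pred ∣ α ∣ 0ℓ) → Set
  Separated β α I V =
    (∀ {x} → I x → ∃ λ i → V i x) × (∀ {i x} → V i x → I x) ×
    (∀ {i j x y} → V i x → V j y → CountableOrder._<_ β i j → CountableOrder._<_ α x y)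

  ∑-↾ : ∀ {I V} → Separated β α I V → ∑ β (λ i → α ↾ V i) ≅ α ↾ I
  ∑-↾ {β} {α} {I} {V} (cover , inside , sep) = mk≅ to mono surj
    where
    module α = CountableOrder α
    to : ∣ ∑ β (λ i → α ↾ V i) ∣ → ∣ α ↾ I ∣
    to (_ , x , [ v ]) = x , [ inside v ]
    mono : ∀ {p q} → CountableOrder._<_ (∑ β (λ i → α ↾ V i)) p q → value (to p) α.< value (to q)
    mono {_ , x , [ v ]} {_ , y , [ w ]} (fst< i<j) = recompute (x α.<? y) (sep v w i<j)
    mono (snd< x<y) = x<y
    surj : ∀ y → ∃ λ p → to p ≡ y
    surj (y , [ iy ]) with i , v ← cover (recompute em iy) = (i , y , [ v ]) , refl

  full : (α : CountableOrder) → Weight α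
  full α = pure U

  -- A relation rather than a function, so that it serves along an embedding and also along a
  -- partial inverse of one, defined on I only.
  big-image : (R : ∣ β ∣ → ∣ α ∣ → Set) →
              (∀ {y y′ x x′} → R y x → R y′ x′ → CountableOrder._<_ α x x′ → CountableOrder._<_ β y y′) →
              ∀ {I J} → (∀ {x} → I x → ∃ λ y → R y x × J y) → ∀ l → Big α l (pure I) → Big β l (pure J)
  big-image {β} {α} R mono I⊂J l = Blocks.expand β α R mono l
    λ { _ (refl , i) → let y , r , j = I⊂J i in y , (refl , j) , r }

  big-embed : (f : ∣ α ∣ → ∣ β ∣) →
              (∀ {x y} → CountableOrder._<_ α x y → CountableOrder._<_ β (f x) (f y)) →
              ∀ {I J} → (∀ {x} → I x → J (f x)) → ∀ l → Big α l (pure I) → Big β l (pure J)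
  big-embed {α} {β} f f-mono I⊂J = big-image {β} {α} (λ y x → f x ≡ y) (λ { refl refl → f-mono })
    λ i → _ , refl , I⊂J i

  big-↾⁻ : ∀ {I} l → Big (α ↾ I) l (full (α ↾ I)) → Big α l (pure I)
  big-↾⁻ {α} {I} = big-embed {α = α ↾ I} {β = α} value (λ lt → lt) {J = I} λ { {x , [ i ]} _ → recompute em i }

  big-↾⁺ : ∀ {I} l → Big α l (pure I) → Big (α ↾ I) l (full (α ↾ I))
  big-↾⁺ {α} {I} = big-image {β = α ↾ I} {α = α} (λ y x → value y ≡ x) (λ { refl refl lt → lt })
    λ i → (_ , [ i ]) , refl , _

  -- Each summand shrinks to one index that carries the levels of the summand as weights, which
  -- moves the question to the index order.
  big-∑ : ∀ {α γ} {δ : ∣ γ ∣ → CountableOrder} (φ : α ≅ ∑ γ δ) →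
          ∀ l → Big α l (full α) → Big γ l (λ i j → Big (δ i) j (full (δ i)))
  big-∑ {α} {γ} {δ} φ l = Blocks.collapse α γ R (λ { refl refl i<j → φ.cancel (fst< i<j) }) l
      (λ _ → _ , refl)
      (λ {i} {j} _ b → big-image {β = δ i} {α = α} (λ x a → φ.to a ≡ (i , x))
        (λ r r′ lt → snd (≡.subst₂ _≺∑_ r r′ (φ.mono lt)))
        (λ { {a} refl → _ , refl , _ }) j (big-mono j (λ ((z , _) , r) → z , r) b))
    where
    module φ = _≅_ φ
    open CountableOrder (∑ γ δ) using () renaming (_<_ to _≺∑_)
    R : ∣ α ∣ → ∣ γ ∣ → Set
    R a i = proj₁ (φ.to a) ≡ i
    snd : ∀ {i x y} → (i , x) ≺∑ (i , y) → CountableOrder._<_ (δ i) x y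
    snd (fst< i<i) = contradiction i<i (CountableOrder.irrefl γ refl)
    snd (snd< x<y) = x<y

  -- In each generating operation the index order limits the gain: a finite index adds no level to
  -- that of the summands, and ℤ, being locally finite, adds at most one.
  𝓘⇒¬big : ∀ {n} → α ∈ 𝓘 n → ¬ Big α (suc n) (full α)
  𝓘⇒¬big {α} (fin k φ) b = contradiction (proj₁ (proj₂ point)) λ ()
    where
    point = big-list {α = finite (suc k)} 1 {P = full (finite (suc k))} (allFin (suc k)) (λ _ → ∈-allFin _)
      (big-embed {α = α} {β = finite (suc k)} (_≅_.to φ) (_≅_.mono φ) _ 1 b)
  𝓘⇒¬big {n = suc n} (zsum δ δ∈ _ φ) b =
    [ block i , block i ∘ big-pred (suc n) (λ ()) ]′ big
    where
    i-big = big-locallyFinite ζ-locallyFinite (suc n) (big-∑ φ (suc (suc n)) b)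
    i = proj₁ i-big
    big = proj₂ i-big
    block : ∀ i → ¬ Big (δ i) (suc n) (full (δ i))
    block i b with δ∈ i
    ... | inj₁ δᵢ∈   = 𝓘⇒¬big δᵢ∈ b
    ... | inj₂ empty = empty (proj₁ (big-nonempty (suc n) b))
  𝓘⇒¬big (fsum {n} k δ δ∈ φ) b
    with i , b ← big-list (suc (suc n)) (allFin (suc k)) (λ _ → ∈-allFin _) (big-∑ φ (suc (suc n)) b) =
      𝓘⇒¬big (δ∈ i) b

  𝓘-resp-≅ : ∀ {n} → α ≅ β → β ∈ 𝓘 n → α ∈ 𝓘 n
  𝓘-resp-≅ φ (fin k ψ)            = fin k (≅-trans φ ψ)
  𝓘-resp-≅ φ (zsum δ δ∈ y ψ)      = zsum δ δ∈ (proj₁ (_≅_.surj φ y)) (≅-trans φ ψ)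
  𝓘-resp-≅ φ (fsum k δ δ∈ ψ)      = fsum k δ δ∈ (≅-trans φ ψ)

  𝓘-singleton : ∀ n {x} → α ↾ (_≡ x) ∈ 𝓘 n
  𝓘-singleton {α} zero {x} = fin 0 (mk≅ (λ _ → zero)
    (λ { {a , [ p ]} {b , [ q ]} a<b → contradiction a<b
           (CountableOrder.irrefl α (trans (recompute em p) (sym (recompute em q)))) })
    λ { zero → (x , [ refl ]) , refl })
  𝓘-singleton {α} (suc n) {x} = zsum δ
    (λ { (+ zero) → inj₁ (𝓘-singleton n) ; (+ suc _) → inj₂ λ () ; -[1+ _ ] → inj₂ λ () })
    (x , [ refl ])
    (mk≅ {β = ∑ ζ δ} (λ a → + 0 , a) snd< λ { (+ zero , a) → a , refl })
    where
    δ : ℤ → CountableOrder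
    δ (+ zero) = α ↾ (_≡ x)
    δ _        = finite 0

  ∑-finite : ∀ m n → ∑ (finite 2) (lookup (finite m ∷ finite n ∷ [])) ≅ finite (m ℕ.+ n)
  ∑-finite m n = mk≅ to (λ {p} {q} → mono {p} {q}) surj
    where
    open CountableOrder (∑ (finite 2) (lookup (finite m ∷ finite n ∷ []))) using () renaming (_<_ to _≺∑_)
    to : ∣ ∑ (finite 2) (lookup (finite m ∷ finite n ∷ [])) ∣ → Fin (m ℕ.+ n)
    to (zero     , i) = i Fin.↑ˡ n
    to (suc zero , j) = m Fin.↑ʳ j
    mono : ∀ {p q} → p ≺∑ q → to p Fin.< to q
    mono {zero , _}     {zero , _}     (fst< ())
    mono {zero , i}     {zero , j}     (snd< lt) =
      ≡.subst₂ ℕ._<_ (sym (Fin.toℕ-↑ˡ i n)) (sym (Fin.toℕ-↑ˡ j n)) lt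
    mono {zero , i}     {suc zero , j} _ =
      ≡.subst₂ ℕ._<_ (sym (Fin.toℕ-↑ˡ i n)) (sym (Fin.toℕ-↑ʳ m j)) (ℕ.<-≤-trans (Fin.toℕ<n i) (ℕ.m≤m+n m _))
    mono {suc zero , _} {zero , _}     (fst< ())
    mono {suc zero , _} {suc zero , _} (fst< (s≤s ()))
    mono {suc zero , i} {suc zero , j} (snd< lt) =
      ≡.subst₂ ℕ._<_ (sym (Fin.toℕ-↑ʳ m i)) (sym (Fin.toℕ-↑ʳ m j)) (ℕ.+-monoʳ-< m lt)
    surj : ∀ k → ∃ λ p → to p ≡ k
    surj k with Fin.splitAt m k in eq
    ... | inj₁ i = (zero , i) , Fin.splitAt⁻¹-↑ˡ eq
    ... | inj₂ j = (suc zero , j) , Fin.splitAt⁻¹-↑ʳ eq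

  ∪-separated : ∀ {I J : Pred ∣ α ∣ 0ℓ} → (∀ {x y} → I x → J y → CountableOrder._<_ α x y) →
                Separated (finite 2) α (I ∪ J) (lookup (I ∷ J ∷ []))
  ∪-separated I<J = [ (zero ,_) , (suc zero ,_) ]′
    , (λ { {zero} → inj₁ ; {suc zero} → inj₂ })
    , λ { {zero}     {zero}     _ _ ()
        ; {zero}     {suc zero} i j _ → I<J i j
        ; {suc zero} {zero}     _ _ ()
        ; {suc zero} {suc zero} _ _ (s≤s ()) }

  𝓘-∪ : ∀ n {I J} → (∀ {x y} → I x → J y → CountableOrder._<_ α x y) →
        α ↾ I ∈ 𝓘 n → α ↾ J ∈ 𝓘 n → α ↾ (I ∪ J) ∈ 𝓘 n
  𝓘-∪ {α} n {I} {J} I<J I∈ J∈ = two n I∈ J∈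
    where
    V : Fin 2 → Pred ∣ α ∣ 0ℓ
    V = lookup (I ∷ J ∷ [])
    two : ∀ n → α ↾ I ∈ 𝓘 n → α ↾ J ∈ 𝓘 n → α ↾ (I ∪ J) ∈ 𝓘 n
    two zero (fin k φ) (fin m ψ) = fin (k ℕ.+ suc m)
      (≅-trans (≅-sym (∑-↾ (∪-separated {α = α} {I} {J} I<J))) (≅-trans
        (∑-cong {α′ = finite 2} {β′ = lookup (finite (suc k) ∷ finite (suc m) ∷ [])} ≅-refl
          λ { zero → φ ; (suc zero) → ψ })
        (∑-finite (suc k) (suc m))))
    two (suc n) I∈ J∈ = fsum 1 (λ i → α ↾ V i) (λ { zero → I∈ ; (suc zero) → J∈ })
      (≅-sym (∑-↾ (∪-separated {α = α} {I} {J} I<J)))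

  ioc-separated : ∀ d {c : ℕ → ∣ α ∣} → (∀ k → Order._≼_ (dir d α) (c k) (c (suc k))) → ∀ {i j x y} →
                  Ioc α d (c i) (c (suc i)) x → Ioc α d (c j) (c (suc j)) y → i ℕ.< j → Lt α d x y
  ioc-separated {α} d c-mono (_ , x≼c) (c<y , _) i<j = ≼-<-trans (≼-trans x≼c (monotone c-mono i<j)) c<y
    where open Order (dir d α)

  𝓘-limit : ∀ d n {I} {c : ℕ → ∣ α ∣} → (∀ k → Order._≼_ (dir d α) (c k) (c (suc k))) →
            (∀ k → α ↾ (I ∩ Ioc α d (c k) (c (suc k))) ∈ 𝓘 n ⊎
                   ¬ Nonempty (α ↾ (I ∩ Ioc α d (c k) (c (suc k))))) →
            let J = I ∩ λ x → ∃ λ k → Ioc α d (c k) (c (suc k)) x in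
            ∃ J → α ↾ J ∈ 𝓘 (suc n)
  𝓘-limit {α} d n {I} {c} c-mono pieces (x , j) =
    zsum (λ z → α ↾ V d z) (V∈ d pieces) (x , [ j ]) (≅-sym (∑-↾ (cover d , inside d , sep d c-mono)))
    where
    Piece : Direction → ℕ → Pred ∣ α ∣ 0ℓ
    Piece d k = I ∩ Ioc α d (c k) (c (suc k))
    J : Direction → Pred ∣ α ∣ 0ℓ
    J d = I ∩ λ x → ∃ λ k → Ioc α d (c k) (c (suc k)) x
    -- An ω-limit occupies the nonnegative half of ℤ and an ω*-limit the negative half, where -1 - k
    -- runs downwards with k; the other half is left empty.
    V : Direction → ℤ → Pred ∣ α ∣ 0ℓ
    V ↑ (+ k)    = Piece ↑ k
    V ↑ -[1+ k ] = λ _ → ⊥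
    V ↓ (+ k)    = λ _ → ⊥
    V ↓ -[1+ k ] = Piece ↓ k
    V∈ : ∀ d → (∀ k → α ↾ Piece d k ∈ 𝓘 n ⊎ ¬ Nonempty (α ↾ Piece d k)) →
         ∀ z → α ↾ V d z ∈ 𝓘 n ⊎ ¬ Nonempty (α ↾ V d z)
    V∈ ↑ p (+ k)    = p k
    V∈ ↑ p -[1+ k ] = inj₂ λ { (_ , [ () ]) }
    V∈ ↓ p (+ k)    = inj₂ λ { (_ , [ () ]) }
    V∈ ↓ p -[1+ k ] = p k
    cover : ∀ d {x} → J d x → ∃ λ z → V d z x
    cover ↑ (i , k , p) = + k , i , p
    cover ↓ (i , k , p) = -[1+ k ] , i , p
    inside : ∀ d {z x} → V d z x → J d x
    inside ↑ {+ k}    (i , p) = i , k , p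
    inside ↓ { -[1+ k ]} (i , p) = i , k , p
    sep : ∀ d → (∀ k → Order._≼_ (dir d α) (c k) (c (suc k))) → ∀ {z z′ x y} →
          V d z x → V d z′ y → z ℤ.< z′ → CountableOrder._<_ α x y
    sep ↑ c-mono {+ _}    {+ _}    (_ , p) (_ , q) (ℤ.+<+ lt) = ioc-separated {α = α} ↑ {c} c-mono p q lt
    sep ↓ c-mono { -[1+ _ ]} { -[1+ _ ]} (_ , p) (_ , q) (ℤ.-<- lt) = ioc-separated {α = α} ↓ {c} c-mono q p lt

  -- Shifted by one: not being big at level 1 means being finite, that is, in `𝓘 0`. Emptiness is
  -- allowed at each level since cutting may produce empty pieces, whereas `𝓘` has nonempty orders
  -- only.
  RankGood : ∀ α → ℕ → Pred (Pred ∣ α ∣ 0ℓ) (lsuc 0ℓ)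
  RankGood α zero    I = Lift (lsuc 0ℓ) (¬ ∃ I)
  RankGood α (suc l) I = ¬ ∃ I ⊎ α ↾ I ∈ 𝓘 l

  rank-isSmallness : ∀ α → IsSmallness (full α) (RankGood α)
  rank-isSmallness α = record
    { ext     = λ {l} → ext l
    ; initial = λ ¬p → lift λ (x , i) → ¬p i (refl , _)
    ; empty   = λ ¬i → inj₁ λ (x , i) → ¬i i
    ; single  = λ {l} _ → inj₂ (𝓘-singleton l)
    ; join    = λ {l} → join l
    ; limit   = λ {l} → limit l
    }
    where
    Good = RankGood α
    ext : ∀ l {I J} → (∀ {x} → I x → J x) → (∀ {x} → J x → I x) → Good l I → Good l J
    ext zero    I⊂J J⊂I (lift ¬∃) = lift λ (x , j) → ¬∃ (x , J⊂I j)
    ext (suc l) I⊂J J⊂I (inj₁ ¬∃) = inj₁ λ (x , j) → ¬∃ (x , J⊂I j)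
    ext (suc l) I⊂J J⊂I (inj₂ I∈) = inj₂ (𝓘-resp-≅ (↾-cong ≅-refl J⊂I I⊂J) I∈)
    join : ∀ l {I J} → (∀ {x y} → I x → J y → CountableOrder._<_ α x y) →
           Good (suc l) I → Good (suc l) J → Good (suc l) (I ∪ J)
    join l I<J (inj₁ ¬i) (inj₁ ¬j) = inj₁ λ { (x , inj₁ i) → ¬i (x , i) ; (x , inj₂ j) → ¬j (x , j) }
    join l I<J (inj₁ ¬i) (inj₂ J∈) =
      ext (suc l) inj₂ (λ { {x} (inj₁ i) → contradiction (x , i) ¬i ; (inj₂ j) → j }) (inj₂ J∈)
    join l I<J (inj₂ I∈) (inj₁ ¬j) =
      ext (suc l) inj₁ (λ { (inj₁ i) → i ; {x} (inj₂ j) → contradiction (x , j) ¬j }) (inj₂ I∈)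
    join l I<J (inj₂ I∈) (inj₂ J∈) = inj₂ (𝓘-∪ l I<J I∈ J∈)
    limit : ∀ l {I} d {c : ℕ → ∣ α ∣} → (∀ k → ¬ Lt α d (c (suc k)) (c k)) →
            (∀ k → Good l (I ∩ Ioc α d (c k) (c (suc k)))) →
            Good (suc l) (I ∩ λ x → ∃ λ k → Ioc α d (c k) (c (suc k)) x)
    limit zero    d c-mono pieces = inj₁ λ (x , i , k , p) → lower (pieces k) (x , i , p)
    limit (suc l) {I} d {c} c-mono pieces with em {P = ∃ (I ∩ λ x → ∃ λ k → Ioc α d (c k) (c (suc k)) x)}
    ... | no ¬∃ = inj₁ ¬∃
    ... | yes j = inj₂ (𝓘-limit d l c-mono
      (λ k → [ (λ ¬∃ → inj₂ λ { (x , [ i ]) → ¬∃ (x , recompute em i) }) , inj₁ ]′ (pieces k)) j)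

  ¬big⇒𝓘 : ∀ n → Nonempty α → ¬ Big α (suc n) (full α) → α ∈ 𝓘 n
  ¬big⇒𝓘 {α} n x ¬big with ¬big⇒good (rank-isSmallness α) (suc n) {U} (¬big ∘ big-mono (suc n) proj₁)
  ... | inj₁ ¬∃ = contradiction (x , _) ¬∃
  ... | inj₂ α∈ = 𝓘-resp-≅ (mk≅ {β = α ↾ U} (λ x → x , [ _ ]) (λ lt → lt) λ (x , _) → x , refl) α∈

  𝓘-nonempty : ∀ {n} → α ∈ 𝓘 n → Nonempty α
  𝓘-nonempty (fin k φ)       = proj₁ (_≅_.surj φ zero)
  𝓘-nonempty (zsum _ _ x _)  = x
  𝓘-nonempty (fsum k δ δ∈ φ) = proj₁ (_≅_.surj φ (zero , 𝓘-nonempty (δ∈ zero)))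

  hasRank⇒big : ∀ j → α HasRank j → Big α j (full α)
  hasRank⇒big zero    (α∈ , _)     = 𝓘-nonempty α∈ , refl , _
  hasRank⇒big (suc j) (α∈ , least) =
    dne λ ¬big → least j ℕ.≤-refl (¬big⇒𝓘 j (𝓘-nonempty α∈) ¬big)

  big-≤ : ∀ {P : Weight α} → (∀ {x i} → P x (suc i) → P x i) → ∀ {i j} → i ≤ j → Big α j P → Big α i P
  big-≤ {α} {P} down i≤j = go (ℕ.≤⇒≤′ i≤j)
    where
    go : ∀ {i j} → i ℕ.≤′ j → Big α j P → Big α i P
    go ℕ.≤′-refl           b = b
    go (ℕ.≤′-step {n} i≤n) b = go i≤n (big-pred n down b)

  big⇒hasRank : ∀ j → Big α j (full α) → ¬ Big α (suc j) (full α) → α HasRank j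
  big⇒hasRank j big ¬big = ¬big⇒𝓘 j (proj₁ (big-nonempty j big)) ¬big ,
    λ m m<j α∈ → 𝓘⇒¬big α∈ (big-≤ (λ ()) m<j big)

  double-< : ∀ {i j} → i ℕ.< j → suc (i ℕ.+ i) ℕ.< j ℕ.+ j
  double-< {i} {j} i<j = subst (ℕ._≤ j ℕ.+ j) (cong suc (ℕ.+-suc i i)) (ℕ.+-mono-≤ i<j i<j)

  -- S may have too large a rank or none. Keep a recursively thinned part of every second interval
  -- of the chain: skipping intervals separates the parts, so X is a sum of them over ω or ω*, and
  -- such a sum gains only one level.
  big-thin : ∀ j {S : Pred ∣ α ∣ 0ℓ} → Big α j (pure S) →
             Σ[ X ∈ Pred ∣ α ∣ 0ℓ ] (∀ {x} → X x → S x) × Big α j (pure X) × ¬ Big α (suc j) (pure X)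
  big-thin {α} zero {S} (x , _ , s) = (_≡ x) , (λ { refl → s }) , (x , refl , refl) , λ b →
    contradiction (proj₁ (proj₂ (big-list 1 {P = pure (_≡ x)} (x ∷ []) (here ∘ proj₂) b))) λ ()
  big-thin {α} (suc j) {S} (inj₂ (d , c , <c , bs)) =
    (λ x → ∃ λ k → X k x) , (λ (k , p) → proj₁ (X⊂ k p)) ,
    inj₂ (d , e , (λ k → strictlyMonotone <c (ℕ.<-trans ℕ.≤-refl (double-< ℕ.≤-refl))) , λ k →
      big-mono j (λ (z , p) → (z , k , p) , between-mono d {α = α} (<⇒≼ (<c _)) ≼-refl
                   (monotone (<⇒≼ ∘ <c) (ℕ.<⇒≤ (double-< ℕ.≤-refl))) (proj₂ (X⊂ k p)))
                 (proj₁ (proj₂ (proj₂ (thin k))))) ,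
    λ b → let k , b′ = big-locallyFinite (dir-locallyFinite d ω-locallyFinite) (suc j)
                (Blocks.collapse α (dir d ω) (λ x k → X k x) (reorient d {V = X} separated) (suc (suc j))
                  {Q = λ k i → Big α i (pure (X k))} (λ (_ , k , p) → k , p)
                  (λ {_} {i} _ → big-mono i (λ ((z , _) , p) → z , p)) b)
          in [ ¬X k , ¬X k ∘ big-pred (suc j) (λ ()) ]′ b′
    where
    open Order (dir d α)
    e : ℕ → ∣ α ∣
    e k = c (k ℕ.+ k)
    thin : ∀ k → _
    thin k = big-thin j {S ∩ Between α (e k) (c (suc (k ℕ.+ k)))}
               (big-mono j (λ ((z , s) , btw) → z , s , btw) (bs (k ℕ.+ k)))
    X : ℕ → Pred ∣ α ∣ 0ℓ
    X k = proj₁ (thin k)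
    X⊂ : ∀ k {x} → X k x → S x × Between α (c (k ℕ.+ k)) (c (suc (k ℕ.+ k))) x
    X⊂ k = proj₁ (proj₂ (thin k))
    ¬X : ∀ k → ¬ Big α (suc j) (pure (X k))
    ¬X k = proj₂ (proj₂ (proj₂ (thin k)))
    separated : ∀ {k k′ x y} → X k x → X k′ y → k ℕ.< k′ → Lt α d x y
    separated {k} {k′} p q k<k′ =
      ≼-<-trans (proj₂ (between-≼ d (<⇒≼ (<c _)) (proj₂ (X⊂ k p))))
        (<-≼-trans (strictlyMonotone <c (double-< k<k′)) (proj₁ (between-≼ d (<⇒≼ (<c _)) (proj₂ (X⊂ k′ q)))))

  ∃-hasRank⇔big : ∀ j (S : Pred ∣ α ∣ 0ℓ) →
                  (Σ[ X ∈ Pred ∣ α ∣ 0ℓ ] (α ↾ X) HasRank j × (∀ x → X x → S x)) ⇔ Big α j (pure S)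
  ∃-hasRank⇔big {α} j S = mk⇔
    (λ (X , rank , X⊂S) → big-mono j (λ (z , p) → z , X⊂S _ p) (big-↾⁻ {α} {X} j (hasRank⇒big j rank)))
    (λ b → let X , X⊂S , big , ¬big = big-thin j b in
      X , big⇒hasRank j (big-↾⁺ {α} {X} j big) (¬big ∘ big-↾⁻ {α} {X} (suc j)) , λ _ → X⊂S)

  -- Products of restricted words

  module Restriction {c ℓ} (M : ⊛-Monoid c ℓ) where
    open ⊛-Monoid M

    π-id : ∀ α → π (constant α id) ≈ id
    π-id α = ≈-trans (≈-sym (π-∏ α (λ _ → ε)))
      (π-cong (mk≅ {β = finite 0} (λ { (_ , ()) }) (λ { {_ , ()} }) (λ ()) , λ { (_ , ()) }))

    module _ (w : Word Carrier) where
      open CountableOrder (dom w) using (_<_; irrefl; compare; <-trans)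

      ρ : Pred ∣ dom w ∣ 0ℓ → Carrier
      ρ I = π (restrict w I)

      ρ-separated : ∀ {β I V} → Separated β (dom w) I V → ρ I ≈ π (word β (ρ ∘ V))
      ρ-separated {β} {I} {V} sep =
        ≈-trans (≈-sym (π-cong (∑-↾ sep , λ _ → ≈-refl))) (π-∏ β (λ i → restrict w (V i)))

      ρ-ext : ∀ {I J} → (∀ {x} → I x → J x) → (∀ {x} → J x → I x) → ρ I ≈ ρ J
      ρ-ext I⊂J J⊂I = π-cong (↾-cong ≅-refl I⊂J J⊂I , λ _ → ≈-refl)

      ρ-full : ρ U ≈ π w
      ρ-full = π-cong (mk≅ value (λ lt → lt) (λ x → (x , [ _ ]) , refl) , λ _ → ≈-refl)

      ρ-empty : ∀ {I} → (∀ {x} → ¬ I x) → ρ I ≈ id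
      ρ-empty ¬i = π-cong
        ( mk≅ {β = finite 0} (λ (x , [ i ]) → contradiction-irr i ¬i)
            (λ { {x , [ i ]} → contradiction-irr i ¬i }) (λ ())
        , λ (x , [ i ]) → contradiction-irr i ¬i )

      ρ-single : ∀ x → ρ (_≡ x) ≈ letter w x
      ρ-single x = ≈-trans (π-cong {v = ⟦ letter w x ⟧}
        ( mk≅ (λ _ → zero)
            (λ { {y , [ p ]} {z , [ q ]} y<z →
               contradiction y<z (irrefl (trans (recompute em p) (sym (recompute em q)))) })
            (λ { zero → (x , [ refl ]) , refl })
        , λ { (y , [ p ]) → reflexive (cong (letter w) (recompute em p)) }))
        (π-⟦⟧ (letter w x))

      ρ-∪ : ∀ {I J} → (∀ {x y} → I x → J y → x < y) → ρ (I ∪ J) ≈ ρ I ∙ ρ J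
      ρ-∪ {I} {J} I<J = ≈-trans (ρ-separated (∪-separated {α = dom w} {I} {J} I<J))
        (π-letters λ { zero → ≈-refl ; (suc zero) → ≈-refl })

      mask : Pred ∣ dom w ∣ 0ℓ → ∣ dom w ∣ → Carrier
      mask I x = if does (em {P = I x}) then letter w x else id

      -- Cut I into pieces indexed by the whole domain, each a singleton or empty. The masked word
      -- keeps the domain of w, so a restricted product can later be treated as a product over w
      -- itself.
      ρ-mask : ∀ I → ρ I ≈ π (word (dom w) (mask I))
      ρ-mask I = ≈-trans (ρ-separated {V = λ x y → I y × y ≡ x} sep) (π-letters at)
        where
        sep : Separated (dom w) (dom w) I (λ x y → I y × y ≡ x)
        sep = (λ i → _ , i , refl) , proj₁ , λ { (_ , refl) (_ , refl) x<y → x<y }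
        at : ∀ x → ρ (λ y → I y × y ≡ x) ≈ mask I x
        at x with em {P = I x}
        ... | yes i = ≈-trans (ρ-ext proj₂ λ { refl → i , refl }) (ρ-single x)
        ... | no ¬i = ρ-empty λ { (i , refl) → ¬i i }

      ρ-ids : ∀ {I} → (∀ {x} → I x → letter w x ≈ id) → ρ I ≈ id
      ρ-ids {I} ids = ≈-trans (ρ-mask I) (≈-trans (π-letters at) (π-id (dom w)))
        where
        at : ∀ x → mask I x ≈ id
        at x with em {P = I x}
        ... | yes i = ids i
        ... | no _  = ≈-refl

      π-split : ∀ x → π w ≈ π (before w x) ∙ (letter w x ∙ π (after w x))
      π-split x = begin
        π w                                             ≈⟨ ρ-full ⟨
        ρ U                                             ≈⟨ ρ-ext (λ _ → split) (λ _ → _) ⟩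
        ρ ((_< x) ∪ ((_≡ x) ∪ (x <_)))                  ≈⟨ ρ-∪ (λ { y<x (inj₁ refl) → y<x ; y<x (inj₂ x<z) → <-trans y<x x<z }) ⟩
        ρ (_< x) ∙ ρ ((_≡ x) ∪ (x <_))                  ≈⟨ ∙-cong ≈-refl (ρ-∪ λ { refl x<z → x<z }) ⟩
        π (before w x) ∙ (ρ (_≡ x) ∙ π (after w x))     ≈⟨ ∙-cong ≈-refl (∙-cong (ρ-single x) ≈-refl) ⟩
        π (before w x) ∙ (letter w x ∙ π (after w x))   ∎
        where
        open SetoidReasoning setoid
        split : ∀ {y} → ((_< x) ∪ ((_≡ x) ∪ (x <_))) y
        split {y} with compare y x
        ... | tri< lt _ _ = inj₁ lt
        ... | tri≈ _ eq _ = inj₂ (inj₁ eq)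
        ... | tri> _ _ gt = inj₂ (inj₂ gt)

  -- Levels of elements of Δ n

  module _ {n : ℕ} where
    open Raw⊛-Algebra (Δ n) using () renaming (Carrier to D; _∙_ to _∙ᴰ_; _^τ to next)

    -- Levels are shifted by one, so that the identity has level 0.
    level : D → ℕ
    level nothing  = 0
    level (just i) = suc (Fin.toℕ i)

    level-injective : ∀ x y → level x ≡ level y → x ≡ y
    level-injective nothing  nothing  _  = refl
    level-injective (just i) (just j) eq = cong just (Fin.toℕ-injective (ℕ.suc-injective eq))

    level≤ : ∀ x → level x ≤ suc n
    level≤ nothing  = z≤n
    level≤ (just i) = Fin.toℕ<n i

    level-∙ : ∀ x y → level (x ∙ᴰ y) ≡ level x ℕ.⊔ level y
    level-∙ nothing  y       = refl
    level-∙ (just i) nothing = refl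
    level-∙ (just i) (just j) with Fin.toℕ i ℕ.≤ᵇ Fin.toℕ j | ℕ.≤ᵇ-reflects-≤ (Fin.toℕ i) (Fin.toℕ j)
    ... | true  | ofʸ i≤j = cong suc (sym (ℕ.m≤n⇒m⊔n≡n i≤j))
    ... | false | ofⁿ i≰j = cong suc (sym (ℕ.m≥n⇒m⊔n≡m (ℕ.≰⇒≥ i≰j)))

    -- The right side has the form of `big-locallyFinite` for a constant word: the letter suffices,
    -- or it is one level short and the chain adds the rest. The bound l ≤ n hides the truncation of
    -- τ at n.
    level-next : ∀ x {l} → l ≤ n → (l ℕ.< level (next x)) ⇔ (l ℕ.< level x ⊎ ∃ λ m → l ≡ suc m × m ℕ.< level x)
    level-next nothing  l≤n = mk⇔ inj₁ λ { (inj₁ ()) ; (inj₂ (_ , _ , ())) }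
    level-next (just i) {l} l≤n = mk⇔ to from
      where
      i′ = suc (Fin.toℕ i) ℕ.⊓ n
      eq : level (next (just i)) ≡ suc i′
      eq = cong suc (Fin.toℕ-fromℕ< (s≤s (ℕ.m⊓n≤n (suc (Fin.toℕ i)) n)))
      to : ∀ {l} → l ℕ.< level (next (just i)) → l ℕ.< suc (Fin.toℕ i) ⊎ ∃ λ m → l ≡ suc m × m ℕ.< suc (Fin.toℕ i)
      to {zero}  _  = inj₁ (s≤s z≤n)
      to {suc m} l< with s≤s m< ← subst (suc m ℕ.<_) eq l< = inj₂ (m , refl , ℕ.≤-trans m< (ℕ.m⊓n≤m _ n))
      from : (l ℕ.< suc (Fin.toℕ i)) ⊎ (∃ λ m → l ≡ suc m × m ℕ.< suc (Fin.toℕ i)) → l ℕ.< level (next (just i))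
      from (inj₁ (s≤s l≤i))               = subst (l ℕ.<_) (sym eq) (s≤s (ℕ.⊓-glb (ℕ.m≤n⇒m≤1+n l≤i) l≤n))
      from (inj₂ (m , refl , s≤s m≤i)) = subst (l ℕ.<_) (sym eq) (s≤s (ℕ.⊓-glb (s≤s m≤i) l≤n))

    element : ∀ k → k ≤ suc n → ∃ λ x → level x ≡ k
    element zero    _   = nothing , refl
    element (suc k) k<n = just (Fin.fromℕ< k<n) , cong suc (Fin.toℕ-fromℕ< k<n)

  dichotomy : ∀ (Q : Pred ℕ ℓ) k → Q 0 → ¬ Q k → ∃ λ m → Q m × ¬ Q (suc m)
  dichotomy Q zero    q0 ¬q = contradiction q0 ¬q
  dichotomy Q (suc k) q0 ¬q with em {P = Q k}
  ... | yes q = k , q , ¬q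
  ... | no ¬q′ = dichotomy Q k q0 ¬q′

  -- The product of a ⊛-monoid inducing Δ n

  module Induced {c ℓ} (M : ⊛-Monoid c ℓ) {n} (induces : Induces M (Δ n)) where
    open ⊛-Monoid M
    open Restriction M
    open Induces induces
    open Inverse carrier↔ using (to; to-cong)

    lv : Carrier → ℕ
    lv x = level (to x)

    lv-cong : ∀ {x y} → x ≈ y → lv x ≡ lv y
    lv-cong = cong level ∘ to-cong

    lv-injective : ∀ {x y} → lv x ≡ lv y → x ≈ y
    lv-injective {x} {y} eq = ≈-trans (≈-sym (Inverse.inverseʳ carrier↔ refl))
      (≈-trans (Inverse.from-cong carrier↔ (level-injective _ _ eq)) (Inverse.inverseʳ carrier↔ refl))

    lv≤ : ∀ x → lv x ≤ suc n
    lv≤ x = level≤ (to x)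

    lv-id : lv id ≡ 0
    lv-id = cong level id-homo

    lv-∙ : ∀ x y → lv (x ∙ y) ≡ lv x ℕ.⊔ lv y
    lv-∙ x y = trans (cong level (∙-homo x y)) (level-∙ (to x) (to y))

    lv-ω : ∀ d x {l} → l ≤ n →
           (l ℕ.< lv (π (constant (dir d ω) x))) ⇔ (l ℕ.< lv x ⊎ ∃ λ m → l ≡ suc m × m ℕ.< lv x)
    lv-ω d x {l} l≤n = subst (λ k → l ℕ.< k ⇔ (l ℕ.< lv x ⊎ ∃ λ m → l ≡ suc m × m ℕ.< lv x))
      (cong level (sym (homo d))) (level-next (to x) l≤n)
      where
      homo : ∀ d → to (π (constant (dir d ω) x)) ≡ Raw⊛-Algebra._^τ (Δ n) (to x)
      homo ↑ = τ-homo x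
      homo ↓ = τ*-homo x

    module _ (w : Word Carrier) where
      private δ = dom w

      weight : Weight δ
      weight x i = i ℕ.< lv (letter w x)

      lv-∪ : ∀ d {I J} → (∀ {x y} → I x → J y → Lt δ d x y) →
             lv (ρ w (I ∪ J)) ≡ lv (ρ w I) ℕ.⊔ lv (ρ w J)
      lv-∪ ↑ I<J = trans (lv-cong (ρ-∪ w I<J)) (lv-∙ _ _)
      lv-∪ ↓ {I} {J} I<J = begin
        lv (ρ w (I ∪ J))             ≡⟨ lv-cong (ρ-ext w Sum.swap Sum.swap) ⟩
        lv (ρ w (J ∪ I))             ≡⟨ lv-cong (ρ-∪ w λ j i → I<J i j) ⟩
        lv (ρ w J ∙ ρ w I)           ≡⟨ lv-∙ _ _ ⟩
        lv (ρ w J) ℕ.⊔ lv (ρ w I)    ≡⟨ ℕ.⊔-comm (lv (ρ w J)) _ ⟩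
        lv (ρ w I) ℕ.⊔ lv (ρ w J)    ∎
        where
        open ≡.≡-Reasoning

      -- The cases express that C is convex in I; then I is a concatenation of L, C and R, whose
      -- value is a maximum. A point of C is what places L before R.
      lv-interval : ∀ d {I C} → ∃ C → (∀ {x} → C x → I x) →
                    (∀ {x} → I x → C x ⊎ (∀ {y} → C y → Lt δ d x y) ⊎ (∀ {y} → C y → Lt δ d y x)) →
                    lv (ρ w C) ≤ lv (ρ w I)
      lv-interval d {I} {C} (y₀ , c₀) C⊂I cases = begin
        lv (ρ w C)                                   ≤⟨ ℕ.m≤n⊔m (lv (ρ w L)) _ ⟩
        lv (ρ w L) ℕ.⊔ lv (ρ w C)                    ≤⟨ ℕ.m≤m⊔n _ (lv (ρ w R)) ⟩
        lv (ρ w L) ℕ.⊔ lv (ρ w C) ℕ.⊔ lv (ρ w R)     ≡⟨ cong (ℕ._⊔ lv (ρ w R)) (lv-∪ d {L} {C} λ (_ , x<) → x< _) ⟨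
        lv (ρ w (L ∪ C)) ℕ.⊔ lv (ρ w R)              ≡⟨ lv-∪ d {L ∪ C} {R} LC<R ⟨
        lv (ρ w ((L ∪ C) ∪ R))                       ≡⟨ lv-cong (ρ-ext w {(L ∪ C) ∪ R} {I} inside split) ⟩
        lv (ρ w I)                                   ∎
        where
        open ℕ.≤-Reasoning
        module D = Order (dir d δ)
        L R : Pred ∣ δ ∣ 0ℓ
        L x = I x × ∀ y → C y → Lt δ d x y
        R x = I x × ∀ y → C y → Lt δ d y x
        LC<R : ∀ {x z} → (L ∪ C) x → R z → Lt δ d x z
        LC<R (inj₁ (_ , x<)) (_ , <z) = D.<-trans (x< y₀ c₀) (<z y₀ c₀)
        LC<R (inj₂ c)        (_ , <z) = <z _ c
        inside : ∀ {x} → ((L ∪ C) ∪ R) x → I x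
        inside (inj₁ (inj₁ (i , _))) = i
        inside (inj₁ (inj₂ c))       = C⊂I c
        inside (inj₂ (i , _))        = i
        split : ∀ {x} → I x → ((L ∪ C) ∪ R) x
        split i with cases i
        ... | inj₁ c         = inj₁ (inj₂ c)
        ... | inj₂ (inj₁ x<) = inj₁ (inj₁ (i , λ _ → x<))
        ... | inj₂ (inj₂ <x) = inj₂ (i , λ _ → <x)

      module Limit (d : Direction) {c : ℕ → ∣ δ ∣} (c-mono : ∀ k → Order._≼_ (dir d δ) (c k) (c (suc k)))
                   (I : Pred ∣ δ ∣ 0ℓ) where
        open Order (dir d δ)

        V : ℕ → ℕ → Pred ∣ δ ∣ 0ℓ
        V i j = I ∩ Ioc δ d (c i) (c j)

        W : Pred ∣ δ ∣ 0ℓ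
        W = I ∩ λ x → ∃ λ k → Ioc δ d (c k) (c (suc k)) x

        v : ℕ → ℕ → ℕ
        v i j = lv (ρ w (V i j))

        v-refl : ∀ i → v i i ≡ 0
        v-refl i = trans (lv-cong (ρ-empty w λ (_ , c<x , x≼c) → x≼c c<x)) lv-id

        v-trans : ∀ {i j k} → i ≤ j → j ≤ k → v i k ≡ v i j ℕ.⊔ v j k
        v-trans {i} {j} {k} i≤j j≤k = trans (lv-cong (ρ-ext w split
            λ { (inj₁ (p , c<x , x≼c)) → p , c<x , ≼-trans x≼c (monotone c-mono j≤k)
              ; (inj₂ (p , c<x , x≼c)) → p , ≼-<-trans (monotone c-mono i≤j) c<x , x≼c }))
          (lv-∪ d {V i j} {V j k} λ (_ , _ , x≼c) (_ , c<y , _) → ≼-<-trans x≼c c<y)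
          where
          split : ∀ {x} → V i k x → (V i j ∪ V j k) x
          split {x} (p , c<x , x≼c) with em {P = c j < x}
          ... | yes c′<x = inj₂ (p , c′<x , x≼c)
          ... | no c′≮x  = inj₁ (p , c<x , c′≮x)

        v-bound : ∀ {l} → (∀ k → v k (suc k) ≤ l) → ∀ {i j} → i ≤ j → v i j ≤ l
        v-bound {l} step {i} i≤j = go (ℕ.≤⇒≤′ i≤j)
          where
          go : ∀ {j} → i ℕ.≤′ j → v i j ≤ l
          go ℕ.≤′-refl           = subst (ℕ._≤ l) (sym (v-refl i)) z≤n
          go (ℕ.≤′-step {j} i≤j) = subst (ℕ._≤ l) (sym (v-trans (ℕ.≤′⇒≤ i≤j) (ℕ.n≤1+n j)))
            (ℕ.⊔-lub (go i≤j) (step j))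

        -- The largest level m recurring cofinally: from some index on, the
        -- chain can be thinned to blocks of level exactly m.
        Recurring : Pred ℕ 0ℓ
        Recurring m = ∀ i → ∃ λ j → i ℕ.< j × m ≤ v i j

        recurrence : ∃₂ λ m i₀ → Recurring m × (∀ {i j} → i₀ ≤ i → i ≤ j → v i j ≤ m)
        -- Values are at most n + 1, so n + 2 does not recur, while 0 always does.
        recurrence with dichotomy Recurring (2 ℕ.+ n) (λ i → suc i , ℕ.≤-refl , z≤n)
                          (λ r → let _ , _ , le = r 0 in ℕ.<-irrefl refl (ℕ.≤-trans le (lv≤ _)))
        ... | m , r , ¬r with em {P = ∃ λ i₀ → ∀ j → i₀ ℕ.< j → v i₀ j ≤ m}
        ...   | no ¬∃ = contradiction (λ i → dne λ ¬j → ¬∃ (i , λ j i<j → ℕ.≮⇒≥ λ m<v → ¬j (j , i<j , m<v))) ¬r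
        ...   | yes (i₀ , bound) = m , i₀ , r , λ {i} {j} i₀≤i i≤j → begin
            v i j                      ≤⟨ ℕ.m≤m⊔n (v i j) _ ⟩
            v i j ℕ.⊔ v j (suc j)      ≡⟨ v-trans i≤j (ℕ.n≤1+n j) ⟨
            v i (suc j)                ≤⟨ ℕ.m≤n⊔m (v i₀ i) _ ⟩
            v i₀ i ℕ.⊔ v i (suc j)     ≡⟨ v-trans i₀≤i (ℕ.m≤n⇒m≤1+n i≤j) ⟨
            v i₀ (suc j)               ≤⟨ bound (suc j) (s≤s (ℕ.≤-trans i₀≤i i≤j)) ⟩
            m                          ∎
          where open ℕ.≤-Reasoning

        -- Beyond i₀ the chain is regrouped into blocks of value exactly m. Elements of equal value
        -- are equivalent, so the tail becomes a constant word over ω or ω*, where `Induces` gives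
        -- the product.
        limit : ∃₂ λ m i₀ → Recurring m × (∀ {i j} → i₀ ≤ i → i ≤ j → v i j ≤ m) ×
                ∃ λ x → lv x ≡ m × lv (ρ w W) ≡ v 0 i₀ ℕ.⊔ lv (π (constant (dir d ω) x))
        limit with m , i₀ , r , bound ← recurrence =
          m , i₀ , r , bound , ρ w (V (f 0) (f 1)) , v≡m 0 , (begin
            lv (ρ w W)                                         ≡⟨ lv-cong (ρ-ext w toHead fromHead) ⟩
            lv (ρ w (V 0 i₀ ∪ W′))                             ≡⟨ lv-∪ d {V 0 i₀} {W′} head<W′ ⟩
            v 0 i₀ ℕ.⊔ lv (ρ w W′)                             ≡⟨ cong (v 0 i₀ ℕ.⊔_) (lv-cong (ρ-separated w {dir d ω} {W′} {V′} blocks)) ⟩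
            v 0 i₀ ℕ.⊔ lv (π (word (dir d ω) (ρ w ∘ V′)))      ≡⟨ cong (v 0 i₀ ℕ.⊔_) (lv-cong (π-letters same-block)) ⟩
            v 0 i₀ ℕ.⊔ lv (π (constant (dir d ω) (ρ w (V (f 0) (f 1))))) ∎)
          where
          open ≡.≡-Reasoning
          f : ℕ → ℕ
          f zero    = i₀
          f (suc t) = proj₁ (r (f t))
          f< : ∀ t → f t ℕ.< f (suc t)
          f< t = proj₁ (proj₂ (r (f t)))
          i₀≤f : ∀ t → i₀ ≤ f t
          i₀≤f zero    = ℕ.≤-refl
          i₀≤f (suc t) = ℕ.≤-trans (i₀≤f t) (ℕ.<⇒≤ (f< t))
          t≤f : ∀ t → t ≤ f t
          t≤f zero    = z≤n
          t≤f (suc t) = ℕ.≤-<-trans (t≤f t) (f< t)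
          v≡m : ∀ t → v (f t) (f (suc t)) ≡ m
          v≡m t = ℕ.≤-antisym (bound (i₀≤f t) (ℕ.<⇒≤ (f< t))) (proj₂ (proj₂ (r (f t))))
          cf-mono : ∀ t → c (f t) ≼ c (f (suc t))
          cf-mono t = monotone c-mono (ℕ.<⇒≤ (f< t))
          V′ : ℕ → Pred ∣ δ ∣ 0ℓ
          V′ t = V (f t) (f (suc t))
          W′ : Pred ∣ δ ∣ 0ℓ
          W′ = I ∩ λ x → ∃ λ t → Ioc δ d (c (f t)) (c (f (suc t))) x
          cover : ∀ {x} → W′ x → ∃ λ t → V′ t x
          cover (i , t , p) = t , i , p
          inside : ∀ {t x} → V′ t x → W′ x
          inside {t} (i , p) = i , t , p
          separated : ∀ {s t x y} → V′ s x → V′ t y → s ℕ.< t → Lt δ d x y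
          separated (_ , p) (_ , q) = ioc-separated {α = δ} d {c ∘ f} cf-mono p q
          blocks : Separated (dir d ω) δ W′ V′
          blocks = cover , (λ {t} → inside {t}) , reorient d {V = V′} separated
          same-block : ∀ t → ρ w (V′ t) ≈ ρ w (V (f 0) (f 1))
          same-block t = lv-injective (trans (v≡m t) (sym (v≡m 0)))
          head<W′ : ∀ {x y} → V 0 i₀ x → W′ y → Lt δ d x y
          head<W′ (_ , _ , x≼c) (_ , t , c<y , _) = ≼-<-trans (≼-trans x≼c (monotone c-mono (i₀≤f t))) c<y
          toHead : ∀ {x} → W x → (V 0 i₀ ∪ W′) x
          toHead {x} (i , k , c<x , x≼c) with em {P = c i₀ < x}
          ... | no c≮x   = inj₁ (i , ≼-<-trans (monotone c-mono z≤n) c<x , c≮x)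
          ... | yes c₀<x = inj₂ (i , locate d (c ∘ f) (suc k) c₀<x (≼-trans x≼c (monotone c-mono (t≤f (suc k)))))
          piece : ∀ {i j x} → Ioc δ d (c i) (c j) x → ∃ λ k → Ioc δ d (c k) (c (suc k)) x
          piece {i} {j} (c<x , x≼c) = locate d c j (≼-<-trans (monotone c-mono {0} {i} z≤n) c<x) x≼c
          fromHead : ∀ {x} → (V 0 i₀ ∪ W′) x → W x
          fromHead (inj₁ (i , p))     = i , piece {0} {i₀} p
          fromHead (inj₂ (i , t , p)) = i , piece {f t} {f (suc t)} p

        limit≤ : ∀ {l} → (∀ k → v k (suc k) ≤ l) → lv (ρ w W) ≤ suc l
        limit≤ {l} step with m , i₀ , r , _ , x , refl , eq ← limit = subst (ℕ._≤ suc l) (sym eq)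
          (ℕ.⊔-lub (ℕ.m≤n⇒m≤1+n (v-bound step z≤n)) (ℕ.≮⇒≥ ¬big))
          where
          x≤l : lv x ≤ l
          x≤l = let _ , i<j , le = r 0 in ℕ.≤-trans le (v-bound step (ℕ.<⇒≤ i<j))
          ¬big : ¬ (suc l ℕ.< lv (π (constant (dir d ω) x)))
          ¬big lt with Equivalence.to (lv-ω d x (ℕ.s≤s⁻¹ (ℕ.≤-trans lt (lv≤ _)))) lt
          ... | inj₁ l<              = ℕ.<⇒≱ l< (ℕ.m≤n⇒m≤1+n x≤l)
          ... | inj₂ (_ , refl , l<) = ℕ.<⇒≱ l< x≤l

        <limit : ∀ {l} → suc l ≤ n → (∀ i → ∃ λ j → i ℕ.< j × l ℕ.< v i j) → suc l ℕ.< lv (ρ w W)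
        <limit {l} l<n often with m , i₀ , _ , bound , x , refl , eq ← limit = subst (suc l ℕ.<_) (sym eq)
          (ℕ.≤-trans (Equivalence.from (lv-ω d x l<n) (inj₂ (l , refl , l<x))) (ℕ.m≤n⊔m (v 0 i₀) _))
          where
          l<x : l ℕ.< lv x
          l<x = let _ , i<j , l<v = often i₀ in ℕ.≤-trans l<v (bound ℕ.≤-refl (ℕ.<⇒≤ i<j))

      lv-isSmallness : IsSmallness weight (λ l I → lv (ρ w I) ≤ l)
      lv-isSmallness = record
        { ext     = λ {l} I⊂J J⊂I → subst (ℕ._≤ l) (lv-cong (ρ-ext w I⊂J J⊂I))
        ; initial = λ none → ℕ.≤-reflexive (trans (lv-cong (ρ-ids w λ i →
                      lv-injective (trans (ℕ.n≤0⇒n≡0 (ℕ.≮⇒≥ (none i))) (sym lv-id)))) lv-id)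
        ; empty   = λ none → subst (ℕ._≤ _) (sym (trans (lv-cong (ρ-empty w none)) lv-id)) z≤n
        ; single  = λ {l} {x} none → subst (ℕ._≤ suc l) (sym (lv-cong (ρ-single w x))) (ℕ.≮⇒≥ none)
        ; join    = λ {l} I<J p q → subst (ℕ._≤ suc l) (sym (lv-∪ ↑ I<J)) (ℕ.⊔-lub p q)
        ; limit   = λ {l} {I} d c-mono → Limit.limit≤ d c-mono I
        }

      big⇒<lv : ∀ l → l ≤ n → ∀ {I} → Big δ l (weight ⊓ I) → l ℕ.< lv (ρ w I)
      big⇒<lv l l≤n {I} b = go l l≤n b
        where
        point : ∀ l {I x} → weight x l → I x → l ℕ.< lv (ρ w I)
        point l {I} {x} p i = ℕ.≤-trans (subst (l ℕ.<_) (sym (lv-cong (ρ-single w x))) p)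
          (lv-interval ↑ {I} {_≡ x} (x , refl) (λ { refl → i }) cases)
          where
          cases : ∀ {y} → I y → y ≡ x ⊎ (∀ {z} → z ≡ x → Lt δ ↑ y z) ⊎ (∀ {z} → z ≡ x → Lt δ ↑ z y)
          cases {y} _ with CountableOrder.compare δ y x
          ... | tri< lt _ _ = inj₂ (inj₁ λ { refl → lt })
          ... | tri≈ _ eq _ = inj₁ eq
          ... | tri> _ _ gt = inj₂ (inj₂ λ { refl → gt })
        go : ∀ l → l ≤ n → ∀ {I} → Big δ l (weight ⊓ I) → l ℕ.< lv (ρ w I)
        go zero    l≤n (x , p , i)        = point 0 p i
        go (suc l) l≤n (inj₁ (x , p , i)) = point (suc l) p i
        -- I may reach beyond the chain on both sides; the part W swept by the chain is convex in I,
        -- so a lower bound for W passes to I.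
        go (suc l) l≤n {I} (inj₂ (d , c , <c , bs)) = ℕ.≤-trans W-big (lv-interval d {I} {W} W-nonempty proj₁ cases)
          where
          open Order (dir d δ)
          open Limit d {c} (<⇒≼ ∘ <c) I
          c-mono : ∀ {i j} → i ≤ j → c i ≼ c j
          c-mono = monotone (<⇒≼ ∘ <c)
          -- Bigness uses closed intervals and v half-open ones: the interval from c (i+1) to c
          -- (i+2) fits into the piece that starts one point earlier.
          V-big : ∀ i → l ℕ.< v i (2 ℕ.+ i)
          V-big i = go l (ℕ.<⇒≤ l≤n) (big-mono l
            (λ ((p , q) , btw) → let c≼x , x≼c = between-≼ d (<⇒≼ (<c (suc i))) btw in
              p , q , <-≼-trans (<c i) c≼x , x≼c) (bs (suc i)))
          W-big : suc l ℕ.< lv (ρ w W)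
          W-big = <limit l≤n λ i → 2 ℕ.+ i , ℕ.m≤n⇒m≤1+n ℕ.≤-refl , V-big i
          W-nonempty : ∃ W
          W-nonempty = dne λ ¬∃ →
            ℕ.n≮0 (subst (suc l ℕ.<_) (trans (lv-cong (ρ-empty w λ p → ¬∃ (_ , p))) lv-id) W-big)
          cases : ∀ {x} → I x → W x ⊎ (∀ {y} → W y → x < y) ⊎ (∀ {y} → W y → y < x)
          cases {x} i with em {P = c 0 < x}
          ... | no c≮x = inj₂ (inj₁ λ (_ , _ , c<y , _) → ≼-<-trans c≮x (≼-<-trans (c-mono z≤n) c<y))
          ... | yes c<x with em {P = ∃ λ m → ¬ c m < x}
          ...   | yes (m , c≮x) = inj₁ (i , locate d c m c<x c≮x)
          ...   | no ¬∃ = inj₂ (inj₂ λ (_ , k , _ , y≼c) → ≼-<-trans y≼c (dne λ c≮x → ¬∃ (suc k , c≮x)))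

      <lv⇔big : ∀ {l} → l ≤ n → (l ℕ.< lv (π w)) ⇔ Big δ l weight
      <lv⇔big {l} l≤n = mk⇔
        (λ l< → dne λ ¬big → ℕ.<⇒≱ l< (subst (ℕ._≤ l) (lv-cong (ρ-full w))
          (¬big⇒good lv-isSmallness l {U} (¬big ∘ big-mono l proj₁))))
        (λ b → subst (l ℕ.<_) (lv-cong (ρ-full w)) (big⇒<lv l l≤n (big-mono l (λ p → p , _) b)))

  -- The ⊛-monoid inducing Δ n

  weightOf : ∀ {n} → (w : Word (Maybe (Fin (suc n)))) → Weight (dom w)
  weightOf w x i = i ℕ.< level (letter w x)

  weightOf-down : ∀ {n} (w : Word (Maybe (Fin (suc n)))) {x i} → weightOf w x (suc i) → weightOf w x i
  weightOf-down w = ℕ.<-trans (ℕ.n<1+n _)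

  module _ (n : ℕ) where
    open Raw⊛-Algebra (Δ n) using () renaming (Carrier to D; _∙_ to _∙ᴰ_; _^τ to next)

    -- The product will be read off from bigness instead of being computed along a decomposition of
    -- the word. Levels l ≤ n determine an element, because `level` is at most n + 1.
    Represents : D → Word D → Set
    Represents x w = ∀ {l} → l ≤ n → (l ℕ.< level x) ⇔ Big (dom w) l (weightOf w)

    represents-unique : ∀ w {x y} → Represents x w → Represents y w → x ≡ y
    represents-unique w {x} {y} rx ry =
      level-injective x y (ℕ.≤-antisym (below {x} {y} rx ry) (below {y} {x} ry rx))
      where
      below : ∀ {x y} → Represents x w → Represents y w → level x ≤ level y
      below {x} {y} rx ry = ℕ.≮⇒≥ λ y<x → let y≤n = ℕ.s≤s⁻¹ (ℕ.≤-trans y<x (level≤ x)) in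
        ℕ.<-irrefl refl (Equivalence.from (ry y≤n) (Equivalence.to (rx y≤n) y<x))

    AllBig : Word D → Pred ℕ 0ℓ
    AllBig w m = m ≤ suc n × ∀ l → l ℕ.< m → Big (dom w) l (weightOf w)

    representative : ∀ w → ∃ λ x → Represents x w
    -- The value is the largest m ≤ n + 1 such that the word is big at all levels below m.
    representative w with dichotomy (AllBig w) (2 ℕ.+ n) (z≤n , λ _ ()) (λ (le , _) → ℕ.<-irrefl refl le)
    ... | m , (m≤ , bigs) , ¬next with x , refl ← element {n} m m≤ = x , λ l≤n → mk⇔ (bigs _) λ b →
      ℕ.≰⇒> λ x≤l → ¬next (s≤s (ℕ.≤-trans x≤l l≤n) ,
        λ i i≤x → big-≤ (weightOf-down w) (ℕ.≤-trans (ℕ.s≤s⁻¹ i≤x) x≤l) b)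

    val : Word D → D
    val w = proj₁ (representative w)

    val-represents : ∀ w → Represents (val w) w
    val-represents w = proj₂ (representative w)

    val-≡ : ∀ w {x} → Represents x w → val w ≡ x
    val-≡ w = represents-unique w (val-represents w)

    val-cong : ∀ {u v} → _≋_ (≡.setoid D) u v → val u ≡ val v
    val-cong {u} {v} e = val-≡ u λ l≤n → mk⇔
      (λ l< → transport (Setoid.sym (wordSetoid (≡.setoid D)) {u} {v} e) (Equivalence.to (val-represents v l≤n) l<))
      (λ b → Equivalence.from (val-represents v l≤n) (transport {u} {v} e b))
      where
      transport : ∀ {u v} → _≋_ (≡.setoid D) u v → ∀ {l} → Big (dom u) l (weightOf u) → Big (dom v) l (weightOf v)
      transport {u} {v} (φ , p) {l} = Blocks.expand (dom v) (dom u) (λ y x → _≅_.to φ x ≡ y)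
        (λ { refl refl → _≅_.mono φ }) l
        λ {x} {i} _ wt → big-point i (subst (λ z → i ℕ.< level z) (p x) wt , refl)

    -- Generalized associativity is the replacement of blocks by weighted points: `expand` restores
    -- the blocks and `collapse` contracts them, and within a block bigness moves along the
    -- inclusion of u x.
    val-∏ : ∀ α (u : ∣ α ∣ → Word D) → val (∏ α u) ≡ val (word α (val ∘ u))
    val-∏ α u = val-≡ (∏ α u) λ {l} l≤n → mk⇔
      (λ l< → B.expand l (λ {_} {i} i≤l i< → Blocks.expand σ (dom (u _)) (λ y a → (_ , a) ≡ y)
                (λ { refl refl → snd< }) i (λ {a} {j} _ wt → big-point j ((wt , refl) , refl))
                (Equivalence.to (val-represents (u _) (ℕ.≤-trans i≤l l≤n)) i<))
              (Equivalence.to (val-represents (word α (val ∘ u)) l≤n) l<))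
      (λ b → Equivalence.from (val-represents (word α (val ∘ u)) l≤n) (B.collapse l (λ _ → _ , refl)
               (λ {x} {i} i≤l b → Equivalence.from (val-represents (u x) (ℕ.≤-trans i≤l l≤n))
                 (Blocks.expand (dom (u x)) σ (λ a y → y ≡ (x , a)) (λ { refl refl → snd<⁻¹ }) i
                   (λ { {_ , a} {j} _ (wt , refl) → big-point j (wt , refl) }) b)) b))
      where
      σ = dom (∏ α u)
      InBlock : ∣ σ ∣ → ∣ α ∣ → Set
      InBlock y x = proj₁ y ≡ x
      inBlock-mono : ∀ {y y′ x x′} → InBlock y x → InBlock y′ x′ →
                     CountableOrder._<_ α x x′ → CountableOrder._<_ σ y y′
      inBlock-mono refl refl = fst<
      module B = Blocks σ α InBlock inBlock-mono
      snd<⁻¹ : ∀ {x a b} → CountableOrder._<_ σ (x , a) (x , b) → CountableOrder._<_ (dom (u x)) a b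
      snd<⁻¹ (fst< x<x) = contradiction x<x (CountableOrder.irrefl α refl)
      snd<⁻¹ (snd< a<b) = a<b

    finite-represents : ∀ {k} (xs : Vec D k) {x} →
                        (∀ {l} → (l ℕ.< level x) ⇔ ∃ λ i → l ℕ.< level (lookup xs i)) → Represents x (fromVec xs)
    finite-represents {k} xs eq {l} _ = mk⇔
      (λ l< → let i , p = Equivalence.to eq l< in big-point l p)
      (λ b → Equivalence.from eq (big-list l (allFin k) (λ _ → ∈-allFin _) b))

    ΔMonoid : ⊛-Monoid 0ℓ 0ℓ
    ΔMonoid = record
      { setoid = ≡.setoid D
      ; π      = val
      ; π-cong = λ {u} {v} → val-cong {u} {v}
      ; π-⟦⟧   = λ x → val-≡ ⟦ x ⟧ (finite-represents (x ∷ []) (mk⇔ (zero ,_) λ { (zero , p) → p }))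
      ; π-∏    = val-∏
      }

    val-∙ : ∀ x y → val ⟦ x ⨾ y ⟧ ≡ x ∙ᴰ y
    val-∙ x y = val-≡ ⟦ x ⨾ y ⟧ (finite-represents (x ∷ y ∷ []) (λ {l} →
      subst (λ k → (l ℕ.< k) ⇔ ∃ λ i → l ℕ.< level (lookup (x ∷ y ∷ []) i)) (sym (level-∙ x y)) (mk⇔ to from)))
      where
      to : ∀ {l} → l ℕ.< level x ℕ.⊔ level y → ∃ λ i → l ℕ.< level (lookup (x ∷ y ∷ []) i)
      to {l} l< with ℕ.⊔-sel (level x) (level y)
      ... | inj₁ eq = zero , subst (l ℕ.<_) eq l<
      ... | inj₂ eq = suc zero , subst (l ℕ.<_) eq l<
      from : ∀ {l} → (∃ λ i → l ℕ.< level (lookup (x ∷ y ∷ []) i)) → l ℕ.< level x ℕ.⊔ level y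
      from (zero     , p) = ℕ.≤-trans p (ℕ.m≤m⊔n _ _)
      from (suc zero , p) = ℕ.≤-trans p (ℕ.m≤n⊔m (level x) _)

    val-ω : ∀ d x → val (constant (dir d ω) x) ≡ next x
    val-ω d x = val-≡ (constant (dir d ω) x) λ {l} l≤n → mk⇔
      (λ l< → to (Equivalence.to (level-next x l≤n) l<)) (λ b → Equivalence.from (level-next x l≤n) (from l b))
      where
      W : Weight (dir d ω)
      W = weightOf (constant (dir d ω) x)
      ascending : ∀ d k → Lt (dir d ω) d k (suc k)
      ascending ↑ k = ℕ.≤-refl
      ascending ↓ k = ℕ.≤-refl
      to : ∀ {l} → l ℕ.< level x ⊎ (∃ λ m → l ≡ suc m × m ℕ.< level x) → Big (dir d ω) l W
      to {l} (inj₁ l<)        = big-point l {x = 0} l<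
      to (inj₂ (m , refl , m<)) = inj₂ (d , (λ k → k) , ascending d , λ k →
        big-point m {x = k} (m< , (λ k<k _ → irrefl refl k<k) , λ k<k _ → irrefl refl k<k))
        where open CountableOrder (dir d ω)
      from : ∀ l → Big (dir d ω) l W → l ℕ.< level x ⊎ ∃ λ m → l ≡ suc m × m ℕ.< level x
      from zero    (_ , p) = inj₁ p
      from (suc l) b with big-locallyFinite (dir-locallyFinite d ω-locallyFinite) l b
      ... | _ , inj₁ p = inj₂ (l , refl , p)
      ... | _ , inj₂ p = inj₁ p

    module _ {E : List⁺ D} {f : ℚ → D} (shuffle : IsPerfectShuffle (≡.setoid D) E f) where
      open IsPerfectShuffle shuffle

      shuffle-big : ∀ {e} → e ∈ₗ toList E → 0 ℕ.< level e → ∀ l {p q} → p ℚ.< q →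
                    Big η l (weightOf (word η f) ⊓ λ x → p ℚ.< x × x ℚ.< q)
      shuffle-big e∈ e>0 zero {p} {q} p<q with m , p<m , m<q ← ℚ.<-dense p<q
        -- The shuffle property speaks of intervals with two distinct points, so a second point
        -- below m is supplied.
        with m′ , p<m′ , m′<m ← ℚ.<-dense p<m
        with r , inside , refl ← dense (λ x → p ℚ.< x × x ℚ.< q)
               (λ (p<x , _) (_ , z<q) x<y y<z → ℚ.<-trans p<x x<y , ℚ.<-trans y<z z<q)
               (p<m , m<q) (p<m′ , ℚ.<-trans m′<m m<q) (ℚ.<⇒≢ m′<m ∘ sym) e∈ = r , e>0 , inside
      shuffle-big e∈ e>0 (suc l) {p} {q} p<q = big-steps η ↑ (λ x → p ℚ.< x × x ℚ.< q)
        (proj₂ (ℚ.<-dense p<q)) λ x (p<x , x<q) → let y , x<y , y<q = ℚ.<-dense x<q in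
          y , x<y , (ℚ.<-trans p<x x<y , y<q) ,
          big-mono l (λ (wt , x<z , z<y) → (wt , ℚ.<-trans p<x x<z , ℚ.<-trans z<y y<q) ,
            ≼-between {α = η} ↑ (ℚ.<-asym x<z) (ℚ.<-asym z<y)) (shuffle-big e∈ e>0 l x<y)

      val-shuffle : val (word η f) ≡ Raw⊛-Algebra._^κ (Δ n) (List⁺.map (λ x → x) E)
      val-shuffle with all is-nothing (toList (List⁺.map (λ x → x) E)) in eq
      ... | true  = val-≡ (word η f) λ {l} _ → mk⇔ (λ ()) λ b →
        let q , i , _ , p = big-nonempty l b in
        contradiction (subst (λ x → i ℕ.< level x) (all-nothing (toList E) eq (letters q)) p) λ ()
        where
        all-nothing : ∀ xs → all is-nothing (List.map (λ x → x) xs) ≡ true → ∀ {x : D} → x ∈ₗ xs → x ≡ nothing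
        all-nothing (nothing ∷ xs) eq (here refl) = refl
        all-nothing (nothing ∷ xs) eq (there x∈)  = all-nothing xs eq x∈
      ... | false = val-≡ (word η f) λ {l} l≤n → mk⇔
        (λ _ → let e , e∈ , e>0 = some-just (toList E) eq in
          big-mono l proj₁ (shuffle-big e∈ e>0 l (ℚ.positive⁻¹ ℚ.1ℚ)))
        (λ _ → s≤s (subst (l ≤_) (sym (Fin.toℕ-fromℕ n)) l≤n))
        where
        some-just : ∀ xs → all is-nothing (List.map (λ x → x) xs) ≡ false → ∃ λ (x : D) → x ∈ₗ xs × 0 ℕ.< level x
        some-just (nothing ∷ xs) eq with x , x∈ , x>0 ← some-just xs eq = x , there x∈ , x>0
        some-just (just i ∷ xs)  eq = just i , here refl , s≤s z≤n

    ΔMonoid-induces : Induces ΔMonoid (Δ n)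
    ΔMonoid-induces = record
      { carrier↔ = Identity.inverse (≡.setoid D)
      ; id-homo  = val-≡ ε (finite-represents [] (mk⇔ (λ ()) λ { (() , _) }))
      ; ∙-homo   = val-∙
      ; τ-homo   = val-ω ↑
      ; τ*-homo  = val-ω ↓
      ; κ-homo   = λ E f shuffle → val-shuffle shuffle
      }

  -- From recognition to definability

  module Definability (Q : Pred ℕ 0ℓ) (A : Set) where

    Point : ℕ → Set₁
    Point k = Σ (Word A) λ w → Vec ∣ dom w ∣ k

    infix 3 _⊨_
    _⊨_ : ∀ {k} → Point k → Formula Q A k → Set₁
    (w , s) ⊨ φ = w ⊨[ s ] φ

    Agree : ∀ {k} → List (Formula Q A k) → Point k → Point k → Set₁
    Agree φs p q = ∀ {φ} → φ ∈ₗ φs → (p ⊨ φ) ⇔ (q ⊨ φ)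

    agree-sym : ∀ {k} {φs : List (Formula Q A k)} {p q} → Agree φs p q → Agree φs q p
    agree-sym agree φ∈ = mk⇔ (Equivalence.from (agree φ∈)) (Equivalence.to (agree φ∈))

    -- R p q states that some invariant takes the same value at p and q;
    -- R is determined if this value depends on finitely many formulas.
    Determined : ∀ {k} → (Point k → Point k → Set ℓ) → Set (lsuc 0ℓ ⊔ ℓ)
    Determined R = ∃ λ φs → ∀ {p q} → Agree φs p q → R p q

    module _ {k : ℕ} where
      private
        variable
          R : Point k → Point k → Set ℓ
          P : Point k → Set ℓ

      determined-sym : Determined R → Determined (λ p q → R p q × R q p)
      determined-sym (φs , det) = φs , λ agree → det agree , det (agree-sym agree)

      determined-× : ∀ {R : Point k → Point k → Set ℓ₁} {R′ : Point k → Point k → Set ℓ₂} →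
                     Determined R → Determined R′ → Determined (λ p q → R p q × R′ p q)
      determined-× (φs , det) (ψs , det′) = φs ++ ψs , λ agree →
        det (agree ∘ ∈-++⁺ˡ) , det′ (agree ∘ ∈-++⁺ʳ φs)

      determined-∀ : ∀ m {R : Fin m → Point k → Point k → Set ℓ} →
                     (∀ i → Determined (R i)) → Determined (λ p q → ∀ i → R i p q)
      determined-∀ zero    _   = [] , λ _ ()
      determined-∀ (suc m) det = proj₁ both , λ agree → λ where
          zero    → proj₁ (proj₂ both agree)
          (suc i) → proj₂ (proj₂ both agree) i
        where both = determined-× (det zero) (determined-∀ m (det ∘ suc))

      formula⇒determined : (φ : Formula Q A k) → (∀ p → P p ⇔ (p ⊨ φ)) → Determined (λ p q → P p → P q)
      formula⇒determined φ eq = φ ∷ [] , λ {p} {q} agree x →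
        Equivalence.from (eq q) (Equivalence.to (agree (here refl)) (Equivalence.to (eq p) x))

      truths : List (Formula Q A k) → Point k → List Bool
      truths φs p = List.map (λ φ → does (em {P = p ⊨ φ})) φs

      truths⇒agree : ∀ φs {p q} → truths φs p ≡ truths φs q → Agree φs p q
      truths⇒agree (φ ∷ φs) {p} {q} eq (there φ∈) = truths⇒agree φs (List.∷-injectiveʳ eq) φ∈
      truths⇒agree (φ ∷ φs) {p} {q} eq (here refl) with em {P = p ⊨ φ} | em {P = q ⊨ φ}
      ... | yes pφ | yes qφ = mk⇔ (λ _ → qφ) (λ _ → pφ)
      ... | no ¬pφ | no ¬qφ = mk⇔ (λ pφ → contradiction pφ ¬pφ) (λ qφ → contradiction qφ ¬qφ)
      ... | yes _  | no _   with () ← List.∷-injectiveˡ eq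
      ... | no _   | yes _  with () ← List.∷-injectiveˡ eq

      -- The syntax has no constants and k may be 0, so the formula binds its own variable; it holds
      -- in the empty word as well.
      ⊤′ : Formula Q A k
      ⊤′ = ¬′ ∃′ (zero ≺ zero)

      ⊨⊤′ : ∀ p → p ⊨ ⊤′
      ⊨⊤′ (w , s) (x , lift x<x) = CountableOrder.irrefl (dom w) refl x<x

      truthTable : ∀ φs (V : Pred (List Bool) ℓ) → ∃ λ ψ → ∀ p → V (truths φs p) ⇔ (p ⊨ ψ)
      truthTable [] V with em {P = V []}
      ... | yes v = ⊤′ , λ p → mk⇔ (λ _ → ⊨⊤′ p) (λ _ → v)
      ... | no ¬v = ¬′ ⊤′ , λ p → mk⇔ (λ v → contradiction v ¬v) (λ ¬⊤ → contradiction (⊨⊤′ p) ¬⊤)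
      truthTable (φ ∷ φs) V
        with ψ₁ , eq₁ ← truthTable φs (V ∘ (true ∷_)) | ψ₀ , eq₀ ← truthTable φs (V ∘ (false ∷_)) =
          ((φ ∧′ ψ₁) ∨′ (¬′ φ ∧′ ψ₀)) , eq
        where
        eq : ∀ p → V (truths (φ ∷ φs) p) ⇔ (p ⊨ (φ ∧′ ψ₁) ∨′ (¬′ φ ∧′ ψ₀))
        eq p with em {P = p ⊨ φ}
        ... | yes pφ = mk⇔ (λ v → inj₁ (pφ , Equivalence.to (eq₁ p) v))
                           [ (λ (_ , x) → Equivalence.from (eq₁ p) x) , (λ (¬pφ , _) → contradiction pφ ¬pφ) ]′
        ... | no ¬pφ = mk⇔ (λ v → inj₂ (¬pφ , Equivalence.to (eq₀ p) v))
                           [ (λ (pφ , _) → contradiction pφ ¬pφ) , (λ (_ , x) → Equivalence.from (eq₀ p) x) ]′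

      -- P is a union of classes of points with equal truth values for the listed formulas; the
      -- truth table collects the lists realized by some point of P.
      determined⇒formula : {P : Point k → Set ℓ} → Determined (λ p q → P p → P q) →
                           ∃ λ φ → ∀ p → P p ⇔ (p ⊨ φ)
      determined⇒formula {P = P} (φs , det)
        with ψ , eq ← truthTable φs (λ b → ∃ λ p → truths φs p ≡ b × P p) = ψ , λ p → mk⇔
          (λ x → Equivalence.to (eq p) (p , refl , x))
          (λ pψ → let q , t , x = Equivalence.from (eq p) pψ in det (truths⇒agree φs t) x)

    liftᵣ : ∀ {k m} → (Fin k → Fin m) → Fin (suc k) → Fin (suc m)
    liftᵣ r zero    = zero
    liftᵣ r (suc i) = suc (r i)

    rename : ∀ {k m} → (Fin k → Fin m) → Formula Q A k → Formula Q A m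
    rename r (i ≺ j)    = r i ≺ r j
    rename r (has a i)  = has a (r i)
    rename r (¬′ φ)     = ¬′ rename r φ
    rename r (φ ∧′ ψ)   = rename r φ ∧′ rename r ψ
    rename r (φ ∨′ ψ)   = rename r φ ∨′ rename r ψ
    rename r (∃′ φ)     = ∃′ (rename (liftᵣ r) φ)
    rename r (∃∞ j q φ) = ∃∞ j q (rename (liftᵣ r) φ)

    ⊨-rename : ∀ {k m} (r : Fin k → Fin m) φ {w s t} → (∀ i → lookup s i ≡ lookup t (r i)) →
               (w ⊨[ s ] φ) ⇔ (w ⊨[ t ] rename r φ)
    ⊨-rename r (i ≺ j) {w} eq = mk⇔
      (λ (lift lt) → lift (≡.subst₂ (CountableOrder._<_ (dom w)) (eq i) (eq j) lt))
      (λ (lift lt) → lift (≡.subst₂ (CountableOrder._<_ (dom w)) (sym (eq i)) (sym (eq j)) lt))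
    ⊨-rename r (has a i) {w} eq = mk⇔
      (λ (lift l) → lift (trans (cong (letter w) (sym (eq i))) l))
      (λ (lift l) → lift (trans (cong (letter w) (eq i)) l))
    ⊨-rename r (¬′ φ) eq = mk⇔ (_∘ Equivalence.from (⊨-rename r φ eq)) (_∘ Equivalence.to (⊨-rename r φ eq))
    ⊨-rename r (φ ∧′ ψ) eq = mk⇔
      (λ (x , y) → Equivalence.to (⊨-rename r φ eq) x , Equivalence.to (⊨-rename r ψ eq) y)
      (λ (x , y) → Equivalence.from (⊨-rename r φ eq) x , Equivalence.from (⊨-rename r ψ eq) y)
    ⊨-rename r (φ ∨′ ψ) eq = mk⇔
      [ inj₁ ∘ Equivalence.to (⊨-rename r φ eq) , inj₂ ∘ Equivalence.to (⊨-rename r ψ eq) ]′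
      [ inj₁ ∘ Equivalence.from (⊨-rename r φ eq) , inj₂ ∘ Equivalence.from (⊨-rename r ψ eq) ]′
    ⊨-rename r (∃′ φ) eq = mk⇔
      (λ (x , p) → x , Equivalence.to (⊨-rename (liftᵣ r) φ λ { zero → refl ; (suc i) → eq i }) p)
      (λ (x , p) → x , Equivalence.from (⊨-rename (liftᵣ r) φ λ { zero → refl ; (suc i) → eq i }) p)
    ⊨-rename r (∃∞ j q φ) eq = mk⇔
      (λ (X , rank , p) → X , rank , λ x i →
        Equivalence.to (⊨-rename (liftᵣ r) φ λ { zero → refl ; (suc i) → eq i }) (p x i))
      (λ (X , rank , p) → X , rank , λ x i →
        Equivalence.from (⊨-rename (liftᵣ r) φ λ { zero → refl ; (suc i) → eq i }) (p x i))

    drop₁ : ∀ {k} → Point (2 ℕ.+ k) → Point (suc k)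
    drop₁ (w , y ∷ x ∷ s) = w , y ∷ s

    determined-drop₁ : ∀ {k} {R : Point (suc k) → Point (suc k) → Set ℓ} →
                       Determined R → Determined (λ p q → R (drop₁ p) (drop₁ q))
    determined-drop₁ {k = k} (φs , det) = List.map (rename r) φs , λ {p} {q} agree → det λ {φ} φ∈ →
      let e = agree (∈-map⁺ (rename r) φ∈) in mk⇔
        (λ x → Equivalence.from (⊨-drop₁ φ q) (Equivalence.to e (Equivalence.to (⊨-drop₁ φ p) x)))
        (λ x → Equivalence.from (⊨-drop₁ φ p) (Equivalence.from e (Equivalence.to (⊨-drop₁ φ q) x)))
      where
      r : Fin (suc k) → Fin (2 ℕ.+ k)
      r zero    = zero
      r (suc i) = suc (suc i)
      ⊨-drop₁ : ∀ φ p → (drop₁ p ⊨ φ) ⇔ (p ⊨ rename r φ)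
      ⊨-drop₁ φ (w , y ∷ x ∷ s) = ⊨-rename r φ λ { zero → refl ; (suc i) → refl }

    extend : ∀ {k} (p : Point k) → ∣ dom (proj₁ p) ∣ → Point (suc k)
    extend (w , s) x = w , x ∷ s

    wordAt : ∀ {k} {C : Set} → (Point (suc k) → C) → Point k → Word C
    wordAt F p = word (dom (proj₁ p)) (F ∘ extend p)

    Invariant : ∀ {k} (S : Setoid 0ℓ 0ℓ) → (Point k → Setoid.Carrier S) → Set₁
    Invariant S F = Determined (λ p q → Setoid._≈_ S (F p) (F q))

    -- Quantified over all labellings and all numbers of parameters, because a block product needs
    -- it for labellings by prefix and suffix products, which depend on one more position.
    Evaluable : ⊛-Monoid 0ℓ 0ℓ → Set₁
    Evaluable M = ∀ {k} (F : Point (suc k) → Carrier) → Invariant setoid F → Invariant setoid (π ∘ wordAt F)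
      where open ⊛-Monoid M

    -- By `big⇒pure` the value of the product depends only on which sets of positions with letter
    -- value above i are big at level j. With i + j ≤ n these are finitely many conditions, each one
    -- quantifier ∃^∞_j.
    induces⇒evaluable : ∀ {M n} → Induces M (Δ n) → (∀ {j} → j ≤ n → Q j) → Evaluable M
    induces⇒evaluable {M} {n} induces Q≤ {k} F (φs , detF) =
      proj₁ det , λ agree → let to , from = proj₂ det agree in lv-injective (ℕ.≤-antisym (below to) (below from))
      where
      open ⊛-Monoid M
      open Induced M induces
      S : ℕ → Pred (Point (suc k)) 0ℓ
      S i p = i ℕ.< lv (F p)
      φ : ∀ i → ∃ λ φ → ∀ p → S i p ⇔ (p ⊨ φ)
      φ i = determined⇒formula (φs , λ agree → subst (i ℕ.<_) (lv-cong (detF agree)))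
      Bigᵢ : ℕ → ℕ → Pred (Point k) 0ℓ
      Bigᵢ i j p = Big (dom (proj₁ p)) j (pure (S i ∘ extend p))
      bigᵢ : ∀ i j → Q j → Determined (λ p q → Bigᵢ i j p → Bigᵢ i j q)
      bigᵢ i j q = formula⇒determined (∃∞ j q (proj₁ (φ i))) λ p → mk⇔
        (λ b → let X , rank , X⊂ = Equivalence.from (∃-hasRank⇔big j (S i ∘ extend p)) b in
          X , rank , λ x Xx → Equivalence.to (proj₂ (φ i) (extend p x)) (X⊂ x Xx))
        (λ (X , rank , X⊂) → Equivalence.to (∃-hasRank⇔big j (S i ∘ extend p))
          (X , rank , λ x Xx → Equivalence.from (proj₂ (φ i) (extend p x)) (X⊂ x Xx)))
      Below : Point k → Point k → Set
      Below p q = ∀ (i j : Fin (suc n)) → Bigᵢ (Fin.toℕ i) (Fin.toℕ j) p → Bigᵢ (Fin.toℕ i) (Fin.toℕ j) q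
      det : Determined (λ p q → Below p q × Below q p)
      det = determined-sym (determined-∀ (suc n) λ i → determined-∀ (suc n) λ j →
              bigᵢ _ _ (Q≤ (ℕ.s≤s⁻¹ (Fin.toℕ<n j))))
      below : ∀ {p q} → Below p q → lv (π (wordAt F p)) ≤ lv (π (wordAt F q))
      below {p} {q} below = ℕ.≮⇒≥ λ q<p → ℕ.<-irrefl refl (transfer (ℕ.s≤s⁻¹ (ℕ.≤-trans q<p (lv≤ _))) q<p)
        where
        transfer : ∀ {l} → l ≤ n → l ℕ.< lv (π (wordAt F p)) → l ℕ.< lv (π (wordAt F q))
        transfer {l} l≤n l< with i , j , refl , b ← big⇒pure l (Equivalence.to (<lv⇔big (wordAt F p) l≤n) l<) =
          Equivalence.from (<lv⇔big (wordAt F q) l≤n) (pure⇒big i j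
            (≡.subst₂ (λ i j → Bigᵢ i j p → Bigᵢ i j q) (Fin.toℕ-fromℕ< i<) (Fin.toℕ-fromℕ< j<)
              (below (Fin.fromℕ< i<) (Fin.fromℕ< j<)) b))
          where
          i< : i ℕ.< suc n
          i< = s≤s (ℕ.≤-trans (ℕ.m≤m+n i j) l≤n)
          j< : j ℕ.< suc n
          j< = s≤s (ℕ.≤-trans (ℕ.m≤n+m j i) l≤n)

  -- Finiteness of iterated block products

  Finite : Setoid ℓ₁ ℓ₂ → Set (ℓ₁ ⊔ ℓ₂)
  Finite S = ∃ λ m → Σ[ r ∈ (Fin m → Carrier) ] ∀ x → ∃ λ i → x ≈ r i
    where open Setoid S

  finite-× : ∀ (S T : Setoid 0ℓ 0ℓ) → Finite S → Finite T → Finite (×-setoid S T)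
  finite-× S T (m , r , r-cover) (n , t , t-cover) = m ℕ.* n ,
    (λ k → let i , j = Fin.remQuot n k in r i , t j) , λ (x , y) →
    let i , x≈ = r-cover x; j , y≈ = t-cover y; eq = sym (Fin.remQuot-combine i j) in
    Fin.combine i j , S.trans x≈ (S.reflexive (cong (r ∘ proj₁) eq)) , T.trans y≈ (T.reflexive (cong (t ∘ proj₂) eq))
    where
    module S = Setoid S
    module T = Setoid T

  encoded⇒finite : ∀ (S : Setoid ℓ₁ ℓ₂) {m} → Setoid.Carrier S → (code : Setoid.Carrier S → Fin m) →
                   (∀ {x y} → code x ≡ code y → Setoid._≈_ S x y) → Finite S
  encoded⇒finite S {m} x₀ code inj = m , r , λ x → code x , inj (r-code x)
    where
    r : Fin m → Setoid.Carrier S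
    r i with em {P = ∃ λ x → code x ≡ i}
    ... | yes (x , _) = x
    -- Codes of no element get an arbitrary representative, as only codes that occur are looked up.
    ... | no _        = x₀
    r-code : ∀ x → code x ≡ code (r (code x))
    r-code x with em {P = ∃ λ y → code y ≡ code x}
    ... | yes (_ , eq) = sym eq
    ... | no ¬∃        = contradiction (x , refl) ¬∃

  finite-^ : ∀ (S : Setoid 0ℓ 0ℓ) (N : ⊛-Monoid 0ℓ 0ℓ) → Finite S → Finite (⊛-Monoid.setoid N) →
             Finite (⊛-Monoid.setoid (N ^ S))
  finite-^ S N (m , r , r-cover) (n , t , t-cover) =
    encoded⇒finite (⊛-Monoid.setoid (N ^ S)) (⊛-Monoid.id (N ^ S))
    (λ f → Fin.funToFin (table f)) λ {f} {g} eq x → let i , x≈ = r-cover x in begin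
      f ⟨$⟩ x          ≈⟨ Func.cong f x≈ ⟩
      f ⟨$⟩ r i        ≈⟨ proj₂ (t-cover _) ⟩
      t (table f i)    ≡⟨ cong t (table-≡ {f} {g} eq i) ⟩
      t (table g i)    ≈⟨ proj₂ (t-cover _) ⟨
      g ⟨$⟩ r i        ≈⟨ Func.cong g x≈ ⟨
      g ⟨$⟩ x          ∎
    where
    open SetoidReasoning (⊛-Monoid.setoid N)
    table : Func S (⊛-Monoid.setoid N) → Fin m → Fin n
    table f i = proj₁ (t-cover (f ⟨$⟩ r i))
    table-≡ : ∀ {f g} → Fin.funToFin (table f) ≡ Fin.funToFin (table g) → ∀ i → table f i ≡ table g i
    table-≡ {f} {g} eq i = trans (sym (Fin.finToFun-funToFin (table f) i))
      (trans (cong (λ c → Fin.finToFun c i) eq) (Fin.finToFun-funToFin (table g) i))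

  induces⇒finite : ∀ {M : ⊛-Monoid 0ℓ 0ℓ} {n} → Induces M (Δ n) → Finite (⊛-Monoid.setoid M)
  induces⇒finite {M} {n} induces = encoded⇒finite setoid {m = 2 ℕ.+ n} id (λ x → Fin.fromℕ< (s≤s (lv≤ x)))
    λ {x} {y} eq → lv-injective (trans (sym (Fin.toℕ-fromℕ< (s≤s (lv≤ x))))
      (trans (cong Fin.toℕ eq) (Fin.toℕ-fromℕ< (s≤s (lv≤ y)))))
    where
    open ⊛-Monoid M
    open Induced M induces

  □-finite : ∀ (M N : ⊛-Monoid 0ℓ 0ℓ) → Finite (⊛-Monoid.setoid M) → Finite (⊛-Monoid.setoid N) →
             Finite (⊛-Monoid.setoid (M □ N))
  □-finite M N finM finN = finite-× S (⊛-Monoid.setoid (N ^ ×-setoid S S)) finM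
    (finite-^ (×-setoid S S) N (finite-× S S finM finM) finN)
    where S = ⊛-Monoid.setoid M

  -- Evaluating block products by formulas

  module _ (Q : Pred ℕ 0ℓ) (A : Set) where
    open Definability Q A

    module _ (M : ⊛-Monoid 0ℓ 0ℓ) (evalM : Evaluable M) where
      open ⊛-Monoid M
      open Restriction M

      π-restrict : ∀ {k} → (Point (suc k) → Carrier) → (Point (2 ℕ.+ k) → Set) → Point (suc k) → Carrier
      π-restrict F C (w , x ∷ s) = π (restrict (wordAt F (w , s)) λ y → C (w , y ∷ x ∷ s))

      -- Masking with the identity turns the restricted product into one over the whole word, with
      -- the cutting position as a further parameter, so that evaluability of M applies.
      restriction-invariant : ∀ {k} (F : Point (suc k) → Carrier) → Invariant setoid F →
        (C : Point (2 ℕ.+ k) → Set) → Determined (λ p q → C p → C q) →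
        Invariant setoid (π-restrict F C)
      restriction-invariant {k} F detF C detC = proj₁ det , λ {p} {q} agree →
        ≈-trans (masked p) (≈-trans (proj₂ det agree) (≈-sym (masked q)))
        where
        H : Point (2 ℕ.+ k) → Carrier
        H p = if does (em {P = C p}) then F (drop₁ p) else id
        H-invariant : Invariant setoid H
        H-invariant = proj₁ both , λ {p} {q} agree → cases p q (proj₂ both agree)
          where
          both = determined-× (determined-sym detC) (determined-drop₁ {R = λ p q → F p ≈ F q} detF)
          cases : ∀ p q → ((C p → C q) × (C q → C p)) × F (drop₁ p) ≈ F (drop₁ q) → H p ≈ H q
          cases p q ((p⇒q , q⇒p) , F≈) with em {P = C p} | em {P = C q}
          ... | yes _  | yes _  = F≈
          ... | no _   | no _   = ≈-refl
          ... | yes cp | no ¬cq = contradiction (p⇒q cp) ¬cq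
          ... | no ¬cp | yes cq = contradiction (q⇒p cq) ¬cp
        det = evalM H H-invariant
        masked : ∀ p → π-restrict F C p ≈ π (wordAt H p)
        masked (w , x ∷ s) = ρ-mask (wordAt F (w , s)) (λ y → C (w , y ∷ x ∷ s))

    -- The second component is a function on pairs from M. Finiteness of M leaves finitely many
    -- arguments to evaluate, so finitely many formulas still suffice.
    □-evaluable : ∀ {M N} → Finite (⊛-Monoid.setoid M) → Evaluable M → Evaluable N → Evaluable (M □ N)
    □-evaluable {M} {N} (m , r , r-cover) evalM evalN {k} F detF@(φs , F≈) = proj₁ det , λ {p} {q} agree →
      proj₁ (proj₂ det agree) , λ (m₁ , m₂) →
        let i , m₁≈ = r-cover m₁; j , m₂≈ = r-cover m₂ in
        N.≈-trans (K-cong p (m₁≈ , m₂≈))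
          (N.≈-trans (proj₂ (proj₂ det agree) i j) (N.≈-sym (K-cong q (m₁≈ , m₂≈))))
      where
      module M = ⊛-Monoid M
      module N = ⊛-Monoid N
      F₁ : Point (suc k) → M.Carrier
      F₁ = proj₁ ∘ F
      F₁-invariant : Invariant M.setoid F₁
      F₁-invariant = φs , λ agree → proj₁ (F≈ agree)
      Below Above : Point (2 ℕ.+ k) → Set
      Below (w , y ∷ x ∷ s) = CountableOrder._<_ (dom w) y x
      Above (w , y ∷ x ∷ s) = CountableOrder._<_ (dom w) x y
      Before After : Point (suc k) → M.Carrier
      Before = π-restrict M evalM F₁ Below
      After  = π-restrict M evalM F₁ Above
      Before-invariant : Invariant M.setoid Before
      Before-invariant = restriction-invariant M evalM F₁ F₁-invariant Below
        (formula⇒determined (zero ≺ suc zero) λ { (w , y ∷ x ∷ s) → mk⇔ lift lower })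
      After-invariant : Invariant M.setoid After
      After-invariant = restriction-invariant M evalM F₁ F₁-invariant Above
        (formula⇒determined (suc zero ≺ zero) λ { (w , y ∷ x ∷ s) → mk⇔ lift lower })
      G : M.Carrier × M.Carrier → Point (suc k) → N.Carrier
      G (m₁ , m₂) p = proj₂ (F p) ⟨$⟩ (m₁ M.∙ Before p , After p M.∙ m₂)
      G-invariant : ∀ m → Invariant N.setoid (G m)
      G-invariant (m₁ , m₂) = proj₁ parts , λ {p} {q} agree → let F≈ , B≈ , A≈ = proj₂ parts agree in
        N.≈-trans (proj₂ F≈ _) (Func.cong (proj₂ (F q)) (M.∙-cong M.≈-refl B≈ , M.∙-cong A≈ M.≈-refl))
        where parts = determined-× detF (determined-× Before-invariant After-invariant)
      value-at : M.Carrier × M.Carrier → Point k → N.Carrier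
      value-at m = N.π ∘ wordAt (G m)
      det : Determined (λ p q → M.π (wordAt F₁ p) M.≈ M.π (wordAt F₁ q) ×
                                (∀ i j → value-at (r i , r j) p N.≈ value-at (r i , r j) q))
      det = determined-× (evalM F₁ F₁-invariant)
        (determined-∀ m λ i → determined-∀ m λ j → evalN (G (r i , r j)) (G-invariant (r i , r j)))
      K-cong : ∀ p {a b} → Setoid._≈_ (×-setoid M.setoid M.setoid) a b → value-at a p N.≈ value-at b p
      K-cong p (≈₁ , ≈₂) = N.π-letters λ x →
        Func.cong (proj₂ (F (extend p x))) (M.∙-cong ≈₁ M.≈-refl , M.∙-cong M.≈-refl ≈₂)

    module _ {B : Pred (⊛-Monoid 0ℓ 0ℓ) ℓ}
             (B⇒Δ : ∀ {M} → B M → ∃ λ n → Induces M (Δ n) × (∀ {j} → j ≤ n → Q j)) where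

      product-evaluable : ∀ {M} → FiniteBlockProduct B M → Finite (⊛-Monoid.setoid M) × Evaluable M
      product-evaluable (base {M} b) =
        let n , induces , Q≤ = B⇒Δ b in induces⇒finite {M} induces , induces⇒evaluable {M} induces Q≤
      product-evaluable (_□ᶠ_ {M} {N} b₁ b₂) =
        let finM , evalM = product-evaluable b₁; finN , evalN = product-evaluable b₂ in
        □-finite M N finM finN , □-evaluable {M} {N} finM evalM evalN

      -- A morphism is fixed by its values on letters, as a word is the product of its letters. A
      -- finite alphabet makes the labelling by these values determined by finitely many atomic
      -- formulas.
      recognized⇒definable : (∃ λ k → A ↔ Fin k) → (L : Language A ℓ₁) →
                             RecognizedIn (FiniteBlockProduct B) L → DefinableIn Q L
      recognized⇒definable (k , A↔Fin) L (M , M∈ , h , recognizes) =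
        let φ , eq = determined⇒formula {P = words L ∘ proj₁} (proj₁ invariant , respects-h) in φ , λ w → eq (w , [])
        where
        open ⊛-Monoid M
        open Morphism h
        open Inverse A↔Fin using () renaming (to to index; from to symbol; inverseʳ to symbol-index)
        F : Point 1 → Carrier
        F (w , x ∷ []) = func ⟨$⟩ ⟦ letter w x ⟧
        F-invariant : Invariant setoid F
        F-invariant = proj₁ letters , λ { {w , x ∷ []} {v , y ∷ []} agree →
            reflexive (cong (λ a → func ⟨$⟩ ⟦ a ⟧) (sym (trans
              (proj₂ letters agree (index (letter w x)) (sym (symbol-index refl))) (symbol-index refl)))) }
          where
          Has : Fin k → Point 1 → Set
          Has i (w , x ∷ []) = letter w x ≡ symbol i
          letters : Determined (λ p q → ∀ i → Has i p → Has i q)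
          letters = determined-∀ k λ i →
            formula⇒determined (has (symbol i) zero) λ { (w , x ∷ []) → mk⇔ lift lower }
        invariant = proj₂ (product-evaluable M∈) F F-invariant
        h≈ : ∀ w → func ⟨$⟩ w ≈ π (wordAt F (w , []))
        h≈ w = ≈-trans (Func.cong func {w} {∏ (dom w) (⟦_⟧ ∘ letter w)}
                 (mk≅ (λ x → x , zero) fst< (λ { (x , zero) → x , refl }) , λ _ → refl))
                 (homo (word (dom w) (⟦_⟧ ∘ letter w)))
        respects-h : ∀ {p q} → Agree (proj₁ invariant) p q → words L (proj₁ p) → words L (proj₁ q)
        respects-h {w , []} {v , []} agree w∈ = Equivalence.from (recognizes v)
          (w , w∈ , ≈-trans (h≈ v) (≈-trans (≈-sym (proj₂ invariant agree)) (≈-sym (h≈ w))))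

  -- From definability to recognition

  module Recognition (Q : Pred ℕ 0ℓ) (A : Set) {B : Pred (⊛-Monoid 0ℓ 0ℓ) ℓ}
                     (some : ∃ λ n → B (ΔMonoid n)) (enough : ∀ {j} → Q j → ∃ λ n → j ≤ n × B (ΔMonoid n)) where
    open Definability Q A using (Point; _⊨_; extend)

    -- A point is coded by a word over A × {0,1}ᵏ marking the k positions.
    marks : ∀ {k} ((w , _) : Point k) → ∣ dom w ∣ → Vec Bool k
    marks (w , s) x = Vec.map (λ y → does (em {P = y ≡ x})) s

    marked : ∀ {k} {C : Set} → (A → Vec Bool k → C) → Point k → Word C
    marked h p = word (dom (proj₁ p)) λ x → h (letter (proj₁ p) x) (marks p x)

    -- R is usually a one-way transfer of truth; equality of products is symmetric, so negation is
    -- handled by exchanging p and q.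
    Recognizable : ∀ {k} → (Point k → Point k → Set ℓ₁) → Set _
    Recognizable {k = k} R = Σ[ M ∈ ⊛-Monoid 0ℓ 0ℓ ] let open ⊛-Monoid M in
      FiniteBlockProduct B M × Σ[ h ∈ (A → Vec Bool k → Carrier) ]
      (∀ {p q} → π (marked h p) ≈ π (marked h q) → R p q)

    does-true : {P : Set ℓ₁} → P → does (em {P = P}) ≡ true
    does-true {P = P} p with em {P = P}
    ... | yes _ = refl
    ... | no ¬p = contradiction p ¬p

    does-false : {P : Set ℓ₁} → ¬ P → does (em {P = P}) ≡ false
    does-false {P = P} ¬p with em {P = P}
    ... | yes p = contradiction p ¬p
    ... | no _  = refl

    does⁻ : {P : Set ℓ₁} → does (em {P = P}) ≡ true → P
    does⁻ {P = P} eq with em {P = P}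
    ... | yes p = p

    marks⁺ : ∀ {k} (p : Point k) i → lookup (marks p (lookup (proj₂ p) i)) i ≡ true
    marks⁺ (w , s) i = trans (Vec.lookup-map i _ s) (does-true refl)

    marks⁻ : ∀ {k} (p : Point k) {x} i → lookup (marks p x) i ≡ true → lookup (proj₂ p) i ≡ x
    marks⁻ (w , s) i eq = does⁻ (trans (sym (Vec.lookup-map i _ s)) eq)

    -- On constant functions both actions are trivial, so a block product contains the direct
    -- product.
    recognizable-× : ∀ {k} {R : Point k → Point k → Set ℓ₁} {R′ : Point k → Point k → Set ℓ₂} →
                     Recognizable R → Recognizable R′ → Recognizable (λ p q → R p q × R′ p q)
    recognizable-× (M , M∈ , h , rec) (N , N∈ , h′ , rec′) =
      _ , _□ᶠ_ {M = M} {N} M∈ N∈ ,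
      (λ a b → h a b , record { to = λ _ → h′ a b ; cong = λ _ → ⊛-Monoid.≈-refl N }) ,
      λ {p} {q} (≈₁ , ≈₂) → rec {p} {q} ≈₁ , rec′ {p} {q} (≈₂ (⊛-Monoid.id M , ⊛-Monoid.id M))

    indicator : ∀ {n} → Set ℓ₁ → Maybe (Fin (suc n))
    indicator P = if does (em {P = P}) then just zero else nothing

    indicator-cong : ∀ {n} {P : Set ℓ₁} {P′ : Set ℓ₂} → (P → P′) → (P′ → P) → indicator {n = n} P ≡ indicator P′
    indicator-cong {P = P} {P′} to from with em {P = P} | em {P = P′}
    ... | yes _ | yes _  = refl
    ... | no _  | no _   = refl
    ... | yes p | no ¬p′ = contradiction (to p) ¬p′
    ... | no ¬p | yes p′ = contradiction (from p′) ¬p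

    <level-indicator : ∀ {n l} {P : Set ℓ₁} → (l ℕ.< level {n} (indicator P)) ⇔ (l ≡ 0 × ⌊ P ⌋)
    <level-indicator {l = l} {P} with em {P = P}
    ... | yes _ = mk⇔ (λ { (s≤s z≤n) → refl , _ }) (λ { (refl , _) → s≤s z≤n })
    ... | no _  = mk⇔ (λ ()) (λ ())

    -- One further factor Δ n: the condition C tests a position by its prefix product, marked letter
    -- and suffix product; positions passing the test get the letter 0, and the Δ-product tells at
    -- which levels l ≤ n they are big.
    module Step {M : ⊛-Monoid 0ℓ 0ℓ} (M∈ : FiniteBlockProduct B M) {k} (h : A → Vec Bool k → ⊛-Monoid.Carrier M)
                (C : ⊛-Monoid.Carrier M → A → Vec Bool k → ⊛-Monoid.Carrier M → Set₁)
                (C-resp : ∀ {m₁ m₂ m₁′ m₂′} a b → ⊛-Monoid._≈_ M m₁ m₁′ → ⊛-Monoid._≈_ M m₂ m₂′ →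
                          C m₁ a b m₂ → C m₁′ a b m₂′) where
      open ⊛-Monoid M

      At : (p : Point k) → Pred ∣ dom (proj₁ p) ∣ _
      At p x = C (π (before (marked h p) x)) (letter (proj₁ p) x) (marks p x) (π (after (marked h p) x))

      BigAt : ℕ → Point k → Set
      BigAt l p = Big (dom (proj₁ p)) l (pure (λ x → ⌊ At p x ⌋))

      indicators : ∀ n → Point k → Word (Maybe (Fin (suc n)))
      indicators n p = word (dom (proj₁ p)) λ x → indicator
        -- The outer identities come from evaluating the function component at the pair (id, id).
        (C (id ∙ π (before (marked h p) x)) (letter (proj₁ p) x) (marks p x) (π (after (marked h p) x) ∙ id))

      big⇔ : ∀ {n} p {l} → l ≤ n → (l ℕ.< level (val n (indicators n p))) ⇔ BigAt l p
      big⇔ {n} p {l} l≤n = mk⇔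
        (λ l< → big-mono l (λ i< → let z , c = Equivalence.to <level-indicator i< in
                    z , ⌊⌋⁺ (C-resp _ _ (identityˡ _) (identityʳ _) (⌊⌋⁻ c)))
                  (Equivalence.to (val-represents n (indicators n p) l≤n) l<))
        (λ b → Equivalence.from (val-represents n (indicators n p) l≤n) (big-mono l (λ (z , c) →
                  Equivalence.from <level-indicator
                    (z , ⌊⌋⁺ (C-resp _ _ (≈-sym (identityˡ _)) (≈-sym (identityʳ _)) (⌊⌋⁻ c)))) b))

      step : ∀ {n} → B (ΔMonoid n) → Recognizable (λ p q → ∀ {l} → l ≤ n → BigAt l p → BigAt l q)
      step {n} b = _ , _□ᶠ_ {M = M} {ΔMonoid n} M∈ (base b) ,
        (λ a b → h a b , record
          { to   = λ (m₁ , m₂) → indicator (C m₁ a b m₂)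
          ; cong = λ (≈₁ , ≈₂) → indicator-cong (C-resp a b ≈₁ ≈₂) (C-resp a b (≈-sym ≈₁) (≈-sym ≈₂))
          }) ,
        λ {p} {q} (_ , ≈₂) {l} l≤n big → Equivalence.to (big⇔ q l≤n)
          (subst (λ x → l ℕ.< level x) (≈₂ (id , id)) (Equivalence.from (big⇔ p l≤n) big))

    recognizable-resp : ∀ {k} {R : Point k → Point k → Set ℓ₁} {R′ : Point k → Point k → Set ℓ₂} →
                        (∀ {p q} → R p q → R′ p q) → Recognizable R → Recognizable R′
    recognizable-resp R⇒R′ (M , M∈ , h , rec) = M , M∈ , h , λ {p} {q} eq → R⇒R′ (rec {p} {q} eq)

    has-recognizable : ∀ {k} a (i : Fin k) → Recognizable (λ p q → p ⊨ has a i → q ⊨ has a i)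
    has-recognizable {k} a i = recognizable-resp
      (λ {p} {q} r p⊨ → Equivalence.to (at⇔ q) (r z≤n (Equivalence.from (at⇔ p) p⊨))) (step (proj₂ some))
      where
      open Step {M = ΔMonoid (proj₁ some)} (base (proj₂ some)) {k} (λ _ _ → nothing)
                (λ _ a′ b _ → Lift _ (a′ ≡ a × lookup b i ≡ true)) (λ _ _ _ _ c → c)
      at⇔ : ∀ p → BigAt 0 p ⇔ (p ⊨ has a i)
      at⇔ p = mk⇔
        (λ (x , _ , c) → let lift (la , m) = ⌊⌋⁻ c in lift (trans (cong (letter (proj₁ p)) (marks⁻ p i m)) la))
        (λ (lift la) → lookup (proj₂ p) i , refl , ⌊⌋⁺ (lift (la , marks⁺ p i)))

    -- The first factor gives a prefix a nonidentity value exactly if it contains mark i; the second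
    -- looks for a position with mark j behind such a prefix.
    ≺-recognizable : ∀ {k} (i j : Fin k) → Recognizable (λ p q → p ⊨ (i ≺ j) → q ⊨ (i ≺ j))
    ≺-recognizable {k} i j = recognizable-resp
      (λ {p} {q} r p⊨ → Equivalence.to (at⇔ q) (r z≤n (Equivalence.from (at⇔ p) p⊨))) (step (proj₂ some))
      where
      n = proj₁ some
      h : A → Vec Bool k → Maybe (Fin (suc n))
      h _ b = indicator (lookup b i ≡ true)
      C : Maybe (Fin (suc n)) → A → Vec Bool k → Maybe (Fin (suc n)) → Set₁
      C m₁ _ b _ = Lift _ (0 ℕ.< level m₁ × lookup b j ≡ true)
      C-resp : ∀ {m₁ m₂ m₁′ m₂′} a b → m₁ ≡ m₁′ → m₂ ≡ m₂′ → C m₁ a b m₂ → C m₁′ a b m₂′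
      C-resp _ _ refl _ c = c
      open Step {M = ΔMonoid n} (base (proj₂ some)) {k} h C C-resp
      at⇔ : ∀ p → BigAt 0 p ⇔ (p ⊨ (i ≺ j))
      at⇔ p@(w , s) = mk⇔ to from
        where
        _<ʷ_ = CountableOrder._<_ (dom w)
        to : BigAt 0 p → p ⊨ (i ≺ j)
        to (x , _ , c) with lift (0< , mⱼ) ← ⌊⌋⁻ c
          with (y , [ y<x ]) , wt ← Equivalence.to (val-represents n (before (marked h p) x) z≤n) 0<
          with _ , mᵢ ← Equivalence.to (<level-indicator {P = lookup (marks p y) i ≡ true}) wt =
            lift (≡.subst₂ _<ʷ_ (sym (marks⁻ p i (⌊⌋⁻ mᵢ))) (sym (marks⁻ p j mⱼ)) (recompute em y<x))
        from : p ⊨ (i ≺ j) → BigAt 0 p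
        from (lift lt) = lookup s j , refl , ⌊⌋⁺ (lift
          ( Equivalence.from (val-represents n (before (marked h p) (lookup s j)) z≤n)
              ((lookup s i , [ lt ]) , Equivalence.from <level-indicator (refl , ⌊⌋⁺ (marks⁺ p i)))
          , marks⁺ p j ))

    -- The left factor leaves the quantified variable unmarked everywhere; marking it at x replaces
    -- one letter, so the product for φ is recovered from prefix and suffix. The test asks for some
    -- point with that product satisfying φ, which by recognition of φ is as good as this one.
    quantifier-recognizable : ∀ {k n} {φ : Formula Q A (suc k)} → B (ΔMonoid n) →
      Recognizable (λ p q → p ⊨ φ → q ⊨ φ) →
      Recognizable (λ (p q : Point k) → ∀ {l} → l ≤ n →
        Big (dom (proj₁ p)) l (pure (λ x → ⌊ extend p x ⊨ φ ⌋)) →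
        Big (dom (proj₁ q)) l (pure (λ x → ⌊ extend q x ⊨ φ ⌋)))
    quantifier-recognizable {k} {n} {φ} b (M , M∈ , h , rec) = recognizable-resp
      (λ {p} {q} r {l} l≤n big → big-mono l (λ (z , c) → z , ⌊⌋⁺ (Equivalence.to (at⇔ q _) (⌊⌋⁻ c)))
        (r l≤n (big-mono l (λ (z , c) → z , ⌊⌋⁺ (Equivalence.from (at⇔ p _) (⌊⌋⁻ c))) big))) (step b)
      where
      open ⊛-Monoid M
      open Step M∈ (λ a b → h a (false ∷ b))
        (λ m₁ a b m₂ → ∃ λ p → π (marked h p) ≈ m₁ ∙ (h a (true ∷ b) ∙ m₂) × p ⊨ φ)
        (λ _ _ ≈₁ ≈₂ (p , eq , p⊨) → p , ≈-trans eq (∙-cong ≈₁ (∙-cong ≈-refl ≈₂)) , p⊨)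
      split : ∀ p x → let u = marked (λ a b → h a (false ∷ b)) p in
              π (marked h (extend p x)) ≈
              π (before u x) ∙ (h (letter (proj₁ p) x) (true ∷ marks p x) ∙ π (after u x))
      split p@(w , s) x = ≈-trans (Restriction.π-split M (marked h (extend p x)) x) (∙-cong
        (π-letters λ { (y , [ y<x ]) → mark {y} (does-false λ x≡y → irrefl (sym x≡y) (recompute em y<x)) })
        (∙-cong (mark {x} (does-true refl))
        (π-letters λ { (y , [ x<y ]) → mark {y} (does-false λ x≡y → irrefl x≡y (recompute em x<y)) })))
        where
        open CountableOrder (dom w)  using (irrefl)
        mark : ∀ {y b} → does (em {P = x ≡ y}) ≡ b →
               h (letter w y) (does (em {P = x ≡ y}) ∷ marks p y) ≈ h (letter w y) (b ∷ marks p y)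
        mark {y} eq = reflexive (cong (λ b → h (letter w y) (b ∷ marks p y)) eq)
      at⇔ : ∀ p x → At p x ⇔ (extend p x ⊨ φ)
      at⇔ p x = mk⇔ (λ (q , eq , q⊨) → rec {q} {extend p x} (≈-trans eq (≈-sym (split p x))) q⊨)
        (λ p⊨ → extend p x , split p x , p⊨)

    recognizable : ∀ {k} (φ : Formula Q A k) → Recognizable (λ p q → p ⊨ φ → q ⊨ φ)
    recognizable (i ≺ j)    = ≺-recognizable i j
    recognizable (has a i)  = has-recognizable a i
    recognizable (¬′ φ) with M , M∈ , h , rec ← recognizable φ =
      M , M∈ , h , λ {p} {q} eq ¬p⊨ q⊨ → ¬p⊨ (rec {q} {p} (⊛-Monoid.≈-sym M eq) q⊨)
    recognizable (φ ∧′ ψ)   = recognizable-resp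
      (λ (r , r′) (x , y) → r x , r′ y) (recognizable-× (recognizable φ) (recognizable ψ))
    recognizable (φ ∨′ ψ)   = recognizable-resp
      (λ (r , r′) → [ inj₁ ∘ r , inj₂ ∘ r′ ]′) (recognizable-× (recognizable φ) (recognizable ψ))
    -- Plain existence is bigness at level 0, visible to every Δ n.
    recognizable (∃′ φ)     = recognizable-resp
      (λ r (x , x⊨) → let y , _ , c = r z≤n (x , refl , ⌊⌋⁺ x⊨) in y , ⌊⌋⁻ c)
      (quantifier-recognizable (proj₂ some) (recognizable φ))
    recognizable (∃∞ j q φ) = let n , j≤n , b = enough q in recognizable-resp
      (λ {p} {q} r (X , rank , X⊨) →
        let Y , rank′ , Y⊨ = Equivalence.from (∃-hasRank⇔big j (λ x → ⌊ extend q x ⊨ φ ⌋))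
              (r j≤n (Equivalence.to (∃-hasRank⇔big j (λ x → ⌊ extend p x ⊨ φ ⌋))
                (X , rank , λ x i → ⌊⌋⁺ (X⊨ x i))))
        in Y , rank′ , λ x i → ⌊⌋⁻ (Y⊨ x i))
      (quantifier-recognizable b (recognizable φ))

    definable⇒recognized : (L : Language A ℓ₁) → DefinableIn Q L → RecognizedIn (FiniteBlockProduct B) L
    definable⇒recognized L (φ , eq) with M , M∈ , h , rec ← recognizable φ = M , M∈ , record
        { func = record
          { to   = λ w → π (map symbol w)
          ; cong = λ (ψ , p) → π-cong (ψ , λ x → reflexive (cong symbol (p x)))
          }
        ; homo = λ w → π-∏ (dom w) (map symbol ∘ letter w)
        } , λ w → mk⇔ (λ w∈ → w , w∈ , ≈-refl)
          (λ (v , v∈ , w≈v) → Equivalence.from (eq w)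
            (rec {v , []} {w , []} (≈-sym w≈v) (Equivalence.to (eq v) v∈)))
      where
      open ⊛-Monoid M
      symbol : A → Carrier
      symbol a = h a []

theorem5 : (∀ {ℓ} → ExcludedMiddle ℓ) →
    ∀ {A : Set} → (∃ λ k → A ↔ Fin k) → ∀ {ℓ} (L : Language A ℓ) →
    (∀ n → DefinableIn (_≤ n) L ⇔
    RecognizedIn (FiniteBlockProduct (λ M → Induces M (Δ n))) L)
    × (DefinableIn U L ⇔
    RecognizedIn (FiniteBlockProduct (λ M → ∃ λ n → Induces M (Δ n))) L)
theorem5 em {A} finite-A L =
  (λ n → mk⇔
    (Recognition.definable⇒recognized em (_≤ n) A (n , ΔMonoid-induces em n)
      (λ j≤n → n , j≤n , ΔMonoid-induces em n) L)
    (recognized⇒definable em (_≤ n) A (λ induces → n , induces , λ j≤n → j≤n) finite-A L)) ,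
  mk⇔
    (Recognition.definable⇒recognized em U A (0 , 0 , ΔMonoid-induces em 0)
      (λ {j} _ → j , ℕ.≤-refl , j , ΔMonoid-induces em j) L)
    (recognized⇒definable em U A (λ (n , induces) → n , induces , _) finite-A L)
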